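{- Let $m\ge 3$ be an integer. Then every integer $N\ge 1056m^3$ can be written as $p_{m+2}(x_1)+p_{m+2}(x_2)+2p_{m+2}(x_3)+4p_{m+2}(x_4)$ with $x_1,x_2,x_3,x_4\in\mathbb{N}$.
   Context: $\mathbb{N}=\{0,1,2,\dots\}$. For integers $m\ge1$ and $n$, $p_{m+2}(n)=m\binom n2+n=\frac{mn^2-(m-2)n}{2}$. -}

module Defs where

open import Data.Nat using (ℕ; _+_; _*_)
open import Data.Nat.Combinatorics using (_C_)

-- Generalized polygonal number p_{m+2}(n) = m * binom(n,2) + n, for n ∈ ℕ.
polygonal : ℕ → ℕ → ℕ
polygonal m n = m * (n C 2) + n

{-# OPTIONS --safe #-}

-- Put a = x₁² + x₂² + 2x₃² + 4x₄² and b = x₁ + x₂ + 2x₃ + 4x₄; the sum of polygonal numbers is then m(a - b)/2 + b,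
-- and 8a - b² = (x₁ + x₂ + 2x₃ - 4x₄)² + 2(x₁ + x₂ - 2x₃)² + 4(x₁ - x₂)². Conversely, up to congruence conditions
-- that can be arranged by the choice of b, a solution comes from writing an integer ≡ 2 (mod 4) as a sum of three
-- squares; this needs b² < 8a, and the xᵢ are nonnegative as soon as 7(a - 1) < (b + 1)². For N ≥ 1056m³ both bounds
-- hold for eight consecutive b ≡ N (mod m), which is enough for the congruence conditions.
--
-- Three squares for n = 2l, l odd, without Dirichlet's theorem on primes: let χ be the character of discriminant -8l
-- and r(q) = ∑_{d ∣ q} χ(d). If r(q) ≠ 0, then q = q₁s² with -n a square modulo q₁. By the hyperbola method the sums
-- of r(q) over q ≤ T² in two classes modulo 8l on which χ = 1 differ by at most 2T. The class of 1 contains the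
-- values x² + ny² with 8l ∣ x - 1 and 8l ∣ y, at which r ≥ 1 and which outnumber 2T; hence some q ≡ 2l - 1 has
-- r(q) ≠ 0. It gives an integral positive definite ternary form of determinant 1 representing n, and
-- every such form is equivalent to x² + y² + z².
module Submission where

-- The classical proof takes for q a prime in a residue class, hence needs L(1, χ) ≠ 0. Here q need
-- not be prime: the ternary form has determinant 1 as soon as s²q₁ ≡ -1 modulo n and -n is a square
-- modulo q₁. The class of 2l - 1 = n - 1 provides the first condition, and r(q) ≠ 0 the second, for
-- every q prime to 8l. That this class contains a suitable q follows from a comparison alone. The
-- hyperbola method writes both class sums with the same values χ(d), d ≤ T, and for each d the
-- number of cofactors in either class is one of the same two consecutive integers. The main terms
-- cancel, so no value of L is needed; the class of 1 only has to beat the error 2T. The number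
-- eight comes from the case 4 ∣ b, 4 ∣ m. There the reduction ends in a condition modulo 8 on a
-- polynomial in i, where b = b₀ + mi, and it is met within every full period of i.

module Range where
  open import Algebra.Bundles using (CommutativeMonoid)
  open import Data.Nat as ℕ using (ℕ; zero; suc; s≤s; z≤n; s≤s⁻¹)
  import Data.Nat.Properties as ℕ
  open import Data.Fin as Fin using (Fin; toℕ; fromℕ<)
  open import Data.Fin.Properties using (toℕ<n; toℕ-fromℕ<; toℕ-injective)
  open import Data.Fin.Permutation using (permutation)
  open import Data.Product using (Σ; Σ-syntax; _×_; _,_; proj₁; proj₂)
  open import Function using (_∘_)
  open import Relation.Binary.PropositionalEquality as ≡ using (_≡_)

  -- Sums and products over 1, ..., n in a commutative monoid

  InRange : ℕ → ℕ → Set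
  InRange n i = 1 ℕ.≤ i × i ℕ.≤ n

  1-inRange : ∀ {n} → InRange (suc n) 1
  1-inRange = s≤s z≤n , s≤s z≤n

  suc-inRange : ∀ {n i} → InRange n i → InRange (suc n) (suc i)
  suc-inRange (_ , i≤n) = s≤s z≤n , s≤s i≤n

  index : ∀ {n} k → InRange n k → Σ[ i ∈ Fin n ] suc (toℕ i) ≡ k
  index (suc k) (_ , k<n) = fromℕ< k<n , ≡.cong suc (toℕ-fromℕ< k<n)

  index-range : ∀ {n} (i : Fin n) → InRange n (suc (toℕ i))
  index-range i = s≤s z≤n , toℕ<n i

  module Fold {c ℓ} (M : CommutativeMonoid c ℓ) where
    open CommutativeMonoid M
    open import Algebra.Properties.CommutativeMonoid.Sum M
      using (sum; ∑-distrib-+; sum-permute)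

    ⨁ : ℕ → (ℕ → Carrier) → Carrier
    ⨁ zero f = ε
    ⨁ (suc n) f = f 1 ∙ ⨁ n (f ∘ suc)

    ⨁≈sum : ∀ n f → ⨁ n f ≈ sum {n} (λ i → f (suc (toℕ i)))
    ⨁≈sum zero f = refl
    ⨁≈sum (suc n) f = ∙-congˡ (⨁≈sum n (f ∘ suc))

    ⨁-cong : ∀ n {f g} → (∀ i → InRange n i → f i ≈ g i) → ⨁ n f ≈ ⨁ n g
    ⨁-cong zero h = refl
    ⨁-cong (suc n) h = ∙-cong (h 1 1-inRange)
      (⨁-cong n λ i r → h (suc i) (suc-inRange r))

    ⨁-∙ : ∀ n f g → ⨁ n (λ i → f i ∙ g i) ≈ ⨁ n f ∙ ⨁ n g
    ⨁-∙ n f g = trans (⨁≈sum n _) (trans (∑-distrib-+ {n} _ _) (sym (∙-cong (⨁≈sum n f) (⨁≈sum n g))))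

    ⨁-ε : ∀ n {f} → (∀ i → InRange n i → f i ≈ ε) → ⨁ n f ≈ ε
    ⨁-ε zero h = refl
    ⨁-ε (suc n) h = trans (∙-cong (h 1 1-inRange) (⨁-ε n λ i r → h (suc i) (suc-inRange r))) (identityˡ ε)

    ⨁-comm : ∀ m n (f : ℕ → ℕ → Carrier) →
      ⨁ m (λ i → ⨁ n (f i)) ≈ ⨁ n (λ j → ⨁ m (λ i → f i j))
    ⨁-comm zero n f = sym (⨁-ε n (λ _ _ → refl))
    ⨁-comm (suc m) n f = trans (∙-congˡ (⨁-comm m n (f ∘ suc))) (sym (⨁-∙ n (f 1) _))

    ⨁-split : ∀ m n f → ⨁ (m ℕ.+ n) f ≈ ⨁ m f ∙ ⨁ n (f ∘ (m ℕ.+_))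
    ⨁-split zero n f = sym (identityˡ _)
    ⨁-split (suc m) n f = trans (∙-congˡ (⨁-split m n (f ∘ suc))) (sym (assoc _ _ _))

    ⨁-last : ∀ n f → ⨁ (suc n) f ≈ ⨁ n f ∙ f (suc n)
    ⨁-last n f = ≡.subst (λ k → ⨁ k f ≈ ⨁ n f ∙ f k) (ℕ.+-comm n 1)
      (trans (⨁-split n 1 f) (∙-congˡ (identityʳ _)))

    -- Outside 1, ..., n the maps `π` and `π⁻¹` are arbitrary, as suits maps given by residues. They
    -- are carried over to `Fin n`, where invariance under permutations is known.
    ⨁-permute : ∀ n f (π π⁻¹ : ℕ → ℕ) →
      (∀ i → InRange n i → InRange n (π i)) → (∀ i → InRange n i → InRange n (π⁻¹ i)) →
      (∀ i → InRange n i → π (π⁻¹ i) ≡ i) → (∀ i → InRange n i → π⁻¹ (π i) ≡ i) →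
      ⨁ n (f ∘ π) ≈ ⨁ n f
    ⨁-permute n f π π⁻¹ r r⁻¹ invˡ invʳ = trans (⨁≈sum n _) (trans
      (⨁-cong′ λ i → reflexive (≡.cong f (≡.sym (proj₂ (index _ (r _ (index-range i)))))))
      (trans (sym (sum-permute {n} {n} _ (permutation to from to-from from-to))) (sym (⨁≈sum n f))))
      where
      ⨁-cong′ : ∀ {n} {f g : Fin n → Carrier} → (∀ i → f i ≈ g i) → sum f ≈ sum g
      ⨁-cong′ {zero} h = refl
      ⨁-cong′ {suc n} h = ∙-cong (h Fin.zero) (⨁-cong′ (h ∘ Fin.suc))
      to from : Fin n → Fin n
      to i = proj₁ (index (π (suc (toℕ i))) (r _ (index-range i)))
      from i = proj₁ (index (π⁻¹ (suc (toℕ i))) (r⁻¹ _ (index-range i)))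
      to-eq : ∀ i → suc (toℕ (to i)) ≡ π (suc (toℕ i))
      to-eq i = proj₂ (index (π (suc (toℕ i))) (r _ (index-range i)))
      from-eq : ∀ i → suc (toℕ (from i)) ≡ π⁻¹ (suc (toℕ i))
      from-eq i = proj₂ (index (π⁻¹ (suc (toℕ i))) (r⁻¹ _ (index-range i)))
      to-from : ∀ i → to (from i) ≡ i
      to-from i = toℕ-injective (ℕ.suc-injective
        (≡.trans (to-eq (from i)) (≡.trans (≡.cong π (from-eq i)) (invˡ _ (index-range i)))))
      from-to : ∀ i → from (to i) ≡ i
      from-to i = toℕ-injective (ℕ.suc-injective
        (≡.trans (from-eq (to i)) (≡.trans (≡.cong π⁻¹ (to-eq i)) (invʳ _ (index-range i)))))

module Proof where
  open import Level using (0ℓ)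
  open import Data.Nat as ℕ using (ℕ; zero; suc; s≤s; z≤n; s≤s⁻¹; NonZero; _≤?_)
  import Data.Nat.Properties as ℕ
  import Data.Nat.Divisibility as ℕ
  import Data.Nat.DivMod as ℕ
  import Data.Nat.Tactic.RingSolver as ℕS
  open import Data.Nat.Coprimality using (Coprime; coprime?; coprime-divisor; coprime-Bézout; 1-coprimeTo; prime⇒coprime)
    renaming (sym to coprime-sym)
  open import Data.Nat.Divisibility using (_∣?_)
  open import Data.Nat.GCD using (module Bézout)
  open import Data.Nat.Induction using (<-rec)
  open import Data.Nat.Primality
    using (Prime; euclidsLemma; irreducible[2]; prime⇒irreducible; prime⇒nonTrivial; prime⇒nonZero; ¬prime[1])
  open import Data.Nat.Primality.Factorisation using (factorise)
  import Data.Integer as ℤ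
  open import Data.Integer hiding (suc; NonZero; _≤?_)
  open import Data.Integer.Properties hiding (_≤?_)
  open import Data.Integer.DivMod using (_/ℕ_; _%ℕ_; a≡a%ℕn+[a/ℕn]*n; n%ℕd<d)
  open import Data.Integer.Divisibility.Signed using (∣ᵤ⇒∣; ∣⇒∣ᵤ; divides)
  open import Data.Integer.Tactic.RingSolver
  open import Data.Empty using (⊥; ⊥-elim)
  open import Data.List using (List; []; _∷_; length; replicate)
  open import Data.List.Properties using (length-replicate)
  open import Data.List.Relation.Unary.All using ([]; _∷_)
  open import Data.Product using (∃-syntax; Σ-syntax; _×_; _,_; proj₁; proj₂)
  open import Data.Sum using (_⊎_; inj₁; inj₂)
  open import Function using (_∘_)
  open import Relation.Binary using (Setoid; IsEquivalence)
  open import Relation.Binary.PropositionalEquality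
  open import Relation.Nullary using (Dec; yes; no; ¬_; contradiction)
  open import Relation.Nullary.Decidable using (_⊎-dec_; _×-dec_; from-yes; True; False; toWitness; toWitnessFalse)
  open import Relation.Unary using (Decidable)
  open import Defs
  open Range

  -- Certificates for integer inequalities

  0≤-+ : ∀ {a b} → 0ℤ ≤ a → 0ℤ ≤ b → 0ℤ ≤ a + b
  0≤-+ = +-mono-≤

  0≤-* : ∀ {a b} → 0ℤ ≤ a → 0ℤ ≤ b → 0ℤ ≤ a * b
  0≤-* {+ m} {+ n} _ _ = subst (0ℤ ≤_) (pos-* m n) (+≤+ z≤n)

  0≤-sq : ∀ a → 0ℤ ≤ a * a
  0≤-sq a = subst (0ℤ ≤_) (sym (i*i≡∣i∣*∣i∣ a)) (+≤+ z≤n)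
    where
    i*i≡∣i∣*∣i∣ : ∀ a → a * a ≡ + (∣ a ∣ ℕ.* ∣ a ∣)
    i*i≡∣i∣*∣i∣ (+ n) = sym (pos-* n n)
    i*i≡∣i∣*∣i∣ -[1+ n ] = refl

  -- Pattern of the inequalities below: the ring solver equates a quantity with a combination of
  -- squares and of terms known to be nonnegative. A strict inequality x > 0 is written 0 ≤ x - 1,
  -- and a contradiction arises when such a combination equals a negative numeral.
  0≤-by : ∀ {a b} → a ≡ b → 0ℤ ≤ b → 0ℤ ≤ a
  0≤-by e = subst (0ℤ ≤_) (sym e)

  ¬0≤-[1+_] : ∀ n → 0ℤ ≤ -[1+ n ] → ⊥
  ¬0≤-[1+ n ] ()

  ≤⇒0≤ : ∀ {a b} → a ≤ b → 0ℤ ≤ b - a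
  ≤⇒0≤ = i≤j⇒0≤j-i

  0≤⇒≤ : ∀ {a b} → 0ℤ ≤ b - a → a ≤ b
  0≤⇒≤ = 0≤i-j⇒j≤i

  compare-0≤ : ∀ a b → 0ℤ ≤ b - a ⊎ 0ℤ ≤ a - b - 1ℤ
  compare-0≤ a b with a ℤ.≤? b
  ... | yes p = inj₁ (≤⇒0≤ p)
  ... | no p = inj₂ (0≤-by (lem a b) (≤⇒0≤ (i<j⇒suc[i]≤j (≰⇒> p))))
    where
    lem : ∀ a b → a - b - 1ℤ ≡ a - (1ℤ + b)
    lem = solve-∀

  pos-cancel : ∀ a b → 0ℤ ≤ a - 1ℤ → 0ℤ ≤ a * b - 1ℤ → 0ℤ ≤ b - 1ℤ
  pos-cancel a b pa pab with compare-0≤ 1ℤ b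
  ... | inj₁ p = p
  ... | inj₂ q = ⊥-elim (¬0≤-[1+ 0 ] (subst (0ℤ ≤_) (lem a b)
        (0≤-+ pab (0≤-* (0≤-+ pa (+≤+ z≤n)) q))))
    where
    lem : ∀ a b → (a * b - 1ℤ) + ((a - 1ℤ) + 1ℤ) * (1ℤ - b - 1ℤ) ≡ -1ℤ
    lem = solve-∀

  centred-remainder : ∀ x m → 0ℤ ≤ m - 1ℤ →
    ∃[ κ ] (0ℤ ≤ m - + 2 * (x + κ * m) × 0ℤ ≤ m + + 2 * (x + κ * m))
  centred-remainder x (+ zero) ()
  centred-remainder x (+ suc n) _ = pick (compare-0≤ (+ 2 * r) m)
    where
    m = + suc n
    r = + (x %ℕ suc n)
    q = x /ℕ suc n
    x≡ : x ≡ r + q * m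
    x≡ = a≡a%ℕn+[a/ℕn]*n x (suc n)
    r≤ : 0ℤ ≤ m - r - 1ℤ
    r≤ = 0≤-by (lem m r) (≤⇒0≤ (+≤+ (n%ℕd<d x (suc n))))
      where
      lem : ∀ m r → m - r - 1ℤ ≡ m - (1ℤ + r)
      lem = solve-∀
    r≥ : 0ℤ ≤ r
    r≥ = +≤+ z≤n
    m≥ : 0ℤ ≤ m
    m≥ = +≤+ z≤n
    e₁ : x + (- q) * m ≡ r
    e₁ = trans (cong (λ z → z + (- q) * m) x≡) (lem r q m)
      where
      lem : ∀ r q m → (r + q * m) + (- q) * m ≡ r
      lem = solve-∀
    e₂ : x + (- q - 1ℤ) * m ≡ r - m
    e₂ = trans (cong (λ z → z + (- q - 1ℤ) * m) x≡) (lem r q m)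
      where
      lem : ∀ r q m → (r + q * m) + (- q - 1ℤ) * m ≡ r - m
      lem = solve-∀
    two : 0ℤ ≤ + 2
    two = +≤+ z≤n
    pick : _ → ∃[ κ ] (0ℤ ≤ m - + 2 * (x + κ * m) × 0ℤ ≤ m + + 2 * (x + κ * m))
    pick (inj₁ p) = - q , subst (λ z → 0ℤ ≤ m - + 2 * z) (sym e₁) p
                  , subst (λ z → 0ℤ ≤ m + + 2 * z) (sym e₁) (0≤-+ m≥ (0≤-* two r≥))
    pick (inj₂ p) = - q - 1ℤ
                  , subst (λ z → 0ℤ ≤ m - + 2 * z) (sym e₂) (0≤-by (l₁ m r) (0≤-+ m≥ (0≤-* two (0≤-+ r≤ (+≤+ z≤n)))))
                  , subst (λ z → 0ℤ ≤ m + + 2 * z) (sym e₂) (0≤-by (l₂ m r) (0≤-+ p (+≤+ z≤n)))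
      where
      l₁ : ∀ m r → m - + 2 * (r - m) ≡ m + + 2 * ((m - r - 1ℤ) + 1ℤ)
      l₁ = solve-∀
      l₂ : ∀ m r → m + + 2 * (r - m) ≡ (+ 2 * r - m - 1ℤ) + 1ℤ
      l₂ = solve-∀

  -- Reduction of positive ternary forms of determinant 1

  ℤ³ : Set
  ℤ³ = ℤ × ℤ × ℤ

  infix 7 _·_
  _·_ : ℤ³ → ℤ³ → ℤ
  (x , y , z) · (x′ , y′ , z′) = x * x′ + y * y′ + z * z′

  _-[_]_ : ℤ³ → ℤ → ℤ³ → ℤ³
  (x , y , z) -[ κ ] (x′ , y′ , z′) = x - κ * x′ , y - κ * y′ , z - κ * z′

  ·-comm : ∀ u v → u · v ≡ v · u
  ·-comm (x , y , z) (x′ , y′ , z′) = lem x y z x′ y′ z′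
    where
    lem : ∀ x y z x′ y′ z′ → x * x′ + y * y′ + z * z′ ≡ x′ * x + y′ * y + z′ * z
    lem = solve-∀

  ·-shear : ∀ u κ v w → w · (u -[ κ ] v) ≡ w · u - κ * (w · v)
  ·-shear (x , y , z) κ (x′ , y′ , z′) (a , b , c) = lem x y z κ x′ y′ z′ a b c
    where
    lem : ∀ x y z κ x′ y′ z′ a b c → a * (x - κ * x′) + b * (y - κ * y′) + c * (z - κ * z′)
      ≡ a * x + b * y + c * z - κ * (a * x′ + b * y′ + c * z′)
    lem = solve-∀

  ·-shear² : ∀ u κ v → (u -[ κ ] v) · (u -[ κ ] v) ≡ u · u - + 2 * κ * (v · u) + κ * κ * (v · v)
  ·-shear² (x , y , z) κ (x′ , y′ , z′) = lem x y z κ x′ y′ z′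
    where
    lem : ∀ x y z κ x′ y′ z′ →
      (x - κ * x′) * (x - κ * x′) + (y - κ * y′) * (y - κ * y′) + (z - κ * z′) * (z - κ * z′)
      ≡ x * x + y * y + z * z - + 2 * κ * (x′ * x + y′ * y + z′ * z) + κ * κ * (x′ * x′ + y′ * y′ + z′ * z′)
    lem = solve-∀

  -- The symmetric matrix (a r s; r b t; s t c) is the Gram matrix of three integer vectors.
  Gram : (a b c r s t : ℤ) → Set
  Gram a b c r s t = ∃[ u ] ∃[ v ] ∃[ w ]
    (u · u ≡ a × v · v ≡ b × w · w ≡ c × u · v ≡ r × u · w ≡ s × v · w ≡ t)

  gram-swap₁₂ : ∀ {a b c r s t} → Gram b a c r t s → Gram a b c r s t
  gram-swap₁₂ (u , v , w , a , b , c , r , s , t) =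
    v , u , w , b , a , c , trans (·-comm v u) r , t , s

  gram-swap₂₃ : ∀ {a b c r s t} → Gram a c b s r t → Gram a b c r s t
  gram-swap₂₃ (u , v , w , a , b , c , r , s , t) =
    u , w , v , a , c , b , s , r , trans (·-comm w v) t

  shift : ℤ → ℤ → ℤ → ℤ → ℤ
  shift κ b r a = b + + 2 * κ * r + κ * κ * a

  shift-cancel : ∀ κ b r a → shift κ b r a - + 2 * κ * (r + κ * a) + κ * κ * a ≡ b
  shift-cancel κ b r a = lem κ b r a
    where
    lem : ∀ κ b r a → b + + 2 * κ * r + κ * κ * a - + 2 * κ * (r + κ * a) + κ * κ * a ≡ b
    lem = solve-∀

  unshift : ∀ κ r a → r + κ * a - κ * a ≡ r
  unshift = solve-∀

  -- The reduction passes to a sheared matrix; vectors found for that matrix are carried back by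
  -- replacing v with v - κu.
  gram-shear₁₂ : ∀ {a b c r s t} κ →
    Gram a (shift κ b r a) c (r + κ * a) s (t + κ * s) → Gram a b c r s t
  gram-shear₁₂ {a} {b} {c} {r} {s} {t} κ (u , v , w , refl , B , C , R , refl , T) =
    u , v -[ κ ] u , w , refl
    , trans (·-shear² v κ u) (trans (cong₂ (λ x y → x - + 2 * κ * y + κ * κ * a) B R) (shift-cancel κ b r a))
    , C
    , trans (·-shear v κ u u) (trans (cong (_- κ * a) R) (unshift κ r a))
    , refl
    , trans (·-comm _ w) (trans (·-shear v κ u w) (trans (cong₂ (λ x y → x - κ * y) (trans (·-comm w v) T) (·-comm w u)) (unshift κ t s)))

  gram-shear₂₃ : ∀ {a b c r s t} κ →
    Gram a b (shift κ c t b) r (s + κ * r) (t + κ * b) → Gram a b c r s t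
  gram-shear₂₃ {a} {b} {c} {r} {s} {t} κ (u , v , w , A , refl , C , refl , S , T) =
    u , v , w -[ κ ] v , A , refl
    , trans (·-shear² w κ v) (trans (cong₂ (λ x y → x - + 2 * κ * y + κ * κ * b) C T) (shift-cancel κ c t b))
    , refl
    , trans (·-shear w κ v u) (trans (cong (_- κ * r) S) (unshift κ s r))
    , trans (·-shear w κ v v) (trans (cong (_- κ * b) T) (unshift κ t b))

  det : (a b c r s t : ℤ) → ℤ
  det a b c r s t = a * b * c + + 2 * r * s * t - a * (t * t) - b * (s * s) - c * (r * r)

  -- Sylvester's criterion together with determinant 1.
  record Unimodular⁺ (a b c r s t : ℤ) : Set where
    constructor unimodular⁺
    field
      a≥1 : 0ℤ ≤ a - 1ℤ
      minor≥1 : 0ℤ ≤ a * b - r * r - 1ℤ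
      det≡1 : det a b c r s t ≡ 1ℤ
  open Unimodular⁺

  shear₁₂⁺ : ∀ {a b c r s t} κ → Unimodular⁺ a b c r s t →
    Unimodular⁺ a (shift κ b r a) c (r + κ * a) s (t + κ * s)
  shear₁₂⁺ {a} {b} {c} {r} {s} {t} κ (unimodular⁺ pa pA d) =
    unimodular⁺ pa (0≤-by (l₁ κ a b r) pA) (trans (l₂ κ a b c r s t) d)
    where
    l₁ : ∀ κ a b r → a * (b + + 2 * κ * r + κ * κ * a) - (r + κ * a) * (r + κ * a) - 1ℤ ≡ a * b - r * r - 1ℤ
    l₁ = solve-∀
    l₂ : ∀ κ a b c r s t → let b′ = b + + 2 * κ * r + κ * κ * a; r′ = r + κ * a; t′ = t + κ * s in
      a * b′ * c + + 2 * r′ * s * t′ - a * (t′ * t′) - b′ * (s * s) - c * (r′ * r′)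
      ≡ a * b * c + + 2 * r * s * t - a * (t * t) - b * (s * s) - c * (r * r)
    l₂ = solve-∀

  shear₂₃⁺ : ∀ {a b c r s t} κ → Unimodular⁺ a b c r s t →
    Unimodular⁺ a b (shift κ c t b) r (s + κ * r) (t + κ * b)
  shear₂₃⁺ {a} {b} {c} {r} {s} {t} κ (unimodular⁺ pa pA d) =
    unimodular⁺ pa pA (trans (l₂ κ a b c r s t) d)
    where
    l₂ : ∀ κ a b c r s t → let c′ = c + + 2 * κ * t + κ * κ * b; s′ = s + κ * r; t′ = t + κ * b in
      a * b * c′ + + 2 * r * s′ * t′ - a * (t′ * t′) - b * (s′ * s′) - c′ * (r * r)
      ≡ a * b * c + + 2 * r * s * t - a * (t * t) - b * (s * s) - c * (r * r)
    l₂ = solve-∀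

  1≤⇒0≤ : ∀ a → 0ℤ ≤ a - 1ℤ → 0ℤ ≤ a
  1≤⇒0≤ a p = 0≤-by (lem a) (0≤-+ p (+≤+ z≤n))
    where
    lem : ∀ a → a ≡ a - 1ℤ + 1ℤ
    lem = solve-∀

  ≡0-by : ∀ {x y} → x ≡ y → x - y ≡ 0ℤ
  ≡0-by {x} refl = +-inverseʳ x

  ∣2x∣≤1⇒x≡0 : ∀ x → 0ℤ ≤ 1ℤ - + 2 * x → 0ℤ ≤ 1ℤ + + 2 * x → x ≡ 0ℤ
  ∣2x∣≤1⇒x≡0 (+ zero) _ _ = refl
  ∣2x∣≤1⇒x≡0 +[1+ n ] p _ = ⊥-elim (¬0≤-[1+ 0 ] (0≤-by (lem +[1+ n ]) (0≤-+ p (0≤-* {+ 2} (+≤+ z≤n) (≤⇒0≤ {1ℤ} {+[1+ n ]} (+≤+ (s≤s z≤n)))))))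
    where
    lem : ∀ x → -1ℤ ≡ 1ℤ - + 2 * x + + 2 * (x - 1ℤ)
    lem = solve-∀
  ∣2x∣≤1⇒x≡0 -[1+ n ] _ p = ⊥-elim (¬0≤-[1+ 0 ] (0≤-by (lem -[1+ n ]) (0≤-+ p (0≤-* {+ 2} (+≤+ z≤n) (≤⇒0≤ { -[1+ n ]} { -1ℤ} (-≤- z≤n))))))
    where
    lem : ∀ x → -1ℤ ≡ 1ℤ + + 2 * x + + 2 * (-1ℤ - x)
    lem = solve-∀

  antisym-0≤ : ∀ {x y} → 0ℤ ≤ x - y → 0ℤ ≤ y - x → x ≡ y
  antisym-0≤ p q = ≤-antisym (0≤⇒≤ q) (0≤⇒≤ p)

  -- Base of the descent. |2r| ≤ 1 gives r = 0, so A = b, and 3b² ≤ 4 gives b = 1. Then B = t with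
  -- |2t| ≤ 1, so t = 0, and the determinant c - s² = 1 allows the vectors (1,0,0), (0,1,0),
  -- (s,0,1).
  gram-a≡1 : ∀ b c r s t → 0ℤ ≤ 1ℤ - + 2 * r → 0ℤ ≤ 1ℤ + + 2 * r →
    (let A = 1ℤ * b - r * r; B = 1ℤ * t - r * s) →
    0ℤ ≤ A - + 2 * B → 0ℤ ≤ A + + 2 * B → 0ℤ ≤ + 4 * 1ℤ - + 3 * (A * A) →
    Unimodular⁺ 1ℤ b c r s t → Gram 1ℤ b c r s t
  gram-a≡1 b c r s t r₁ r₂ B₁ B₂ A≤ (unimodular⁺ _ A≥1 d) = go (∣2x∣≤1⇒x≡0 r r₁ r₂)
    where
    e₁ : ∀ b → b - 1ℤ ≡ 1ℤ * b - 0ℤ * 0ℤ - 1ℤ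
    e₁ = solve-∀
    e₂ : ∀ s t → 1ℤ - + 2 * t ≡ 1ℤ * 1ℤ - 0ℤ * 0ℤ - + 2 * (1ℤ * t - 0ℤ * s)
    e₂ = solve-∀
    e₃ : ∀ s t → 1ℤ + + 2 * t ≡ 1ℤ * 1ℤ - 0ℤ * 0ℤ + + 2 * (1ℤ * t - 0ℤ * s)
    e₃ = solve-∀
    e₄ : ∀ s → s * s + 0ℤ * 0ℤ + 1ℤ * 1ℤ ≡ 1ℤ + s * s
    e₄ = solve-∀
    e₅ : ∀ c s → c - s * s ≡ 1ℤ * 1ℤ * c + + 2 * 0ℤ * s * 0ℤ - 1ℤ * (0ℤ * 0ℤ) - 1ℤ * (s * s) - c * (0ℤ * 0ℤ)
    e₅ = solve-∀
    e₆ : ∀ s → 1ℤ * s + 0ℤ * 0ℤ + 0ℤ * 1ℤ ≡ s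
    e₆ = solve-∀
    e₇ : ∀ c s → c - s * s + s * s ≡ c
    e₇ = solve-∀
    b≤1 : r ≡ 0ℤ → 0ℤ ≤ 1ℤ - b
    b≤1 refl with compare-0≤ b 1ℤ
    ... | inj₁ p = p
    ... | inj₂ p = ⊥-elim (¬0≤-[1+ 7 ] (0≤-by (lem b) (0≤-+ A≤ (0≤-* {+ 3} (+≤+ z≤n) (0≤-* p (0≤-+ p (+≤+ (z≤n {4}))))))))
      where
      lem : ∀ b → - + 8 ≡ + 4 * 1ℤ - + 3 * ((1ℤ * b - 0ℤ * 0ℤ) * (1ℤ * b - 0ℤ * 0ℤ)) + + 3 * ((b - 1ℤ - 1ℤ) * (b - 1ℤ - 1ℤ + + 4))
      lem = solve-∀
    go : r ≡ 0ℤ → Gram 1ℤ b c r s t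
    go refl with antisym-0≤ {b} {1ℤ} (0≤-by (e₁ b) A≥1) (b≤1 refl)
    ... | refl with ∣2x∣≤1⇒x≡0 t (0≤-by (e₂ s t) B₁) (0≤-by (e₃ s t) B₂)
    ... | refl = (1ℤ , 0ℤ , 0ℤ) , (0ℤ , 1ℤ , 0ℤ) , (s , 0ℤ , 1ℤ)
      , refl , refl , trans (e₄ s) (trans (cong (_+ s * s) (sym (trans (e₅ c s) d))) (e₇ c s)) , refl , e₆ s , refl

  -- Jacobi's identity AC - B² = a det for the minors A, B, C, at det = 1. Thus (A B; B C) is a
  -- binary form of determinant a, which can be reduced in its turn.
  minors : ∀ a b c r s t → det a b c r s t ≡ 1ℤ →
    (a * b - r * r) * (a * c - s * s) ≡ a + (a * t - r * s) * (a * t - r * s)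
  minors a b c r s t d = trans (lem a b c r s t) (cong (_+ (a * t - r * s) * (a * t - r * s)) (trans (cong (a *_) d) (*-identityʳ a)))
    where
    lem : ∀ a b c r s t → (a * b - r * r) * (a * c - s * s)
      ≡ a * (a * b * c + + 2 * r * s * t - a * (t * t) - b * (s * s) - c * (r * r)) + (a * t - r * s) * (a * t - r * s)
    lem = solve-∀

  -- Hermite reduction: lexicographic descent on a and on the minor A = ab - r².
  gram : ∀ k j a b c r s t → 0ℤ ≤ + k - a → 0ℤ ≤ + j - (a * b - r * r) →
    Unimodular⁺ a b c r s t → Gram a b c r s t
  gram-reduced : ∀ k j a b c r s t → 0ℤ ≤ + suc k - a → 0ℤ ≤ + suc j - (a * b - r * r) →
    0ℤ ≤ a - + 2 * r → 0ℤ ≤ a + + 2 * r →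
    (let A = a * b - r * r; B = a * t - r * s) →
    0ℤ ≤ A - + 2 * B → 0ℤ ≤ A + + 2 * B →
    Unimodular⁺ a b c r s t → Gram a b c r s t

  gram zero j a b c r s t k≥ j≥ U = ⊥-elim (¬0≤-[1+ 0 ] (0≤-by (lem a) (0≤-+ k≥ (a≥1 U))))
    where
    lem : ∀ a → -1ℤ ≡ 0ℤ - a + (a - 1ℤ)
    lem = solve-∀
  gram (suc k) zero a b c r s t k≥ j≥ U = ⊥-elim (¬0≤-[1+ 0 ] (0≤-by (lem (a * b - r * r)) (0≤-+ j≥ (minor≥1 U))))
    where
    lem : ∀ a → -1ℤ ≡ 0ℤ - a + (a - 1ℤ)
    lem = solve-∀
  gram (suc k) (suc j) a b c r s t k≥ j≥ U
    -- `κ` centres r modulo a, and `λ′` centres B = at - rs modulo A. The shear by `κ` fixes A and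
    -- B, the shear by `λ′` fixes a, r and A, so both bounds hold at once.
    = let κ , r₁ , r₂ = centred-remainder r a (a≥1 U)
          λ′ , B₁ , B₂ = centred-remainder (a * t - r * s) (a * b - r * r) (minor≥1 U)
      in gram-shear₂₃ λ′ (gram-shear₁₂ κ (gram-reduced k j a _ _ _ _ _ k≥
        (0≤-by (cong (λ z → + suc j - z) (m₁ κ a b r)) j≥) r₁ r₂
        (0≤-by (cong₂ (λ x y → x - + 2 * y) (m₁ κ a b r) (m₂ λ′ κ a b r s t)) B₁)
        (0≤-by (cong₂ (λ x y → x + + 2 * y) (m₁ κ a b r) (m₂ λ′ κ a b r s t)) B₂)
        (shear₁₂⁺ κ (shear₂₃⁺ λ′ U))))
    where
    m₁ : ∀ κ a b r → a * (b + + 2 * κ * r + κ * κ * a) - (r + κ * a) * (r + κ * a) ≡ a * b - r * r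
    m₁ = solve-∀
    m₂ : ∀ λ′ κ a b r s t → a * (t + λ′ * b + κ * (s + λ′ * r)) - (r + κ * a) * (s + λ′ * r)
       ≡ a * t - r * s + λ′ * (a * b - r * r)
    m₂ = solve-∀

  gram-reduced k j a b c r s t k≥ j≥ r₁ r₂ B₁ B₂ U with compare-0≤ (a * b - r * r) (a * c - s * s)
  ... | inj₂ C<A = gram-swap₂₃ (gram (suc k) j a c b s r t k≥ (0≤-by (e₁ (+ j) A C) (0≤-+ j≥ C<A))
          (unimodular⁺ (a≥1 U) (pos-cancel A C (minor≥1 U) (0≤-by (trans (cong (_- 1ℤ) (minors a b c r s t (det≡1 U))) (e₂ a (B * B))) (0≤-+ (a≥1 U) (0≤-sq B)))) (trans (e₃ a b c r s t) (det≡1 U))))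
    where
    A = a * b - r * r
    B = a * t - r * s
    C = a * c - s * s
    e₁ : ∀ j A C → j - C ≡ 1ℤ + j - A + (A - C - 1ℤ)
    e₁ = solve-∀
    e₂ : ∀ a b → a + b - 1ℤ ≡ a - 1ℤ + b
    e₂ = solve-∀
    e₃ : ∀ a b c r s t → a * c * b + + 2 * s * r * t - a * (t * t) - c * (r * r) - b * (s * s) ≡ a * b * c + + 2 * r * s * t - a * (t * t) - b * (s * s) - c * (r * r)
    e₃ = solve-∀
  ... | inj₁ A≤C = by-a (compare-0≤ a 1ℤ)
    where
    A = a * b - r * r
    B = a * t - r * s
    C = a * c - s * s
    A≥0 : 0ℤ ≤ A
    A≥0 = 1≤⇒0≤ A (minor≥1 U)
    AC≡ : A * C ≡ a + B * B
    AC≡ = minors a b c r s t (det≡1 U)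
    -- A² ≤ AC = a + B² ≤ a + A²/4.
    3A²≤4a : 0ℤ ≤ + 4 * a - + 3 * (A * A)
    3A²≤4a = 0≤-by (trans (e a A B C) (trans (cong (λ z → + 4 * (A * (C - A)) + (A - + 2 * B) * (A + + 2 * B) - + 4 * z) (≡0-by AC≡)) (+-identityʳ _)))
               (0≤-+ (0≤-* {+ 4} (+≤+ z≤n) (0≤-* A≥0 A≤C)) (0≤-* B₁ B₂))
      where
      e : ∀ a A B C → + 4 * a - + 3 * (A * A) ≡ + 4 * (A * (C - A)) + (A - + 2 * B) * (A + + 2 * B) - + 4 * (A * C - (a + B * B))
      e = solve-∀
    by-a : 0ℤ ≤ 1ℤ - a ⊎ 0ℤ ≤ a - 1ℤ - 1ℤ → Gram a b c r s t
    by-a (inj₁ a≤1) with antisym-0≤ {a} {1ℤ} (a≥1 U) a≤1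
    ... | refl = gram-a≡1 b c r s t r₁ r₂ B₁ B₂ 3A²≤4a U
    by-a (inj₂ a≥2) = gram-swap₁₂ (gram k (suc j) b a c r t s
        (0≤-by (f₁ (+ k) a b) (0≤-+ k≥ b<a))
        (0≤-by (cong (λ z → + suc j - (z - r * r)) (*-comm b a)) j≥)
        (unimodular⁺ b≥1 (0≤-by (cong (λ z → z - r * r - 1ℤ) (*-comm b a)) (minor≥1 U)) (trans (f₂ a b c r s t) (det≡1 U))))
      where
      f₁ : ∀ k a b → k - b ≡ 1ℤ + k - a + (a - b - 1ℤ)
      f₁ = solve-∀
      f₂ : ∀ a b c r s t → b * a * c + + 2 * r * t * s - b * (s * s) - a * (t * t) - c * (r * r) ≡ a * b * c + + 2 * r * s * t - a * (t * t) - b * (s * s) - c * (r * r)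
      f₂ = solve-∀
      b≥1 : 0ℤ ≤ b - 1ℤ
      b≥1 = pos-cancel a b (a≥1 U) (0≤-by (e a b r) (0≤-+ (minor≥1 U) (0≤-sq r)))
        where
        e : ∀ a b r → a * b - 1ℤ ≡ a * b - r * r - 1ℤ + r * r
        e = solve-∀
      -- Otherwise a² ≤ ab = A + r² ≤ A + a²/4, so 3a² ≤ 4A. Together with 3A² ≤ 4a, the larger x of
      -- a and A satisfies 3x² ≤ 4x, against x ≥ 2.
      b<a : 0ℤ ≤ a - b - 1ℤ
      b<a with compare-0≤ a b
      ... | inj₂ p = p
      ... | inj₁ a≤b = ⊥-elim (absurd (compare-0≤ A a))
        where
        3a²≤4A : 0ℤ ≤ + 4 * A - + 3 * (a * a)
        3a²≤4A = 0≤-by (e a b r) (0≤-+ (0≤-* {+ 4} (+≤+ z≤n) (0≤-* (1≤⇒0≤ a (a≥1 U)) a≤b)) (0≤-* r₁ r₂))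
          where
          e : ∀ a b r → + 4 * (a * b - r * r) - + 3 * (a * a) ≡ + 4 * (a * (b - a)) + (a - + 2 * r) * (a + + 2 * r)
          e = solve-∀
        small : ∀ x y → 0ℤ ≤ x - 1ℤ - 1ℤ → 0ℤ ≤ x - y → 0ℤ ≤ + 4 * y - + 3 * (x * x) → ⊥
        small x y p q h = ¬0≤-[1+ 3 ] (0≤-by (e x y) (0≤-+ (0≤-+ h (0≤-* {+ 4} (+≤+ z≤n) q)) (0≤-+ (0≤-* {+ 3} (+≤+ z≤n) (0≤-sq (x - 1ℤ - 1ℤ))) (0≤-* {+ 8} (+≤+ z≤n) p))))
          where
          e : ∀ x y → - + 4 ≡ (+ 4 * y - + 3 * (x * x) + + 4 * (x - y)) + (+ 3 * ((x - 1ℤ - 1ℤ) * (x - 1ℤ - 1ℤ)) + + 8 * (x - 1ℤ - 1ℤ))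
          e = solve-∀
        absurd : 0ℤ ≤ a - A ⊎ 0ℤ ≤ A - a - 1ℤ → ⊥
        absurd (inj₁ A≤a) = small a A a≥2 A≤a 3a²≤4A
        absurd (inj₂ a<A) = small A a (0≤-by (g A a) (0≤-+ (0≤-+ a<A a≥2) (+≤+ (z≤n {1})))) (0≤-by (g′ A a) (0≤-+ a<A (+≤+ (z≤n {1})))) 3A²≤4a
          where
          g : ∀ A a → A - 1ℤ - 1ℤ ≡ A - a - 1ℤ + (a - 1ℤ - 1ℤ) + 1ℤ
          g = solve-∀
          g′ : ∀ A a → A - a ≡ A - a - 1ℤ + 1ℤ
          g′ = solve-∀

  unimodular⁺⇒gram : ∀ {a b c r s t} → Unimodular⁺ a b c r s t → Gram a b c r s t
  unimodular⁺⇒gram {a} {b} {c} {r} {s} {t} U =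
    gram ∣ a ∣ ∣ A ∣ a b c r s t (bound (1≤⇒0≤ a (a≥1 U))) (bound (1≤⇒0≤ A (minor≥1 U))) U
    where
    A = a * b - r * r
    bound : ∀ {x} → 0ℤ ≤ x → 0ℤ ≤ + ∣ x ∣ - x
    bound {x} p = ≤⇒0≤ (≤-reflexive (sym (0≤i⇒+∣i∣≡i p)))

  -- Finite sums and products of integers

  open Fold +-0-commutativeMonoid public hiding (⨁≈sum) renaming
    (⨁ to ∑; ⨁-cong to ∑-cong; ⨁-∙ to ∑-+; ⨁-comm to ∑-comm; ⨁-ε to ∑-0; ⨁-split to ∑-split; ⨁-last to ∑-last; ⨁-permute to ∑-permute)
  open Fold *-1-commutativeMonoid public hiding (⨁≈sum) renaming
    (⨁ to ∏; ⨁-cong to ∏-cong; ⨁-∙ to ∏-*; ⨁-comm to ∏-comm; ⨁-ε to ∏-1; ⨁-split to ∏-split; ⨁-last to ∏-last; ⨁-permute to ∏-permute)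

  ∑-*ˡ : ∀ n c f → ∑ n (λ i → c * f i) ≡ c * ∑ n f
  ∑-*ˡ zero c f = sym (*-zeroʳ c)
  ∑-*ˡ (suc n) c f = trans (cong (_+_ (c * f 1)) (∑-*ˡ n c (f ∘ suc))) (sym (*-distribˡ-+ c _ _))

  ∑-mono : ∀ n {f g} → (∀ i → InRange n i → f i ≤ g i) → ∑ n f ≤ ∑ n g
  ∑-mono zero h = ≤-refl
  ∑-mono (suc n) h = +-mono-≤ (h 1 1-inRange) (∑-mono n λ i r → h (suc i) (suc-inRange r))

  ∑-const : ∀ n c → ∑ n (λ _ → c) ≡ + n * c
  ∑-const zero c = sym (*-zeroˡ c)
  ∑-const (suc n) c = trans (cong (λ z → c + z) (∑-const n c))
    (trans (cong (_+ (+ n * c)) (sym (*-identityˡ c))) (sym (*-distribʳ-+ c 1ℤ (+ n))))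

  ∏-const : ∀ n c → ∏ n (λ _ → c) ≡ c ^ n
  ∏-const zero c = refl
  ∏-const (suc n) c = cong (c *_) (∏-const n c)

  -- Iverson bracket. It lets sums over varying conditions run over one fixed range, so that they
  -- can be interchanged.
  ⟦_⟧ : ∀ {P : Set} → Dec P → ℤ
  ⟦ yes _ ⟧ = 1ℤ
  ⟦ no _ ⟧ = 0ℤ

  ⟦⟧-yes : ∀ {P : Set} (d : Dec P) → P → ⟦ d ⟧ ≡ 1ℤ
  ⟦⟧-yes (yes _) p = refl
  ⟦⟧-yes (no ¬p) p = contradiction p ¬p

  ⟦⟧-no : ∀ {P : Set} (d : Dec P) → ¬ P → ⟦ d ⟧ ≡ 0ℤ
  ⟦⟧-no (yes p) ¬p = contradiction p ¬p
  ⟦⟧-no (no _) ¬p = refl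

  ⟦⟧-cong : ∀ {P Q : Set} (d : Dec P) (e : Dec Q) → (P → Q) → (Q → P) → ⟦ d ⟧ ≡ ⟦ e ⟧
  ⟦⟧-cong (yes p) e f g = sym (⟦⟧-yes e (f p))
  ⟦⟧-cong (no ¬p) e f g = sym (⟦⟧-no e (¬p ∘ g))

  ⟦⟧≥0 : ∀ {P : Set} (d : Dec P) → 0ℤ ≤ ⟦ d ⟧
  ⟦⟧≥0 (yes _) = +≤+ z≤n
  ⟦⟧≥0 (no _) = +≤+ z≤n

  ∑-≥0 : ∀ n {f} → (∀ i → InRange n i → 0ℤ ≤ f i) → 0ℤ ≤ ∑ n f
  ∑-≥0 n {f} h = subst (_≤ ∑ n f) (∑-0 n {λ _ → 0ℤ} (λ _ _ → refl)) (∑-mono n h)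

  ∑-extend : ∀ {m n} f → m ℕ.≤ n → (∀ i → m ℕ.< i → i ℕ.≤ n → f i ≡ 0ℤ) → ∑ n f ≡ ∑ m f
  ∑-extend {m} {n} f m≤n h with k , refl ← ℕ.m≤n⇒∃[o]m+o≡n m≤n =
    trans (∑-split m k f)
      (trans (cong (_+_ (∑ m f)) (∑-0 k λ i → λ { (1≤i , i≤k) → h (m ℕ.+ i) (subst (ℕ._≤ m ℕ.+ i) (ℕ.+-comm m 1) (ℕ.+-monoʳ-≤ m 1≤i)) (ℕ.+-monoʳ-≤ m i≤k) }))
        (+-identityʳ _))

  ∑-truncate : ∀ {m n} f → m ℕ.≤ n → ∑ n (λ i → ⟦ i ℕ.≤? m ⟧ * f i) ≡ ∑ m f
  ∑-truncate {m} {n} f m≤n = trans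
    (∑-extend _ m≤n λ i m<i _ → trans (cong (_* f i) (⟦⟧-no (i ℕ.≤? m) (ℕ.<⇒≱ m<i))) (*-zeroˡ (f i)))
    (∑-cong m λ i r → trans (cong (_* f i) (⟦⟧-yes (i ℕ.≤? m) (proj₂ r))) (*-identityˡ (f i)))

  ∑-single : ∀ n k → InRange n k → ∀ f → (∀ i → InRange n i → i ≢ k → f i ≡ 0ℤ) → ∑ n f ≡ f k
  ∑-single (suc n) (suc zero) r f h = trans
    (cong (_+_ (f 1)) (∑-0 n λ i q → h (suc i) (suc-inRange q) λ { refl → contradiction (proj₁ q) λ () }))
    (+-identityʳ _)
  ∑-single (suc n) (suc (suc k)) r f h = trans
    (cong₂ _+_ (h 1 1-inRange λ ()) (∑-single n (suc k) (s≤s z≤n , s≤s⁻¹ (proj₂ r)) (f ∘ suc)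
      λ i q i≢k → h (suc i) (suc-inRange q) λ { refl → i≢k refl }))
    (+-identityˡ _)

  -- Congruences

  infix 4 _≈_[mod_]
  infix 3 _by_ _inverse-by_
  record _≈_[mod_] (a b m : ℤ) : Set where
    constructor _by_
    field
      quotient : ℤ
      equality : a ≡ b + quotient * m

  ≈-reflexive : ∀ {a b m} → a ≡ b → a ≈ b [mod m ]
  ≈-reflexive {a} {m = m} refl = 0ℤ by lem a m
    where
    lem : ∀ a m → a ≡ a + 0ℤ * m
    lem = solve-∀

  ≈-refl : ∀ {a m} → a ≈ a [mod m ]
  ≈-refl = ≈-reflexive refl

  ≈-sym : ∀ {a b m} → a ≈ b [mod m ] → b ≈ a [mod m ]
  ≈-sym {b = b} {m} (k by refl) = (- k) by lem b k m
    where
    lem : ∀ b k m → b ≡ b + k * m + (- k) * m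
    lem = solve-∀

  ≈-trans : ∀ {a b c m} → a ≈ b [mod m ] → b ≈ c [mod m ] → a ≈ c [mod m ]
  ≈-trans {c = c} {m} (k by refl) (l by refl) = (l + k) by lem c k l m
    where
    lem : ∀ c k l m → c + l * m + k * m ≡ c + (l + k) * m
    lem = solve-∀

  +-≈ : ∀ {a b c d m} → a ≈ b [mod m ] → c ≈ d [mod m ] → a + c ≈ b + d [mod m ]
  +-≈ {b = b} {d = d} {m} (k by refl) (l by refl) = (k + l) by lem b d k l m
    where
    lem : ∀ b d k l m → b + k * m + (d + l * m) ≡ b + d + (k + l) * m
    lem = solve-∀

  *-≈ : ∀ {a b c d m} → a ≈ b [mod m ] → c ≈ d [mod m ] → a * c ≈ b * d [mod m ]
  *-≈ {b = b} {d = d} {m} (k by refl) (l by refl) = (b * l + k * d + k * l * m) by lem b d k l m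
    where
    lem : ∀ b d k l m → (b + k * m) * (d + l * m) ≡ b * d + (b * l + k * d + k * l * m) * m
    lem = solve-∀

  *-≈ˡ : ∀ {b c m} a → b ≈ c [mod m ] → a * b ≈ a * c [mod m ]
  *-≈ˡ a = *-≈ (≈-refl {a})

  *-≈ʳ : ∀ {b c m} a → b ≈ c [mod m ] → b * a ≈ c * a [mod m ]
  *-≈ʳ a p = *-≈ p (≈-refl {a})

  ≈-isEquivalence : ∀ m → IsEquivalence (_≈_[mod m ])
  ≈-isEquivalence m = record { refl = ≈-refl ; sym = ≈-sym ; trans = ≈-trans }

  ≈-setoid : ℤ → Setoid 0ℓ 0ℓ
  ≈-setoid m = record { isEquivalence = ≈-isEquivalence m }

  module ≈-Reasoning (m : ℤ) where
    open import Relation.Binary.Reasoning.Setoid (≈-setoid m) public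

  ≈0⇒∣ : ∀ {m a} → a ≈ 0ℤ [mod m ] → ∣ m ∣ ℕ.∣ ∣ a ∣
  ≈0⇒∣ (k by e) = ∣⇒∣ᵤ (divides k (trans e (+-identityˡ _)))

  ∣⇒≈0 : ∀ {m a} → ∣ m ∣ ℕ.∣ ∣ a ∣ → a ≈ 0ℤ [mod m ]
  ∣⇒≈0 d with divides k e ← ∣ᵤ⇒∣ d = k by trans e (sym (+-identityˡ _))

  ≈⇒-≈0 : ∀ {m a b} → a ≈ b [mod m ] → a - b ≈ 0ℤ [mod m ]
  ≈⇒-≈0 {m} {b = b} (k by refl) = k by lem b k m
    where
    lem : ∀ b k m → b + k * m - b ≡ 0ℤ + k * m
    lem = solve-∀

  -≈0⇒≈ : ∀ {m a b} → a - b ≈ 0ℤ [mod m ] → a ≈ b [mod m ]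
  -≈0⇒≈ {m} {a} {b} (k by e) = k by trans (lem a b) (cong (λ z → b + z) (trans e (+-identityˡ _)))
    where
    lem : ∀ a b → a ≡ b + (a - b)
    lem = solve-∀

  euclid-≈0 : ∀ {p} a b → Prime p → a * b ≈ 0ℤ [mod + p ] → a ≈ 0ℤ [mod + p ] ⊎ b ≈ 0ℤ [mod + p ]
  euclid-≈0 {p} a b pp h with euclidsLemma ∣ a ∣ ∣ b ∣ pp (subst (p ℕ.∣_) (abs-* a b) (≈0⇒∣ h))
  ... | inj₁ d = inj₁ (∣⇒≈0 d)
  ... | inj₂ d = inj₂ (∣⇒≈0 d)

  %-≈ : ∀ x m .{{_ : NonZero m}} → + x ≈ + (x ℕ.% m) [mod + m ]
  %-≈ x m = + (x ℕ./ m) by trans (cong (+_) (ℕ.m≡m%n+[m/n]*n x m))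
    (trans (pos-+ (x ℕ.% m) _) (cong (λ z → + (x ℕ.% m) + z) (pos-* (x ℕ./ m) m)))

  %ℕ-≈ : ∀ z m .{{_ : NonZero m}} → z ≈ + (z %ℕ m) [mod + m ]
  %ℕ-≈ z m = (z /ℕ m) by a≡a%ℕn+[a/ℕn]*n z m

  record Unit (m a : ℕ) : Set where
    constructor _inverse-by_
    field
      inverse : ℕ
      isInverse : + a * + inverse ≈ 1ℤ [mod + m ]

  unit : ∀ {a m} .{{_ : NonZero m}} z → + a * z ≈ 1ℤ [mod + m ] → Unit m a
  unit {a} {m} z h = (z %ℕ m) inverse-by ≈-trans (*-≈ˡ (+ a) (≈-sym (%ℕ-≈ z m))) h

  opaque
    coprime⇒unit : ∀ {a m} .{{_ : NonZero m}} → Coprime a m → Unit m a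
    coprime⇒unit {a} {m} c with coprime-Bézout c
    ... | Bézout.+- x y e = unit (+ x) (+ y by trans (*-comm (+ a) (+ x)) (trans (sym (pos-* x a))
            (trans (cong (+_) (sym e)) (trans (pos-+ 1 (y ℕ.* m)) (cong (λ z → 1ℤ + z) (pos-* y m))))))
    ... | Bézout.-+ x y e = unit (- + x) ((- + y) by trans (lem (+ a) (+ x))
            (trans (cong (λ z → 1ℤ - z) e′) (lem′ (+ y) (+ m))))
      where
      e′ : 1ℤ + + x * + a ≡ + y * + m
      e′ = trans (cong (λ z → 1ℤ + z) (sym (pos-* x a))) (trans (sym (pos-+ 1 (x ℕ.* a))) (trans (cong (+_) e) (pos-* y m)))
      lem : ∀ a x → a * (- x) ≡ 1ℤ - (1ℤ + x * a)
      lem = solve-∀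
      lem′ : ∀ y m → 1ℤ - y * m ≡ 1ℤ + (- y) * m
      lem′ = solve-∀

  unit⇒cancel : ∀ {a m} x → Unit m a → + a * x ≈ 0ℤ [mod + m ] → x ≈ 0ℤ [mod + m ]
  unit⇒cancel {a} {m} x (b inverse-by h) p = begin
    x ≡⟨ *-identityˡ x ⟨
    1ℤ * x ≈⟨ *-≈ʳ x h ⟨
    (+ a * + b) * x ≡⟨ lem (+ a) (+ b) x ⟩
    + b * (+ a * x) ≈⟨ *-≈ˡ (+ b) p ⟩
    + b * 0ℤ ≡⟨ *-zeroʳ (+ b) ⟩
    0ℤ ∎
    where
    open ≈-Reasoning (+ m)
    lem : ∀ a b x → a * b * x ≡ b * (a * x)
    lem = solve-∀

  unit-* : ∀ {a b m} → Unit m a → Unit m b → Unit m (a ℕ.* b)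
  unit-* {a} {b} {m} (a′ inverse-by p) (b′ inverse-by q) = (a′ ℕ.* b′) inverse-by ≈-trans (≈-reflexive
    (trans (cong₂ _*_ (pos-* a b) (pos-* a′ b′)) (lem (+ a) (+ b) (+ a′) (+ b′)))) (*-≈ p q)
    where
    lem : ∀ a b a′ b′ → a * b * (a′ * b′) ≡ a * a′ * (b * b′)
    lem = solve-∀

  -- The Jacobi symbol

  IsSign : ℤ → Set
  IsSign ε = ε ≡ 1ℤ ⊎ ε ≡ -1ℤ

  isSign-* : ∀ {ε δ} → IsSign ε → IsSign δ → IsSign (ε * δ)
  isSign-* (inj₁ refl) (inj₁ refl) = inj₁ refl
  isSign-* (inj₁ refl) (inj₂ refl) = inj₂ refl
  isSign-* (inj₂ refl) (inj₁ refl) = inj₂ refl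
  isSign-* (inj₂ refl) (inj₂ refl) = inj₁ refl

  sign² : ∀ {ε} → IsSign ε → ε * ε ≡ 1ℤ
  sign² (inj₁ refl) = refl
  sign² (inj₂ refl) = refl

  sign-∏ : ∀ n {f} → (∀ i → InRange n i → IsSign (f i)) → IsSign (∏ n f)
  sign-∏ zero h = inj₁ refl
  sign-∏ (suc n) h = isSign-* (h 1 1-inRange) (sign-∏ n λ i r → h (suc i) (suc-inRange r))

  par : ℕ → ℤ
  par n = -1ℤ ^ n

  par-+ : ∀ m n → par (m ℕ.+ n) ≡ par m * par n
  par-+ = ^-distribˡ-+-* -1ℤ

  par-sign : ∀ n → IsSign (par n)
  par-sign zero = inj₁ refl
  par-sign (suc n) = isSign-* (inj₂ refl) (par-sign n)

  par² : ∀ n → par n * par n ≡ 1ℤ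
  par² n = sign² (par-sign n)

  par-double : ∀ n → par (n ℕ.+ n) ≡ 1ℤ
  par-double n = trans (par-+ n n) (par² n)

  par-*-odd : ∀ h n → par (suc (h ℕ.+ h) ℕ.* n) ≡ par n
  par-*-odd h n = trans (par-+ n ((h ℕ.+ h) ℕ.* n)) (trans (cong (par n *_) (trans (cong par (ℕ.*-distribʳ-+ n h h)) (par-double (h ℕ.* n)))) (*-identityʳ _))

  par-*-cancel : ∀ n {x} → par n * (par n * x) ≡ x
  par-*-cancel n {x} = trans (sym (*-assoc (par n) (par n) x)) (trans (cong (_* x) (par² n)) (*-identityˡ x))

  small-≈ : ∀ {m x y} → x ℕ.< m → y ℕ.< m → + x ≈ + y [mod + m ] → x ≡ y
  small-≈ {m} {x} {y} x<m y<m p with ∣ + x - + y ∣ in e | ≈0⇒∣ (≈⇒-≈0 p)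
  ... | zero | _ = +-injective (i-j≡0⇒i≡j (+ x) (+ y) (∣i∣≡0⇒i≡0 e))
  ... | suc k | d = contradiction (ℕ.∣⇒≤ d) (ℕ.<⇒≱ (begin-strict
      suc k ≡⟨ e ⟨
      ∣ + x - + y ∣ ≡⟨ cong ∣_∣ ([+m]-[+n]≡m⊖n x y) ⟩
      ∣ x ⊖ y ∣ ≤⟨ ∣m⊝n∣≤m⊔n x y ⟩
      x ℕ.⊔ y <⟨ ℕ.⊔-lub x<m y<m ⟩
      m ∎))
    where open ℕ.≤-Reasoning

  module _ (h : ℕ) where

    private
      m = suc (h ℕ.+ h)

    h<m : h ℕ.< m
    h<m = s≤s (ℕ.m≤m+n h h)

    -- The absolute least residue modulo m, split into its sign and its absolute value.
    absLeast : ℕ → ℤ × ℕ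
    absLeast r with r ≤? h
    ... | yes _ = 1ℤ , r
    ... | no _ = -1ℤ , m ℕ.∸ r

    sgn : ℕ → ℤ
    sgn x = proj₁ (absLeast (x ℕ.% m))

    ρ : ℕ → ℕ
    ρ x = proj₂ (absLeast (x ℕ.% m))

    sgn-sign : ∀ x → IsSign (sgn x)
    sgn-sign x with x ℕ.% m ≤? h
    ... | yes _ = inj₁ refl
    ... | no _ = inj₂ refl

    %-≢0 : ∀ {x} → ¬ (+ x ≈ 0ℤ [mod + m ]) → 1 ℕ.≤ x ℕ.% m
    %-≢0 {x} ¬p with x ℕ.% m in e
    ... | zero = contradiction (≈-trans (%-≈ x m) (≈-reflexive (cong +_ e))) ¬p
    ... | suc _ = s≤s z≤n

    ρ-range : ∀ {x} → ¬ (+ x ≈ 0ℤ [mod + m ]) → InRange h (ρ x)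
    ρ-range {x} ¬p with x ℕ.% m ≤? h
    ... | yes r≤h = %-≢0 ¬p , r≤h
    ... | no r≰h = ℕ.m<n⇒0<n∸m (ℕ.m%n<n x m) ,
          ℕ.≤-trans (ℕ.∸-monoʳ-≤ m (ℕ.≰⇒> r≰h)) (ℕ.≤-reflexive (ℕ.m+n∸m≡n h h))

    absLeast-≈ : ∀ x → + x ≈ sgn x * + ρ x [mod + m ]
    absLeast-≈ x with x ℕ.% m ≤? h
    ... | yes _ = ≈-trans (%-≈ x m) (≈-reflexive (sym (*-identityˡ _)))
    ... | no _ = ≈-trans (%-≈ x m) (1ℤ by trans (lem (+ (x ℕ.% m)) (+ m)) (cong (λ z → -1ℤ * z + 1ℤ * + m)
          (trans ([+m]-[+n]≡m⊖n m (x ℕ.% m)) (⊖-≥ (ℕ.<⇒≤ (ℕ.m%n<n x m))))))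
      where
      lem : ∀ r m → r ≡ -1ℤ * (m - r) + 1ℤ * m
      lem = solve-∀

    -- Opposite signs would give i + j ≡ 0 modulo m, although 0 < i + j < m.
    absLeast-unique : ∀ {ε δ i j} → IsSign ε → IsSign δ → InRange h i → InRange h j →
      ε * + i ≈ δ * + j [mod + m ] → ε ≡ δ × i ≡ j
    absLeast-unique {i = i} {j} s t ri rj p = go s t p
      where
      <m : ∀ {i} → InRange h i → i ℕ.< m
      <m r = ℕ.≤-<-trans (proj₂ r) h<m
      opposite : ∀ i j → InRange h i → InRange h j → ¬ (1ℤ * + i ≈ -1ℤ * + j [mod + m ])
      opposite i j ri rj p = contradiction (small-≈ {m} {i ℕ.+ j} {0} (s≤s (ℕ.+-mono-≤ (proj₂ ri) (proj₂ rj))) (s≤s z≤n) q)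
        (ℕ.m<n⇒n≢0 (ℕ.≤-trans (proj₁ ri) (ℕ.m≤m+n i j)))
        where
        l₁ : ∀ i j → i + j ≡ 1ℤ * i + j
        l₁ = solve-∀
        l₂ : ∀ j → -1ℤ * j + j ≡ 0ℤ
        l₂ = solve-∀
        q : + (i ℕ.+ j) ≈ 0ℤ [mod + m ]
        q = ≈-trans (≈-reflexive (trans (pos-+ i j) (l₁ (+ i) (+ j))))
          (≈-trans (+-≈ p (≈-refl {+ j})) (≈-reflexive (l₂ (+ j))))
      go : ∀ {ε δ} → IsSign ε → IsSign δ → ε * + i ≈ δ * + j [mod + m ] → ε ≡ δ × i ≡ j
      go (inj₁ refl) (inj₁ refl) p = refl , small-≈ (<m ri) (<m rj) (subst₂ (λ x y → x ≈ y [mod + m ]) (*-identityˡ _) (*-identityˡ _) p)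
      go (inj₁ refl) (inj₂ refl) p = contradiction p (opposite i j ri rj)
      go (inj₂ refl) (inj₁ refl) p = contradiction (≈-sym p) (opposite j i rj ri)
      go (inj₂ refl) (inj₂ refl) p = refl , small-≈ (<m ri) (<m rj)
        (subst₂ (λ x y → x ≈ y [mod + m ]) (lem (+ i)) (lem (+ j)) (*-≈ˡ -1ℤ p))
        where
        lem : ∀ i → -1ℤ * (-1ℤ * i) ≡ i
        lem = solve-∀

    range-≉0 : ∀ {i} → InRange h i → ¬ (+ i ≈ 0ℤ [mod + m ])
    range-≉0 (1≤i , i≤h) p = contradiction (small-≈ (ℕ.≤-<-trans i≤h h<m) (s≤s z≤n) p) (ℕ.m<n⇒n≢0 1≤i)

    absLeast-char : ∀ x {ε i} → IsSign ε → InRange h i → + x ≈ ε * + i [mod + m ] → sgn x ≡ ε × ρ x ≡ i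
    absLeast-char x {ε} {i} s r p = absLeast-unique (sgn-sign x) s (ρ-range x≉0) r (≈-trans (≈-sym (absLeast-≈ x)) p)
      where
      x≉0 : ¬ (+ x ≈ 0ℤ [mod + m ])
      x≉0 q = range-≉0 r (≈-trans (≈-reflexive (sym (trans (sym (*-assoc ε ε (+ i))) (trans (cong (_* + i) (sign² s)) (*-identityˡ _)))))
        (≈-trans (*-≈ˡ ε (≈-trans (≈-sym p) q)) (≈-reflexive (*-zeroʳ ε))))

    unit-range-≉0 : ∀ {a i} → Unit m a → InRange h i → ¬ (+ (a ℕ.* i) ≈ 0ℤ [mod + m ])
    unit-range-≉0 {a} {i} u r p = range-≉0 r (unit⇒cancel (+ i) u (subst (_≈ 0ℤ [mod + m ]) (pos-* a i) p))

    -- The Jacobi symbol (a / m) for m = 2h + 1, by the Gauss–Schering lemma.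
    jacobi : ℕ → ℤ
    jacobi a = ∏ h (λ k → sgn (a ℕ.* k))

    jacobi-sign : ∀ a → IsSign (jacobi a)
    jacobi-sign a = sign-∏ h λ i _ → sgn-sign (a ℕ.* i)

    sgn-cong : ∀ x y → x ℕ.% m ≡ y ℕ.% m → sgn x ≡ sgn y
    sgn-cong x y e = cong (proj₁ ∘ absLeast) e

    jacobi-cong : ∀ {a b} → a ℕ.% m ≡ b ℕ.% m → jacobi a ≡ jacobi b
    jacobi-cong {a} {b} e = ∏-cong h λ k _ → sgn-cong (a ℕ.* k) (b ℕ.* k) (trans (ℕ.%-distribˡ-* a k m) (trans (cong (λ z → (z ℕ.* (k ℕ.% m)) ℕ.% m) e) (sym (ℕ.%-distribˡ-* b k m))))

    module _ {b} (u : Unit m b) where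
      private
        b⁻¹ = Unit.inverse u
        u⁻¹ : Unit m b⁻¹
        u⁻¹ = b inverse-by ≈-trans (≈-reflexive (*-comm (+ b⁻¹) (+ b))) (Unit.isInverse u)

        ρ-inverse : ∀ c d (p : + c * + d ≈ 1ℤ [mod + m ]) → Unit m d → ∀ k → InRange h k → ρ (c ℕ.* ρ (d ℕ.* k)) ≡ k
        ρ-inverse c d p u k r = proj₂ (absLeast-char (c ℕ.* ρ (d ℕ.* k)) (sgn-sign (d ℕ.* k)) r (begin
          + (c ℕ.* i) ≡⟨ pos-* c i ⟩
          + c * + i ≡⟨ cong (λ z → + c * z) (sym (trans (sym (*-assoc ε ε (+ i))) (trans (cong (_* + i) (sign² (sgn-sign (d ℕ.* k)))) (*-identityˡ _)))) ⟩
          + c * (ε * (ε * + i)) ≈⟨ *-≈ˡ (+ c) (*-≈ˡ ε (absLeast-≈ (d ℕ.* k))) ⟨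
          + c * (ε * + (d ℕ.* k)) ≡⟨ cong (λ z → + c * (ε * z)) (pos-* d k) ⟩
          + c * (ε * (+ d * + k)) ≡⟨ lem (+ c) ε (+ d) (+ k) ⟩
          (+ c * + d) * (ε * + k) ≈⟨ *-≈ʳ (ε * + k) p ⟩
          1ℤ * (ε * + k) ≡⟨ *-identityˡ _ ⟩
          ε * + k ∎))
          where
          open ≈-Reasoning (+ m)
          i = ρ (d ℕ.* k)
          ε = sgn (d ℕ.* k)
          lem : ∀ c e d k → c * (e * (d * k)) ≡ c * d * (e * k)
          lem = solve-∀

      -- Multiplication by a unit permutes the nonzero classes up to sign; the inverse unit gives
      -- the inverse permutation.
      ∏-ρ : ∀ (f : ℕ → ℤ) → ∏ h (λ k → f (ρ (b ℕ.* k))) ≡ ∏ h f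
      ∏-ρ f = ∏-permute h f (λ k → ρ (b ℕ.* k)) (λ k → ρ (b⁻¹ ℕ.* k))
        (λ k r → ρ-range (unit-range-≉0 u r)) (λ k r → ρ-range (unit-range-≉0 u⁻¹ r))
        (ρ-inverse b b⁻¹ (Unit.isInverse u) u⁻¹) (ρ-inverse b⁻¹ b (Unit.isInverse u⁻¹) u)

      -- The product abk is reduced in two stages: its sign is that of bk times that of a ρ(bk). By
      -- `∏-ρ` the second factors multiply to the symbol of a. Primality of m does not enter.
      jacobi-* : ∀ {a} → Unit m a → jacobi (a ℕ.* b) ≡ jacobi a * jacobi b
      jacobi-* {a} v = begin
        jacobi (a ℕ.* b) ≡⟨ ∏-cong h step ⟩
        ∏ h (λ k → sgn (b ℕ.* k) * sgn (a ℕ.* ρ (b ℕ.* k))) ≡⟨ ∏-* h (λ k → sgn (b ℕ.* k)) _ ⟩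
        jacobi b * ∏ h (λ k → sgn (a ℕ.* ρ (b ℕ.* k))) ≡⟨ cong (jacobi b *_) (∏-ρ (λ k → sgn (a ℕ.* k))) ⟩
        jacobi b * jacobi a ≡⟨ *-comm (jacobi b) (jacobi a) ⟩
        jacobi a * jacobi b ∎
        where
        open ≡-Reasoning
        step : ∀ k → InRange h k → sgn (a ℕ.* b ℕ.* k) ≡ sgn (b ℕ.* k) * sgn (a ℕ.* ρ (b ℕ.* k))
        step k r = proj₁ (absLeast-char (a ℕ.* b ℕ.* k) (isSign-* (sgn-sign (b ℕ.* k)) (sgn-sign (a ℕ.* i)))
          (ρ-range (unit-range-≉0 v (ρ-range (unit-range-≉0 u r)))) chain)
          where
          i = ρ (b ℕ.* k)
          ε = sgn (b ℕ.* k)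
          lem : ∀ a e i → a * (e * i) ≡ e * (a * i)
          lem = solve-∀
          chain : + (a ℕ.* b ℕ.* k) ≈ ε * sgn (a ℕ.* i) * + ρ (a ℕ.* i) [mod + m ]
          chain = ≈-trans (≈-reflexive (trans (cong +_ (ℕ.*-assoc a b k)) (pos-* a (b ℕ.* k))))
            (≈-trans (*-≈ˡ (+ a) (absLeast-≈ (b ℕ.* k)))
            (≈-trans (≈-reflexive (trans (lem (+ a) ε (+ i)) (cong (ε *_) (sym (pos-* a i)))))
            (≈-trans (*-≈ˡ ε (absLeast-≈ (a ℕ.* i)))
            (≈-reflexive (sym (*-assoc ε _ _))))))

      -- Since m is odd, x and ⌊x/m⌋ determine the parity of x mod m, and this is the parity of ρ x
      -- exactly when sgn x = 1. By `∏-ρ` the factors (-1)^ρ(bk) may be replaced with (-1)^k.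
      jacobi-parity : jacobi b ≡ ∏ h (λ k → par (b ℕ.* k) * par k * par (b ℕ.* k ℕ./ m))
      jacobi-parity = begin
        jacobi b ≡⟨ ∏-cong h (λ k r → sgn≡ (b ℕ.* k)) ⟩
        ∏ h (λ k → par (b ℕ.* k) * par (b ℕ.* k ℕ./ m) * par (ρ (b ℕ.* k))) ≡⟨ ∏-* h (λ k → par (b ℕ.* k) * par (b ℕ.* k ℕ./ m)) _ ⟩
        ∏ h (λ k → par (b ℕ.* k) * par (b ℕ.* k ℕ./ m)) * ∏ h (λ k → par (ρ (b ℕ.* k))) ≡⟨ cong (λ z → ∏ h (λ k → par (b ℕ.* k) * par (b ℕ.* k ℕ./ m)) * z) (∏-ρ par) ⟩
        ∏ h (λ k → par (b ℕ.* k) * par (b ℕ.* k ℕ./ m)) * ∏ h par ≡⟨ ∏-* h (λ k → par (b ℕ.* k) * par (b ℕ.* k ℕ./ m)) par ⟨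
        ∏ h (λ k → par (b ℕ.* k) * par (b ℕ.* k ℕ./ m) * par k) ≡⟨ ∏-cong h (λ k _ → lem (par (b ℕ.* k)) (par (b ℕ.* k ℕ./ m)) (par k)) ⟩
        ∏ h (λ k → par (b ℕ.* k) * par k * par (b ℕ.* k ℕ./ m)) ∎
        where
        open ≡-Reasoning
        lem : ∀ x y z → x * y * z ≡ x * z * y
        lem = solve-∀
        par-% : ∀ x → par (x ℕ.% m) ≡ sgn x * par (ρ x)
        par-% x with x ℕ.% m ≤? h
        ... | yes _ = sym (*-identityˡ _)
        ... | no _ = trans (sym (par-*-cancel (m ℕ.∸ r))) (trans (cong (par (m ℕ.∸ r) *_) (trans (sym (par-+ (m ℕ.∸ r) r)) (trans (cong par (ℕ.m∸n+n≡m (ℕ.<⇒≤ (ℕ.m%n<n x m)))) (cong (-1ℤ *_) (par-double h))))) (*-comm (par (m ℕ.∸ r)) -1ℤ))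
          where r = x ℕ.% m
        par-x : ∀ x → par x ≡ sgn x * par (ρ x) * par (x ℕ./ m)
        par-x x = trans (cong par (ℕ.m≡m%n+[m/n]*n x m)) (trans (par-+ (x ℕ.% m) _)
          (cong₂ _*_ (par-% x) (trans (cong par (ℕ.*-comm (x ℕ./ m) m)) (par-*-odd h (x ℕ./ m)))))
        sgn≡ : ∀ x → sgn x ≡ par x * par (x ℕ./ m) * par (ρ x)
        sgn≡ x = sym (trans (cong (λ z → z * par (x ℕ./ m) * par (ρ x)) (par-x x))
          (trans (lem′ (sgn x) (par (ρ x)) (par (x ℕ./ m)))
            (trans (cong₂ (λ y z → sgn x * (y * z)) (par² (ρ x)) (par² (x ℕ./ m))) (*-identityʳ (sgn x)))))
          where
          lem′ : ∀ s x y → s * x * y * y * x ≡ s * (x * x * (y * y))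
          lem′ = solve-∀

  -- Quadratic reciprocity

  -- -1 to the power of the Iverson bracket: a product of such factors counts modulo 2. In `∏-τ-/`
  -- this turns a floor into a number of lattice points.
  τ : ∀ {P : Set} → Dec P → ℤ
  τ (yes _) = -1ℤ
  τ (no _) = 1ℤ

  τ-cong : ∀ {P Q : Set} (d : Dec P) (e : Dec Q) → (P → Q) → (Q → P) → τ d ≡ τ e
  τ-cong (yes p) (yes q) f g = refl
  τ-cong (yes p) (no ¬q) f g = contradiction (f p) ¬q
  τ-cong (no ¬p) (yes q) f g = contradiction (g q) ¬p
  τ-cong (no ¬p) (no ¬q) f g = refl

  τ-exclusive : ∀ x y → x ≢ y → τ (x ≤? y) * τ (y ≤? x) ≡ -1ℤ
  τ-exclusive x y x≢y with x ≤? y | y ≤? x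
  ... | yes p | yes q = contradiction (ℕ.≤-antisym p q) x≢y
  ... | yes p | no _ = refl
  ... | no _ | yes q = refl
  ... | no p | no q = contradiction (ℕ.<⇒≤ (ℕ.≰⇒> p)) q

  ∏-τ : ∀ g q → q ℕ.≤ g → ∏ g (λ j → τ (j ≤? q)) ≡ par q
  ∏-τ g q q≤g with k , refl ← ℕ.m≤n⇒∃[o]m+o≡n q≤g = trans (∏-split q k _) (trans
    (cong₂ _*_
      (trans (∏-cong q λ j r → τ-cong (j ≤? q) (0 ≤? 0) (λ _ → z≤n) (λ _ → proj₂ r)) (∏-const q -1ℤ))
      (∏-1 k λ j r → τ-cong (q ℕ.+ j ≤? q) (1 ≤? 0) (λ p → contradiction p (ℕ.<⇒≱ (ℕ.m<m+n q (proj₁ r)))) (λ ())))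
    (*-identityʳ (par q)))

  ∏-τ-/ : ∀ g m x .{{_ : NonZero m}} → x ℕ./ m ℕ.≤ g → ∏ g (λ j → τ (m ℕ.* j ≤? x)) ≡ par (x ℕ./ m)
  ∏-τ-/ g m x le = trans
    (∏-cong g λ j _ → τ-cong (m ℕ.* j ≤? x) (j ≤? x ℕ./ m)
      (λ p → subst (ℕ._≤ x ℕ./ m) (trans (cong (ℕ._/ m) (ℕ.*-comm m j)) (ℕ.m*n/n≡m j m)) (ℕ./-monoˡ-≤ m p))
      (λ p → ℕ.≤-trans (ℕ.*-monoʳ-≤ m p) (ℕ.≤-trans (ℕ.≤-reflexive (ℕ.*-comm m (x ℕ./ m))) (ℕ.m/n*n≤m x m))))
    (∏-τ g (x ℕ./ m) le)

  odd : ℕ → ℕ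
  odd h = suc (h ℕ.+ h)

  -- Every lattice point counted by the floor lies in the h × g rectangle.
  half-quotient : ∀ g h k → k ℕ.≤ h → odd g ℕ.* k ℕ./ odd h ℕ.≤ g
  half-quotient g h k k≤h = ℕ.m<1+n⇒m≤n (ℕ.m<n*o⇒m/o<n (begin-strict
      odd g ℕ.* k ≤⟨ ℕ.*-monoʳ-≤ (odd g) k≤h ⟩
      odd g ℕ.* h ≡⟨ solve₁ g h ⟩
      h ℕ.+ (g ℕ.* h ℕ.+ g ℕ.* h) <⟨ ℕ.m<m+n _ (s≤s z≤n) ⟩
      h ℕ.+ (g ℕ.* h ℕ.+ g ℕ.* h) ℕ.+ suc (h ℕ.+ g) ≡⟨ solve₂ g h ⟩
      suc g ℕ.* odd h ∎))
    where
    open ℕ.≤-Reasoning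
    solve₁ : ∀ g h → suc (g ℕ.+ g) ℕ.* h ≡ h ℕ.+ (g ℕ.* h ℕ.+ g ℕ.* h)
    solve₁ = ℕS.solve-∀
    solve₂ : ∀ g h → h ℕ.+ (g ℕ.* h ℕ.+ g ℕ.* h) ℕ.+ suc (h ℕ.+ g) ≡ suc g ℕ.* suc (h ℕ.+ h)
    solve₂ = ℕS.solve-∀

  eisenstein : ∀ g h → Unit (odd h) (odd g) →
    jacobi h (odd g) ≡ ∏ h (λ k → ∏ g (λ j → τ (odd h ℕ.* j ≤? odd g ℕ.* k)))
  eisenstein g h u = trans (jacobi-parity h u) (∏-cong h λ k r → begin
      par (odd g ℕ.* k) * par k * par (odd g ℕ.* k ℕ./ odd h) ≡⟨ cong (λ z → z * par k * par (odd g ℕ.* k ℕ./ odd h)) (par-*-odd g k) ⟩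
      par k * par k * par (odd g ℕ.* k ℕ./ odd h) ≡⟨ cong (_* par (odd g ℕ.* k ℕ./ odd h)) (par² k) ⟩
      1ℤ * par (odd g ℕ.* k ℕ./ odd h) ≡⟨ *-identityˡ _ ⟩
      par (odd g ℕ.* k ℕ./ odd h) ≡⟨ ∏-τ-/ g (odd h) (odd g ℕ.* k) (half-quotient g h k (proj₂ r)) ⟨
      ∏ g (λ j → τ (odd h ℕ.* j ≤? odd g ℕ.* k)) ∎)
    where open ≡-Reasoning

  -- Eisenstein's argument: the two symbols count the points of the h × g rectangle on the two sides
  -- of the diagonal. Coprimality keeps all points off the diagonal, so each of the gh points
  -- contributes exactly one factor -1.
  reciprocity : ∀ g h → Unit (odd h) (odd g) → Unit (odd g) (odd h) →
    jacobi h (odd g) * jacobi g (odd h) ≡ par (g ℕ.* h)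
  reciprocity g h u v = begin
    jacobi h (odd g) * jacobi g (odd h)
      ≡⟨ cong₂ _*_ (eisenstein g h u) (eisenstein h g v) ⟩
    ∏ h (λ k → ∏ g (λ j → τ (odd h ℕ.* j ≤? odd g ℕ.* k))) * ∏ g (λ j → ∏ h (λ k → τ (odd g ℕ.* k ≤? odd h ℕ.* j)))
      ≡⟨ cong (λ z → ∏ h (λ k → ∏ g (λ j → τ (odd h ℕ.* j ≤? odd g ℕ.* k))) * z) (∏-comm g h _) ⟩
    ∏ h (λ k → ∏ g (λ j → τ (odd h ℕ.* j ≤? odd g ℕ.* k))) * ∏ h (λ k → ∏ g (λ j → τ (odd g ℕ.* k ≤? odd h ℕ.* j)))
      ≡⟨ ∏-* h _ _ ⟨
    ∏ h (λ k → ∏ g (λ j → τ (odd h ℕ.* j ≤? odd g ℕ.* k)) * ∏ g (λ j → τ (odd g ℕ.* k ≤? odd h ℕ.* j)))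
      ≡⟨ ∏-cong h (λ k r → trans (sym (∏-* g _ _)) (trans (∏-cong g λ j _ → τ-exclusive (odd h ℕ.* j) (odd g ℕ.* k) (distinct j k r)) (∏-const g -1ℤ))) ⟩
    ∏ h (λ _ → par g)
      ≡⟨ ∏-const h (par g) ⟩
    par g ^ h
      ≡⟨ ^-*-assoc -1ℤ g h ⟩
    par (g ℕ.* h) ∎
    where
    open ≡-Reasoning
    distinct : ∀ j k → InRange h k → odd h ℕ.* j ≢ odd g ℕ.* k
    distinct j k r e = unit-range-≉0 h u r (∣⇒≈0 (subst (odd h ℕ.∣_) e (ℕ.m∣m*n j)))

  -- For k ≤ h the quotient of 2k by 2h + 1 is 0, and of the factor in `jacobi-parity` only (-1)^k
  -- is left.
  jacobi-two : ∀ h → Unit (odd h) 2 → jacobi h 2 ≡ ∏ h par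
  jacobi-two h u = trans (jacobi-parity h u) (∏-cong h λ k r → begin
      par (2 ℕ.* k) * par k * par (2 ℕ.* k ℕ./ odd h) ≡⟨ cong₂ (λ x y → x * par k * par y) (trans (cong par (cong (k ℕ.+_) (ℕ.+-identityʳ k))) (par-double k)) (ℕ.m<n⇒m/n≡0 {_} {odd h} (s≤s (ℕ.+-mono-≤ (proj₂ r) (ℕ.≤-trans (ℕ.≤-reflexive (ℕ.+-identityʳ k)) (proj₂ r))))) ⟩
      1ℤ * par k * 1ℤ ≡⟨ trans (*-identityʳ _) (*-identityˡ _) ⟩
      par k ∎)
    where open ≡-Reasoning

  jacobi-minus-one : ∀ h → jacobi h (h ℕ.+ h) ≡ par h
  jacobi-minus-one h = trans (∏-cong h λ k r → proj₁ (absLeast-char h ((h ℕ.+ h) ℕ.* k) (inj₂ refl) r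
      (+ k by trans (pos-* (h ℕ.+ h) k) (trans (lem (+ (h ℕ.+ h)) (+ k)) (cong (λ z → -1ℤ * + k + + k * z) (sym (pos-+ 1 (h ℕ.+ h))))))))
    (∏-const h -1ℤ)
    where
    lem : ∀ x k → x * k ≡ -1ℤ * k + k * (1ℤ + x)
    lem = solve-∀

  -- Roots modulo a prime and Euler's criterion

  -- Horner form of a monic polynomial; the leading coefficient 1 is not stored.
  eval : List ℤ → ℤ → ℤ
  eval [] x = 1ℤ
  eval (c ∷ cs) x = c + x * eval cs x

  divide : ∀ c cs u → Σ[ q ∈ List ℤ ] (length q ≡ length cs ×
    (∀ x → eval (c ∷ cs) x ≡ eval (c ∷ cs) u + (x - u) * eval q x))
  divide c [] u = [] , refl , λ x → lem c u x
    where
    lem : ∀ c u x → c + x * 1ℤ ≡ c + u * 1ℤ + (x - u) * 1ℤ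
    lem = solve-∀
  divide c (d ∷ cs) u with q , e , h ← divide d cs u =
    eval (d ∷ cs) u ∷ q , cong suc e , λ x → trans (cong (λ z → c + x * z) (h x)) (lem c u x (eval (d ∷ cs) u) (eval q x))
    where
    lem : ∀ c u x y z → c + x * (y + (x - u) * z) ≡ c + u * y + (x - u) * (y + x * z)
    lem = solve-∀

  -- Lagrange's bound: the quotient by x - f 1 is monic and vanishes at the other points, because p
  -- divides no f i - f 1 with i > 1.
  too-many-roots : ∀ {p} → Prime p → ∀ n P → length P ≡ n → (f : ℕ → ℤ) →
    (∀ i → InRange (suc n) i → eval P (f i) ≈ 0ℤ [mod + p ]) →
    (∀ i j → InRange (suc n) i → InRange (suc n) j → i ℕ.< j → ¬ (f j ≈ f i [mod + p ])) → ⊥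
  too-many-roots {p} pp zero [] _ f root distinct = ¬prime[1] (subst Prime (ℕ.∣1⇒≡1 (≈0⇒∣ (root 1 1-inRange))) pp)
  too-many-roots {p} pp (suc n) (c ∷ cs) l f root distinct with divide c cs (f 1)
  ... | q , e , h = too-many-roots pp n q (trans e (ℕ.suc-injective l)) (f ∘ suc) root′
      λ i j ri rj i<j → distinct (suc i) (suc j) (up ri) (up rj) (s≤s i<j)
    where
    up : ∀ {i} → InRange (suc n) i → InRange (suc (suc n)) (suc i)
    up (_ , i≤) = s≤s z≤n , s≤s i≤
    root₁ = root 1 1-inRange
    root′ : ∀ i → InRange (suc n) i → eval q (f (suc i)) ≈ 0ℤ [mod + p ]
    root′ i r with euclid-≈0 (f (suc i) - f 1) (eval q (f (suc i))) pp (≈-trans (≈-trans (≈-reflexive (sym (+-identityˡ _))) (+-≈ (≈-sym root₁) ≈-refl)) (≈-trans (≈-reflexive (sym (h (f (suc i))))) (root (suc i) (up r))))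
    ... | inj₁ p = contradiction (-≈0⇒≈ p) (distinct 1 (suc i) 1-inRange (up r) (s≤s (proj₁ r)))
    ... | inj₂ p = p

  eval-power : ∀ h x → eval (-1ℤ ∷ replicate h 0ℤ) x ≡ x ^ suc h - 1ℤ
  eval-power h x = trans (+-comm -1ℤ (x * eval (replicate h 0ℤ) x)) (cong (λ z → x * z - 1ℤ) (go h))
    where
    go : ∀ h → eval (replicate h 0ℤ) x ≡ x ^ h
    go zero = refl
    go (suc h) = trans (+-identityˡ _) (cong (x *_) (go h))

  ∏-≈ : ∀ {m} n {f g} → (∀ i → InRange n i → f i ≈ g i [mod m ]) → ∏ n f ≈ ∏ n g [mod m ]
  ∏-≈ zero h = ≈-refl
  ∏-≈ (suc n) h = *-≈ (h 1 1-inRange) (∏-≈ n λ i r → h (suc i) (suc-inRange r))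

  ∏-cancel : ∀ {p} → Prime p → ∀ n f x → (∀ i → InRange n i → ¬ (f i ≈ 0ℤ [mod + p ])) →
    ∏ n f * x ≈ 0ℤ [mod + p ] → x ≈ 0ℤ [mod + p ]
  ∏-cancel pp zero f x h p = ≈-trans (≈-reflexive (sym (*-identityˡ x))) p
  ∏-cancel pp (suc n) f x h p with euclid-≈0 (f 1) (∏ n (f ∘ suc) * x) pp (≈-trans (≈-reflexive (sym (*-assoc (f 1) _ x))) p)
  ... | inj₁ q = contradiction q (h 1 1-inRange)
  ... | inj₂ q = ∏-cancel pp n (f ∘ suc) x (λ i r → h (suc i) (suc-inRange r)) q

  ≈⇒%≡ : ∀ {m} a b .{{_ : NonZero m}} → + a ≈ + b [mod + m ] → a ℕ.% m ≡ b ℕ.% m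
  ≈⇒%≡ {m} a b p = small-≈ (ℕ.m%n<n a m) (ℕ.m%n<n b m) (≈-trans (≈-sym (%-≈ a m)) (≈-trans p (%-≈ b m)))

  module _ (h : ℕ) where
    private p = odd h

    jacobi-square : ∀ {a} x → Unit p a → x * x ≈ + a [mod + p ] → jacobi h a ≡ 1ℤ
    jacobi-square {a} x u e = trans (jacobi-cong h {a} {z ℕ.* z} (≈⇒%≡ a (z ℕ.* z) (≈-sym zz≈a)))
      (trans (jacobi-* h v v) (sign² (jacobi-sign h z)))
      where
      z = x %ℕ p
      x≈z : x ≈ + z [mod + p ]
      x≈z = %ℕ-≈ x p
      zz≈a : + (z ℕ.* z) ≈ + a [mod + p ]
      zz≈a = ≈-trans (≈-reflexive (pos-* z z)) (≈-trans (*-≈ (≈-sym x≈z) (≈-sym x≈z)) e)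
      v : Unit p z
      v = unit (+ z * + Unit.inverse u) (≈-trans (≈-reflexive (trans (sym (*-assoc (+ z) (+ z) _)) (cong (_* + Unit.inverse u) (sym (pos-* z z))))) (≈-trans (*-≈ʳ _ zz≈a) (Unit.isInverse u)))

    module _ (pp : Prime p) where

      -- The product of ak over k ≤ h is a^h h!, and through absolute least residues it is also
      -- `jacobi h a` times h!. The prime p does not divide h!.
      euler : ∀ {a} → Unit p a → (+ a) ^ h ≈ jacobi h a [mod + p ]
      euler {a} u = -≈0⇒≈ (∏-cancel pp h (λ k → + k) ((+ a) ^ h - jacobi h a) (λ i r → range-≉0 h r)
        (≈-trans (≈-reflexive (lem (∏ h (λ k → + k)) ((+ a) ^ h) (jacobi h a))) (≈⇒-≈0 chain)))
        where
        lem : ∀ f x y → f * (x - y) ≡ x * f - y * f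
        lem = solve-∀
        open ≈-Reasoning (+ p)
        chain : (+ a) ^ h * ∏ h (λ k → + k) ≈ jacobi h a * ∏ h (λ k → + k) [mod + p ]
        chain = begin
          (+ a) ^ h * ∏ h (λ k → + k) ≡⟨ cong (_* ∏ h (λ k → + k)) (∏-const h (+ a)) ⟨
          ∏ h (λ _ → + a) * ∏ h (λ k → + k) ≡⟨ ∏-* h _ _ ⟨
          ∏ h (λ k → + a * + k) ≡⟨ ∏-cong h (λ k _ → pos-* a k) ⟨
          ∏ h (λ k → + (a ℕ.* k)) ≈⟨ ∏-≈ h (λ k _ → absLeast-≈ h (a ℕ.* k)) ⟩
          ∏ h (λ k → sgn h (a ℕ.* k) * + ρ h (a ℕ.* k)) ≡⟨ ∏-* h (λ k → sgn h (a ℕ.* k)) (λ k → + ρ h (a ℕ.* k)) ⟩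
          jacobi h a * ∏ h (λ k → + ρ h (a ℕ.* k)) ≡⟨ cong (jacobi h a *_) (∏-ρ h u (λ k → + k)) ⟩
          jacobi h a * ∏ h (λ k → + k) ∎

      -- By `euler` the numbers 1², ..., h² and a are roots of x^h - 1. If a were no square, these h
      -- + 1 roots would be incongruent. The function `f` lists them, with a in place h + 1.
      jacobi≡1⇒square : ∀ {a} → Unit p a → jacobi h a ≡ 1ℤ → ∃[ x ] + x * + x ≈ + a [mod + p ]
      jacobi≡1⇒square {a} u J≡1 with ℕ.anyUpTo? (λ k → (k ℕ.* k) ℕ.% p ℕ.≟ a ℕ.% p) (suc h)
      ... | yes (k , _ , e) = k , ≈-trans (≈-reflexive (sym (pos-* k k))) (≈-trans (%-≈ (k ℕ.* k) p) (≈-trans (≈-reflexive (cong +_ e)) (≈-sym (%-≈ a p))))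
      ... | no none = ⊥-elim (impossible h refl)
        where
        f : ℕ → ℤ
        f i with i ≤? h
        ... | yes _ = + (i ℕ.* i)
        ... | no _ = + a
        f-≤ : ∀ {i} → i ℕ.≤ h → f i ≡ + (i ℕ.* i)
        f-≤ {i} le with i ≤? h
        ... | yes _ = refl
        ... | no n = contradiction le n
        f-> : f (suc h) ≡ + a
        f-> with suc h ≤? h
        ... | yes le = contradiction le ℕ.1+n≰n
        ... | no _ = refl
        cases : ∀ {i} → InRange (suc h) i → InRange h i ⊎ i ≡ suc h
        cases {i} (1≤i , i≤) with ℕ.m≤n⇒m<n∨m≡n i≤
        ... | inj₁ i< = inj₁ (1≤i , ℕ.≤-pred i<)
        ... | inj₂ e = inj₂ e
        unit-range : ∀ {i} → InRange h i → Unit p i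
        unit-range {i} r = coprime⇒unit (coprime-sym (prime⇒coprime pp {{ℕ.>-nonZero (proj₁ r)}} (ℕ.≤-<-trans (proj₂ r) (h<m h))))
        f-power : ∀ i → InRange (suc h) i → f i ^ h ≈ 1ℤ [mod + p ]
        f-power i r with cases r
        ... | inj₁ r′ rewrite f-≤ (proj₂ r′) = ≈-trans (euler (unit-* (unit-range r′) (unit-range r′)))
                (≈-reflexive (trans (jacobi-* h (unit-range r′) (unit-range r′)) (sign² (jacobi-sign h i))))
        ... | inj₂ refl rewrite f-> = ≈-trans (euler u) (≈-reflexive J≡1)
        f-distinct : ∀ i j → InRange (suc h) i → InRange (suc h) j → i ℕ.< j → ¬ (f j ≈ f i [mod + p ])
        f-distinct i j ri rj i<j e with cases ri | cases rj
        ... | inj₁ ri′ | inj₂ refl rewrite f-≤ (proj₂ ri′) | f-> = none (i , s≤s (proj₂ ri′) , ≈⇒%≡ (i ℕ.* i) a (≈-sym e))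
        ... | inj₂ refl | inj₁ rj′ = contradiction (ℕ.≤-trans (ℕ.n≤1+n _) (ℕ.≤-trans i<j (proj₂ rj′))) ℕ.1+n≰n
        ... | inj₂ refl | inj₂ refl = ℕ.<-irrefl refl i<j
        ... | inj₁ ri′ | inj₁ rj′ rewrite f-≤ (proj₂ ri′) | f-≤ (proj₂ rj′)
          with euclid-≈0 (+ j - + i) (+ j + + i) pp (≈-trans (≈-reflexive (trans (lem (+ j) (+ i)) (sym (cong₂ _-_ (pos-* j j) (pos-* i i))))) (≈⇒-≈0 e))
          where
          lem : ∀ j i → (j - i) * (j + i) ≡ j * j - i * i
          lem = solve-∀
        ... | inj₁ q = ℕ.<-irrefl (sym (small-≈ (ℕ.≤-<-trans (proj₂ rj′) (h<m h)) (ℕ.≤-<-trans (proj₂ ri′) (h<m h)) (-≈0⇒≈ q))) i<j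
        ... | inj₂ q = contradiction (small-≈ {p} {j ℕ.+ i} {0} (s≤s (ℕ.+-mono-≤ (proj₂ rj′) (proj₂ ri′))) (s≤s z≤n) (≈-trans (≈-reflexive (pos-+ j i)) q))
                (ℕ.m<n⇒n≢0 (ℕ.≤-trans (proj₁ rj′) (ℕ.m≤m+n j i)))
        impossible : ∀ k → h ≡ k → ⊥
        impossible zero e = ¬prime[1] (subst (Prime ∘ odd) e pp)
        impossible (suc k) e = too-many-roots pp (suc k) (-1ℤ ∷ replicate k 0ℤ) (cong suc (length-replicate k)) f
          (λ i r → ≈-trans (≈-reflexive (eval-power k (f i))) (≈⇒-≈0 (subst (λ n → f i ^ n ≈ 1ℤ [mod + p ]) e (f-power i (conv i r)))))
          (λ i j ri rj → f-distinct i j (conv i ri) (conv j rj))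
          where
          conv : ∀ i → InRange (suc (suc k)) i → InRange (suc h) i
          conv i = subst (λ n → InRange (suc n) i) (sym e)

  -- The character of discriminant -8l

  coprime-∣ : ∀ {a b m n} → a ℕ.∣ b → m ℕ.∣ n → Coprime b n → Coprime a m
  coprime-∣ a∣b m∣n c (p , q) = c (ℕ.∣-trans p a∣b , ℕ.∣-trans q m∣n)

  coprime-* : ∀ {a b m} → Coprime a m → Coprime b m → Coprime (a ℕ.* b) m
  coprime-* {a} {b} {m} p q {d} (d∣ab , d∣m) = q (coprime-divisor {d} {a} {b} (coprime-sym (coprime-∣ ℕ.∣-refl d∣m p)) d∣ab , d∣m)

  coprime-% : ∀ {a m} .{{_ : NonZero m}} → Coprime a m → Coprime (a ℕ.% m) m
  coprime-% c (p , q) = c (ℕ.∣n∣m%n⇒∣m q p , q)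

  coprime-%⁻¹ : ∀ {a m} .{{_ : NonZero m}} → Coprime (a ℕ.% m) m → Coprime a m
  coprime-%⁻¹ c (p , q) = c (ℕ.%-presˡ-∣ p q , q)

  ≈-divisor : ∀ {a b} l k → a ≈ b [mod + (k ℕ.* l) ] → a ≈ b [mod + l ]
  ≈-divisor {b = b} l k (q by e) = q * + k by trans e (cong (λ z → b + z) (trans (cong (q *_) (pos-* k l)) (sym (*-assoc q (+ k) (+ l)))))

  -- (-1)^(h(h+1)/2), which is (2 / (2h + 1)); the product form avoids the division by 2.
  tri : ℕ → ℤ
  tri h = ∏ h par

  tri-+ : ∀ a b → tri (a ℕ.+ b) ≡ tri a * (par (a ℕ.* b) * tri b)
  tri-+ a b = trans (∏-split a b par) (cong (tri a *_) (trans (∏-cong b λ k _ → par-+ a k)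
    (trans (∏-* b (λ _ → par a) par) (cong (_* tri b) (trans (∏-const b (par a)) (^-*-assoc -1ℤ a b))))))

  tri-sign : ∀ h → IsSign (tri h)
  tri-sign h = sign-∏ h λ i _ → par-sign i

  par-square : ∀ n → par (n ℕ.* n) ≡ par n
  par-square n with ℕ.m≡m%n+[m/n]*n n 2 | ℕ.m%n<n n 2
  ... | e | lt with n ℕ.% 2 | n ℕ./ 2
  ... | 0 | q rewrite e = trans (cong par (lem q)) (trans (par-double (2 ℕ.* q ℕ.* q)) (sym (trans (cong par (lem′ q)) (par-double q))))
    where
    lem : ∀ q → q ℕ.* 2 ℕ.* (q ℕ.* 2) ≡ 2 ℕ.* q ℕ.* q ℕ.+ 2 ℕ.* q ℕ.* q
    lem = ℕS.solve-∀
    lem′ : ∀ q → q ℕ.* 2 ≡ q ℕ.+ q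
    lem′ = ℕS.solve-∀
  ... | 1 | q rewrite e = trans (cong (λ z → par (suc z ℕ.* suc z)) (lem q)) (trans (par-*-odd q (suc (q ℕ.+ q))) (cong (par ∘ suc) (sym (lem q))))
    where
    lem : ∀ q → q ℕ.* 2 ≡ q ℕ.+ q
    lem = ℕS.solve-∀
  par-square n | e | s≤s (s≤s ()) | suc (suc r) | q

  tri-double : ∀ n → tri (n ℕ.+ n) ≡ par n
  tri-double n = trans (tri-+ n n) (trans (lem (tri n) (par (n ℕ.* n))) (trans (cong₂ _*_ (sign² (tri-sign n)) (par-square n)) (*-identityˡ _)))
    where
    lem : ∀ t x → t * (x * t) ≡ t * t * x
    lem = solve-∀

  -- For an odd prime p = 2h + 1 this is (-2 / p) times the sign in the reciprocity law for (l / p), l = 2g + 1.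
  ε : ℕ → ℕ → ℤ
  ε g h = par h * tri h * par (g ℕ.* h)

  ε-sign : ∀ g h → IsSign (ε g h)
  ε-sign g h = isSign-* (isSign-* (par-sign h) (tri-sign h)) (par-sign (g ℕ.* h))

  ε-period : ∀ g h q → ε g (h ℕ.+ q ℕ.* (4 ℕ.* odd g)) ≡ ε g h
  ε-period g h q = cong₂ _*_ (cong₂ _*_ p₁ p₂) p₃
    where
    k = q ℕ.* odd g
    l₁ : ∀ h q g → h ℕ.+ q ℕ.* (4 ℕ.* suc (g ℕ.+ g)) ≡ h ℕ.+ (2 ℕ.* (q ℕ.* suc (g ℕ.+ g)) ℕ.+ 2 ℕ.* (q ℕ.* suc (g ℕ.+ g)))
    l₁ = ℕS.solve-∀
    l₂ : ∀ h k → h ℕ.* (2 ℕ.* k ℕ.+ 2 ℕ.* k) ≡ 2 ℕ.* h ℕ.* k ℕ.+ 2 ℕ.* h ℕ.* k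
    l₂ = ℕS.solve-∀
    l₃ : ∀ g h k → g ℕ.* (h ℕ.+ (2 ℕ.* k ℕ.+ 2 ℕ.* k)) ≡ g ℕ.* h ℕ.+ (2 ℕ.* (g ℕ.* k) ℕ.+ 2 ℕ.* (g ℕ.* k))
    l₃ = ℕS.solve-∀
    even : ∀ h k → par (h ℕ.+ (2 ℕ.* k ℕ.+ 2 ℕ.* k)) ≡ par h
    even h k = trans (par-+ h _) (trans (cong (par h *_) (par-double (2 ℕ.* k))) (*-identityʳ (par h)))
    p₁ : par (h ℕ.+ q ℕ.* (4 ℕ.* odd g)) ≡ par h
    p₁ = trans (cong par (l₁ h q g)) (even h k)
    p₂ : tri (h ℕ.+ q ℕ.* (4 ℕ.* odd g)) ≡ tri h
    p₂ = trans (cong tri (l₁ h q g)) (trans (tri-+ h _) (trans (cong (tri h *_) (trans (cong₂ _*_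
      (trans (cong par (l₂ h k)) (par-double (2 ℕ.* h ℕ.* k))) (trans (tri-double (2 ℕ.* k)) (trans (cong par (cong (k ℕ.+_) (ℕ.+-identityʳ k))) (par-double k)))) refl)) (*-identityʳ (tri h))))
    p₃ : par (g ℕ.* (h ℕ.+ q ℕ.* (4 ℕ.* odd g))) ≡ par (g ℕ.* h)
    p₃ = trans (cong par (trans (cong (g ℕ.*_) (l₁ h q g)) (l₃ g h k))) (even (g ℕ.* h) (g ℕ.* k))

  -- (2h + 1)(2k + 1) = 2(2hk + h + k) + 1, so this is multiplicativity in the odd number d = 2h +
  -- 1.
  ε-* : ∀ g h k → ε g (2 ℕ.* (h ℕ.* k) ℕ.+ (h ℕ.+ k)) ≡ ε g h * ε g k
  ε-* g h k = trans (cong₂ _*_ (cong₂ _*_ p₁ p₂) p₃) (lem (par h) (par k) (tri h) (tri k) (par (g ℕ.* h)) (par (g ℕ.* k)))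
    where
    x = h ℕ.* k
    2x≡ : 2 ℕ.* x ≡ x ℕ.+ x
    2x≡ = cong (x ℕ.+_) (ℕ.+-identityʳ x)
    lem : ∀ a b c d e f → a * b * (c * d) * (e * f) ≡ a * c * e * (b * d * f)
    lem = solve-∀
    l₃ : ∀ g h k → g ℕ.* (2 ℕ.* (h ℕ.* k) ℕ.+ (h ℕ.+ k)) ≡ g ℕ.* (h ℕ.* k) ℕ.+ g ℕ.* (h ℕ.* k) ℕ.+ (g ℕ.* h ℕ.+ g ℕ.* k)
    l₃ = ℕS.solve-∀
    l₂ : ∀ x s → 2 ℕ.* x ℕ.* s ≡ x ℕ.* s ℕ.+ x ℕ.* s
    l₂ = ℕS.solve-∀
    even+ : ∀ x y z → par (x ℕ.+ x ℕ.+ (y ℕ.+ z)) ≡ par y * par z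
    even+ x y z = trans (par-+ (x ℕ.+ x) _) (trans (cong (_* par (y ℕ.+ z)) (par-double x)) (trans (*-identityˡ _) (par-+ y z)))
    p₁ : par (2 ℕ.* x ℕ.+ (h ℕ.+ k)) ≡ par h * par k
    p₁ = trans (cong (λ z → par (z ℕ.+ (h ℕ.+ k))) 2x≡) (even+ x h k)
    p₂ : tri (2 ℕ.* x ℕ.+ (h ℕ.+ k)) ≡ tri h * tri k
    p₂ = trans (tri-+ (2 ℕ.* x) (h ℕ.+ k)) (trans (cong₂ _*_ (trans (cong tri 2x≡) (tri-double x))
      (cong₂ _*_ (trans (cong par (l₂ x (h ℕ.+ k))) (par-double (x ℕ.* (h ℕ.+ k)))) (tri-+ h k)))
      (trans (lem′ (par x) (tri h) (tri k)) (trans (cong (_* (tri h * tri k)) (par² x)) (*-identityˡ _))))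
      where
      lem′ : ∀ p a b → p * (1ℤ * (a * (p * b))) ≡ p * p * (a * b)
      lem′ = solve-∀
    p₃ : par (g ℕ.* (2 ℕ.* x ℕ.+ (h ℕ.+ k))) ≡ par (g ℕ.* h) * par (g ℕ.* k)
    p₃ = trans (cong par (l₃ g h k)) (even+ (g ℕ.* x) (g ℕ.* h) (g ℕ.* k))

  odd-/2 : ∀ h → odd h ℕ./ 2 ≡ h
  odd-/2 h = trans (cong (ℕ._/ 2) (cong suc (lem h))) (trans (ℕ.+-distrib-/-∣ʳ 1 {h ℕ.* 2} {2} (ℕ.n∣m*n h)) (ℕ.m*n/n≡m h 2))
    where
    lem : ∀ h → h ℕ.+ h ≡ h ℕ.* 2
    lem = ℕS.solve-∀

  even-or-odd : ∀ d → d ≡ odd (d ℕ./ 2) ⊎ 2 ℕ.∣ d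
  even-or-odd d with ℕ.m≡m%n+[m/n]*n d 2 | ℕ.m%n<n d 2
  ... | e | lt with d ℕ.% 2 in r
  ... | 0 = inj₂ (ℕ.m%n≡0⇒n∣m d 2 r)
  ... | 1 = inj₁ (trans e (cong suc (lem (d ℕ./ 2))))
    where
    lem : ∀ q → q ℕ.* 2 ≡ q ℕ.+ q
    lem = ℕS.solve-∀
  even-or-odd d | e | s≤s (s≤s ()) | suc (suc _)

  -- The Kronecker character of discriminant -8l, l = 2g + 1: for primes p not dividing 2l it is (-2l / p).
  module _ (g : ℕ) where

    private
      l = odd g

    opaque
      modulus : ℕ
      modulus = 8 ℕ.* l

      modulus≡8l : modulus ≡ 8 ℕ.* l
      modulus≡8l = refl

      instance
        modulus≢0 : NonZero modulus
        modulus≢0 = _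

    private
      l∣M : l ℕ.∣ modulus
      l∣M = ℕ.divides 8 modulus≡8l
      2∣M : 2 ℕ.∣ modulus
      2∣M = ℕ.divides (4 ℕ.* l) (trans modulus≡8l (lem l))
        where
        lem : ∀ l → 8 ℕ.* l ≡ 4 ℕ.* l ℕ.* 2
        lem = ℕS.solve-∀

    coprime⇒odd : ∀ {d} → Coprime d modulus → d ≡ odd (d ℕ./ 2)
    coprime⇒odd {d} c with even-or-odd d
    ... | inj₁ e = e
    ... | inj₂ 2∣d = contradiction (c (2∣d , 2∣M)) λ ()

    coprime⇒unit-l : ∀ {d} → Coprime d modulus → Unit l d
    coprime⇒unit-l c = coprime⇒unit (coprime-∣ ℕ.∣-refl l∣M c)

    -- The Jacobi symbol is (d / l), with the variable above: both factors are periodic and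
    -- multiplicative in d for direct reasons. Reciprocity enters only in `jacobi≡χ`, which compares
    -- with symbols modulo a prime.
    χ-unit : ℕ → ℤ
    χ-unit d = jacobi g d * ε g (d ℕ./ 2)

    opaque
      χ : ℕ → ℤ
      χ d with coprime? d modulus
      ... | yes _ = χ-unit d
      ... | no _ = 0ℤ

      χ-coprime : ∀ {d} → Coprime d modulus → χ d ≡ χ-unit d
      χ-coprime {d} c with coprime? d modulus
      ... | yes _ = refl
      ... | no ¬c = ⊥-elim (¬c c)

      χ-¬coprime : ∀ {d} → ¬ Coprime d modulus → χ d ≡ 0ℤ
      χ-¬coprime {d} ¬c with coprime? d modulus
      ... | yes c = ⊥-elim (¬c c)
      ... | no _ = refl

    χ-sign : ∀ {d} → Coprime d modulus → IsSign (χ d)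
    χ-sign {d} c = subst IsSign (sym (χ-coprime c)) (isSign-* (jacobi-sign g d) (ε-sign g (d ℕ./ 2)))

    χ-% : ∀ d → χ d ≡ χ (d ℕ.% modulus)
    χ-% d = go (coprime? d modulus)
      where
      half : d ℕ./ 2 ≡ (d ℕ.% modulus) ℕ./ 2 ℕ.+ (d ℕ./ modulus) ℕ.* (4 ℕ.* l)
      half = trans (cong (ℕ._/ 2) (ℕ.m≡m%n+[m/n]*n d modulus))
        (trans (ℕ.+-distrib-/-∣ʳ (d ℕ.% modulus) (ℕ.∣n⇒∣m*n (d ℕ./ modulus) 2∣M))
          (cong ((d ℕ.% modulus) ℕ./ 2 ℕ.+_) (trans (cong (ℕ._/ 2) (trans (cong (d ℕ./ modulus ℕ.*_) modulus≡8l) (lem (d ℕ./ modulus) l))) (ℕ.m*n/n≡m (d ℕ./ modulus ℕ.* (4 ℕ.* l)) 2))))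
        where
        lem : ∀ q l → q ℕ.* (8 ℕ.* l) ≡ q ℕ.* (4 ℕ.* l) ℕ.* 2
        lem = ℕS.solve-∀
      go : Dec (Coprime d modulus) → χ d ≡ χ (d ℕ.% modulus)
      go (no ¬c) = trans (χ-¬coprime ¬c) (sym (χ-¬coprime λ c → ¬c (coprime-%⁻¹ {d} c)))
      go (yes c) = trans (χ-coprime c) (sym (trans (χ-coprime (coprime-% {d} c)) (cong₂ _*_
        (jacobi-cong g {d ℕ.% modulus} {d} (≈⇒%≡ (d ℕ.% modulus) d (≈-divisor l 8 (subst (λ m → + (d ℕ.% modulus) ≈ + d [mod + m ]) modulus≡8l (≈-sym (%-≈ d modulus))))))
        (sym (trans (cong (ε g) half) (ε-period g ((d ℕ.% modulus) ℕ./ 2) (d ℕ./ modulus)))))))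

    χ-cong : ∀ {a b} → a ℕ.% modulus ≡ b ℕ.% modulus → χ a ≡ χ b
    χ-cong {a} {b} e = trans (χ-% a) (trans (cong χ e) (sym (χ-% b)))

    χ-* : ∀ a b → χ (a ℕ.* b) ≡ χ a * χ b
    χ-* a b = go (coprime? a modulus) (coprime? b modulus)
      where
      go : Dec (Coprime a modulus) → Dec (Coprime b modulus) → χ (a ℕ.* b) ≡ χ a * χ b
      go (no ¬c) _ = trans (χ-¬coprime λ c → ¬c (coprime-∣ (ℕ.m∣m*n b) ℕ.∣-refl c)) (sym (trans (cong (_* χ b) (χ-¬coprime ¬c)) (*-zeroˡ (χ b))))
      go (yes _) (no ¬c) = trans (χ-¬coprime λ c → ¬c (coprime-∣ (ℕ.n∣m*n a) ℕ.∣-refl c)) (sym (trans (cong (χ a *_) (χ-¬coprime ¬c)) (*-zeroʳ (χ a))))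
      go (yes c) (yes d) = begin
        χ (a ℕ.* b) ≡⟨ χ-coprime (coprime-* c d) ⟩
        jacobi g (a ℕ.* b) * ε g (a ℕ.* b ℕ./ 2) ≡⟨ cong₂ _*_ (jacobi-* g (coprime⇒unit-l d) (coprime⇒unit-l c)) (cong (ε g) halves) ⟩
        jacobi g a * jacobi g b * ε g (2 ℕ.* (h ℕ.* k) ℕ.+ (h ℕ.+ k)) ≡⟨ cong (jacobi g a * jacobi g b *_) (ε-* g h k) ⟩
        jacobi g a * jacobi g b * (ε g h * ε g k) ≡⟨ lem (jacobi g a) (jacobi g b) (ε g h) (ε g k) ⟩
        jacobi g a * ε g h * (jacobi g b * ε g k) ≡⟨ cong₂ _*_ (χ-coprime c) (χ-coprime d) ⟨
        χ a * χ b ∎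
        where
        open ≡-Reasoning
        h = a ℕ./ 2
        k = b ℕ./ 2
        lem : ∀ a b c d → a * b * (c * d) ≡ a * c * (b * d)
        lem = solve-∀
        odd-* : ∀ h k → suc (h ℕ.+ h) ℕ.* suc (k ℕ.+ k) ≡ suc (2 ℕ.* (h ℕ.* k) ℕ.+ (h ℕ.+ k) ℕ.+ (2 ℕ.* (h ℕ.* k) ℕ.+ (h ℕ.+ k)))
        odd-* = ℕS.solve-∀
        halves : a ℕ.* b ℕ./ 2 ≡ 2 ℕ.* (h ℕ.* k) ℕ.+ (h ℕ.+ k)
        halves = trans (cong (ℕ._/ 2) (trans (cong₂ ℕ._*_ (coprime⇒odd c) (coprime⇒odd d)) (odd-* h k))) (odd-/2 (2 ℕ.* (h ℕ.* k) ℕ.+ (h ℕ.+ k)))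

    target-coprime : Coprime (odd (g ℕ.+ g)) modulus
    target-coprime = coprime-sym (subst (λ m → Coprime m (odd (g ℕ.+ g))) (sym modulus≡8l) (coprime-* {8} (coprime-* {2} {4} c₂ (coprime-* {2} {2} c₂ c₂)) c-l))
      where
      c-l : Coprime l (odd (g ℕ.+ g))
      c-l {d} (p , q) = ℕ.∣1⇒≡1 (ℕ.∣m+n∣m⇒∣n (subst (d ℕ.∣_) (lem g) (ℕ.∣m⇒∣m*n 2 p)) q)
        where
        lem : ∀ g → suc (g ℕ.+ g) ℕ.* 2 ≡ suc (g ℕ.+ g ℕ.+ (g ℕ.+ g)) ℕ.+ 1
        lem = ℕS.solve-∀
      c₂ : Coprime 2 (odd (g ℕ.+ g))
      c₂ {d} (p , q) with irreducible[2] p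
      ... | inj₁ e = e
      ... | inj₂ refl = contradiction (ℕ.∣1⇒≡1 (ℕ.∣m+n∣m⇒∣n {2} {g ℕ.+ g ℕ.+ (g ℕ.+ g)} {1} (subst (2 ℕ.∣_) (ℕ.+-comm 1 _) q) (ℕ.divides (g ℕ.+ g) (lem g)))) λ ()
        where
        lem : ∀ g → g ℕ.+ g ℕ.+ (g ℕ.+ g) ≡ (g ℕ.+ g) ℕ.* 2
        lem = ℕS.solve-∀

    -- 4g + 1 = 2l - 1
    χ-target : χ (odd (g ℕ.+ g)) ≡ 1ℤ
    χ-target = trans (χ-coprime target-coprime) (trans (cong₂ _*_
      (trans (jacobi-cong g {odd (g ℕ.+ g)} {g ℕ.+ g} (≈⇒%≡ {l} (odd (g ℕ.+ g)) (g ℕ.+ g) (1ℤ by trans (cong +_ (lem g)) (trans (pos-+ (g ℕ.+ g) l) (cong (λ z → + (g ℕ.+ g) + z) (sym (*-identityˡ (+ l))))))))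
        (jacobi-minus-one g))
      (trans (cong (ε g) (odd-/2 (g ℕ.+ g))) (cong₂ _*_ (cong₂ _*_ (par-double g) (tri-double g)) (trans (cong par (ℕ.*-distribˡ-+ g g g)) (par-double (g ℕ.* g))))))
      (trans (lem′ (par g)) (par² g)))
      where
      lem : ∀ g → suc (g ℕ.+ g ℕ.+ (g ℕ.+ g)) ≡ g ℕ.+ g ℕ.+ suc (g ℕ.+ g)
      lem = ℕS.solve-∀
      lem′ : ∀ x → x * (1ℤ * x * 1ℤ) ≡ x * x
      lem′ = solve-∀

    χ-one : χ 1 ≡ 1ℤ
    χ-one = [x≡x²]∧sign (χ-sign {1} (1-coprimeTo modulus)) (χ-* 1 1)
      where
      [x≡x²]∧sign : ∀ {x} → IsSign x → x ≡ x * x → x ≡ 1ℤ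
      [x≡x²]∧sign (inj₁ e) _ = e
      [x≡x²]∧sign (inj₂ refl) ()

    module _ {h} (pp : Prime (odd h)) (c : Coprime (odd h) modulus) where

      private
        unit₂ : Unit (odd h) 2
        unit₂ = coprime⇒unit (coprime-sym (coprime-∣ ℕ.∣-refl 2∣M c))

        unit-l : Unit (odd h) l
        unit-l = coprime⇒unit (coprime-sym (coprime-∣ ℕ.∣-refl l∣M c))

        unit-minus-one : Unit (odd h) (h ℕ.+ h)
        unit-minus-one = unit -1ℤ (-1ℤ by trans (lem (+ (h ℕ.+ h))) (cong (λ z → 1ℤ + -1ℤ * z) (sym (pos-+ 1 (h ℕ.+ h)))))
          where
          lem : ∀ x → x * -1ℤ ≡ 1ℤ + -1ℤ * (1ℤ + x)
          lem = solve-∀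


        a = (h ℕ.+ h) ℕ.* (2 ℕ.* l)

        unit-a : Unit (odd h) a
        unit-a = unit-* unit-minus-one (unit-* unit₂ unit-l)

        a≈ : + a ≈ - + (2 ℕ.* l) [mod + odd h ]
        a≈ = + (2 ℕ.* l) by trans (pos-* (h ℕ.+ h) (2 ℕ.* l)) (trans (lem (+ (h ℕ.+ h)) (+ (2 ℕ.* l))) (cong (λ z → - + (2 ℕ.* l) + + (2 ℕ.* l) * z) (sym (pos-+ 1 (h ℕ.+ h)))))
          where
          lem : ∀ x y → x * y ≡ - y + y * (1ℤ + x)
          lem = solve-∀

        recip : jacobi h l ≡ par (g ℕ.* h) * jacobi g (odd h)
        recip = trans (sym (trans (*-assoc (jacobi h l) (jacobi g (odd h)) (jacobi g (odd h))) (trans (cong (jacobi h l *_) (sign² (jacobi-sign g (odd h)))) (*-identityʳ (jacobi h l)))))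
          (cong (_* jacobi g (odd h)) (reciprocity g h unit-l (coprime⇒unit-l c)))

      -- Here `a` = 2h · 2l is a natural number congruent to -2l modulo p = 2h + 1. Its symbol is
      -- (-1 / p)(2 / p)(l / p); reciprocity turns the last factor into (p / l) up to sign, and `ε`
      -- collects the signs.
      jacobi≡χ : jacobi h a ≡ χ (odd h)
      jacobi≡χ = begin
        jacobi h a ≡⟨ jacobi-* h (unit-* unit₂ unit-l) unit-minus-one ⟩
        jacobi h (h ℕ.+ h) * jacobi h (2 ℕ.* l) ≡⟨ cong₂ _*_ (jacobi-minus-one h) (jacobi-* h unit-l unit₂) ⟩
        par h * (jacobi h 2 * jacobi h l) ≡⟨ cong₂ (λ x y → par h * (x * y)) (jacobi-two h unit₂) recip ⟩
        par h * (tri h * (par (g ℕ.* h) * jacobi g (odd h))) ≡⟨ lem (par h) (tri h) (par (g ℕ.* h)) (jacobi g (odd h)) ⟩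
        jacobi g (odd h) * ε g h ≡⟨ cong (λ y → jacobi g (odd h) * ε g y) (odd-/2 h) ⟨
        χ-unit (odd h) ≡⟨ χ-coprime c ⟨
        χ (odd h) ∎
        where
        open ≡-Reasoning
        lem : ∀ a b c d → a * (b * (c * d)) ≡ d * (a * b * c)
        lem = solve-∀

      χ-odd≡1⇒square : χ (odd h) ≡ 1ℤ → ∃[ x ] x * x ≈ - + (2 ℕ.* l) [mod + odd h ]
      χ-odd≡1⇒square e = + proj₁ s , ≈-trans (proj₂ s) a≈
        where
        s : ∃[ x ] + x * + x ≈ + a [mod + odd h ]
        s = jacobi≡1⇒square h pp unit-a (trans jacobi≡χ e)

      square⇒χ-odd≡1 : ∀ x → x * x ≈ - + (2 ℕ.* l) [mod + odd h ] → χ (odd h) ≡ 1ℤ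
      square⇒χ-odd≡1 x q = trans (sym jacobi≡χ) (jacobi-square h x unit-a (≈-trans q (≈-sym a≈)))

  -- Divisor sums of a multiplicative function

  ∑-multiples : ∀ p .{{_ : NonZero p}} q (F : ℕ → ℤ) → ∑ (q ℕ.* p) (λ d → ⟦ p ∣? d ⟧ * F d) ≡ ∑ q (λ e → F (e ℕ.* p))
  ∑-multiples p zero F = refl
  ∑-multiples p (suc q) F = trans (∑-split p (q ℕ.* p) _) (cong₂ _+_
    (trans (∑-single p p (ℕ.>-nonZero⁻¹ p , ℕ.≤-refl) _ λ i r i≢p → trans (cong (_* F i) (⟦⟧-no (p ∣? i) λ d → i≢p (ℕ.≤-antisym (proj₂ r) (ℕ.∣⇒≤ {{ℕ.>-nonZero (proj₁ r)}} d)))) (*-zeroˡ (F i)))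
      (trans (cong (_* F p) (⟦⟧-yes (p ∣? p) ℕ.∣-refl)) (trans (*-identityˡ (F p)) (cong F (sym (ℕ.+-identityʳ p))))))
    (trans (∑-cong (q ℕ.* p) λ i _ → cong (_* F (p ℕ.+ i)) (⟦⟧-cong (p ∣? p ℕ.+ i) (p ∣? i) (λ d → ℕ.∣m+n∣m⇒∣n d ℕ.∣-refl) (ℕ.∣m∣n⇒∣m+n ℕ.∣-refl)))
      (∑-multiples p q (F ∘ (p ℕ.+_)))))

  ∑-multiples-≤ : ∀ d .{{_ : NonZero d}} X (F : ℕ → ℤ) → ∑ X (λ q → ⟦ d ∣? q ⟧ * F q) ≡ ∑ (X ℕ./ d) (λ e → F (e ℕ.* d))
  ∑-multiples-≤ d X F = trans (∑-extend _ (ℕ.m/n*n≤m X d) λ i lo hi → trans (cong (_* F i) (⟦⟧-no (d ∣? i) λ d∣i → ℕ.<-irrefl refl (begin-strict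
      X ℕ./ d ℕ.* d <⟨ lo ⟩
      i ≡⟨ ℕ.m/n*n≡m d∣i ⟨
      i ℕ./ d ℕ.* d ≤⟨ ℕ.*-monoˡ-≤ d (ℕ./-monoˡ-≤ d hi) ⟩
      X ℕ./ d ℕ.* d ∎))) (*-zeroˡ (F i))) (∑-multiples d (X ℕ./ d) F)
    where open ℕ.≤-Reasoning

  PrimePowerSplit : ℕ → ℕ → Set
  PrimePowerSplit p n = ∃[ k ] ∃[ m ] (n ≡ p ℕ.^ k ℕ.* m × ¬ p ℕ.∣ m)

  prime-power-split : ∀ {p} → Prime p → ∀ n → 1 ℕ.≤ n → PrimePowerSplit p n
  prime-power-split {p} pp = <-rec _ go
    where
    go : ∀ n → (∀ {i} → i ℕ.< n → 1 ℕ.≤ i → PrimePowerSplit p i) → 1 ℕ.≤ n → PrimePowerSplit p n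
    go n rec 1≤n with p ∣? n
    ... | no p∤n = 0 , n , sym (ℕ.+-identityʳ n) , p∤n
    ... | yes p∣n@(ℕ.divides q e) with rec {q} (ℕ.quotient-< p∣n {{prime⇒nonTrivial pp}} {{ℕ.>-nonZero 1≤n}}) 1≤q
      where
      1≤q : 1 ℕ.≤ q
      1≤q = ℕ.n≢0⇒n>0 λ { refl → contradiction (subst (1 ℕ.≤_) e 1≤n) λ () }
    ... | k , m , refl , p∤m = suc k , m , trans e (trans (ℕ.*-comm (p ℕ.^ k ℕ.* m) p) (sym (ℕ.*-assoc p (p ℕ.^ k) m))) , p∤m

  prime-divisor : ∀ n → 1 ℕ.< n → ∃[ p ] (Prime p × p ℕ.∣ n)
  prime-divisor n 1<n with factorise n {{ℕ.>-nonZero (ℕ.<⇒≤ 1<n)}}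
  ... | record { factors = [] ; isFactorisation = e } = contradiction (subst (1 ℕ.<_) e 1<n) (ℕ.<-irrefl refl)
  ... | record { factors = p ∷ ps ; isFactorisation = e ; factorsPrime = pp ∷ _ } = p , pp , subst (p ℕ.∣_) (sym e) (ℕ.m∣m*n _)

  prime-power-induction : (P : ℕ → Set) → P 1 →
    (∀ p k m → Prime p → ¬ p ℕ.∣ m → 1 ℕ.≤ m → P m → P (p ℕ.^ suc k ℕ.* m)) → ∀ n → 1 ℕ.≤ n → P n
  prime-power-induction P P1 step = <-rec _ go
    where
    go : ∀ n → (∀ {i} → i ℕ.< n → 1 ℕ.≤ i → P i) → 1 ℕ.≤ n → P n
    go (suc zero) rec _ = P1
    go n@(suc (suc _)) rec 1≤n with prime-divisor n (s≤s (s≤s z≤n))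
    ... | p , pp , p∣n with prime-power-split pp n 1≤n
    ... | zero , m , e , p∤m = contradiction (subst (p ℕ.∣_) (trans e (ℕ.+-identityʳ m)) p∣n) p∤m
    ... | suc k , m , e , p∤m = subst P (sym e) (step p k m pp p∤m 1≤m (rec m<n 1≤m))
      where
      1≤m : 1 ℕ.≤ m
      1≤m = ℕ.n≢0⇒n>0 λ { refl → p∤m (p ℕ.∣0) }
      1<p^ : ∀ k → 1 ℕ.< p ℕ.^ suc k
      1<p^ zero = subst (1 ℕ.<_) (sym (ℕ.*-identityʳ p)) (ℕ.nonTrivial⇒n>1 p {{prime⇒nonTrivial pp}})
      1<p^ (suc k) = ℕ.<-≤-trans (1<p^ k) (ℕ.m≤n*m (p ℕ.^ suc k) p {{prime⇒nonZero pp}})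
      m<n : m ℕ.< n
      m<n = subst (m ℕ.<_) (sym e) (subst (ℕ._< p ℕ.^ suc k ℕ.* m) (ℕ.+-identityʳ m) (ℕ.*-monoˡ-< m {{ℕ.>-nonZero 1≤m}} (1<p^ k)))

  prime∤⇒coprime : ∀ {p m} → Prime p → ¬ p ℕ.∣ m → Coprime p m
  prime∤⇒coprime pp p∤m {d} (d∣p , d∣m) with prime⇒irreducible pp d∣p
  ... | inj₁ e = e
  ... | inj₂ refl = contradiction d∣m p∤m

  coprime-^ : ∀ {p m} k → Coprime p m → Coprime (p ℕ.^ k) m
  coprime-^ {m = m} zero c = 1-coprimeTo m
  coprime-^ (suc k) c = coprime-* c (coprime-^ k c)

  geometric : ℤ → ℕ → ℤ
  geometric x zero = 1ℤ
  geometric x (suc k) = 1ℤ + x * geometric x k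

  geometric-1 : ∀ k → geometric 1ℤ k ≡ + suc k
  geometric-1 zero = refl
  geometric-1 (suc k) = cong (λ z → 1ℤ + z) (trans (*-identityˡ _) (geometric-1 k))

  geometric-minus-1 : ∀ k → + 2 * geometric -1ℤ k ≡ 1ℤ + par k
  geometric-minus-1 zero = refl
  geometric-minus-1 (suc k) = trans (lem (geometric -1ℤ k)) (trans (cong (λ z → + 2 - z) (geometric-minus-1 k)) (lem′ (par k)))
    where
    lem : ∀ x → + 2 * (1ℤ + -1ℤ * x) ≡ + 2 - + 2 * x
    lem = solve-∀
    lem′ : ∀ y → + 2 - (1ℤ + y) ≡ 1ℤ + -1ℤ * y
    lem′ = solve-∀

  geometric-minus-1-even : ∀ k → par k ≡ 1ℤ → geometric -1ℤ k ≡ 1ℤ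
  geometric-minus-1-even k e = *-cancelˡ-≡ (+ 2) _ _ (trans (geometric-minus-1 k) (cong (λ z → 1ℤ + z) e))

  geometric-minus-1-odd : ∀ k → par k ≡ -1ℤ → geometric -1ℤ k ≡ 0ℤ
  geometric-minus-1-odd k e = *-cancelˡ-≡ (+ 2) _ _ (trans (geometric-minus-1 k) (cong (λ z → 1ℤ + z) e))

  geometric-≥0 : ∀ {x} k → IsSign x → 0ℤ ≤ geometric x k
  geometric-≥0 k (inj₁ refl) = subst (0ℤ ≤_) (sym (geometric-1 k)) (+≤+ z≤n)
  geometric-≥0 k (inj₂ refl) with par-sign k
  ... | inj₁ e = subst (0ℤ ≤_) (sym (geometric-minus-1-even k e)) (+≤+ z≤n)
  ... | inj₂ e = subst (0ℤ ≤_) (sym (geometric-minus-1-odd k e)) ≤-refl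

  divisorSum : (ℕ → ℤ) → ℕ → ℤ
  divisorSum χ q = ∑ q (λ d → ⟦ d ∣? q ⟧ * χ d)

  divisorSum-extend : ∀ χ {q X} → 1 ℕ.≤ q → q ℕ.≤ X → ∑ X (λ d → ⟦ d ∣? q ⟧ * χ d) ≡ divisorSum χ q
  divisorSum-extend χ {q} 1≤q q≤X = ∑-extend _ q≤X λ d q<d _ →
    trans (cong (_* χ d) (⟦⟧-no (d ∣? q) λ d∣q → ℕ.<⇒≱ q<d (ℕ.∣⇒≤ {{ℕ.>-nonZero 1≤q}} d∣q))) (*-zeroˡ (χ d))

  module _ (χ : ℕ → ℤ) (χ-* : ∀ a b → χ (a ℕ.* b) ≡ χ a * χ b) where

    -- The divisors of p^(k+1) m that are prime to p are the divisors of m; the others are pe with e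
    -- ∣ p^k m.
    divisorSum-step : ∀ {p} → Prime p → ∀ k m → ¬ p ℕ.∣ m → 1 ℕ.≤ m →
      divisorSum χ (p ℕ.^ suc k ℕ.* m) ≡ divisorSum χ m + χ p * divisorSum χ (p ℕ.^ k ℕ.* m)
    divisorSum-step {p} pp k m p∤m 1≤m = begin
      ∑ Q (λ d → ⟦ d ∣? Q ⟧ * χ d)
        ≡⟨ ∑-cong Q (λ d _ → trans (cong (_* χ d) (splitting d)) (*-distribʳ-+ (χ d) ⟦ d ∣? m ⟧ (⟦ p ∣? d ⟧ * ⟦ d ∣? Q ⟧))) ⟩
      ∑ Q (λ d → ⟦ d ∣? m ⟧ * χ d + ⟦ p ∣? d ⟧ * ⟦ d ∣? Q ⟧ * χ d)
        ≡⟨ ∑-+ Q (λ d → ⟦ d ∣? m ⟧ * χ d) _ ⟩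
      ∑ Q (λ d → ⟦ d ∣? m ⟧ * χ d) + ∑ Q (λ d → ⟦ p ∣? d ⟧ * ⟦ d ∣? Q ⟧ * χ d)
        ≡⟨ cong₂ _+_ (divisorSum-extend χ 1≤m m≤Q) (∑-cong Q λ d _ → *-assoc ⟦ p ∣? d ⟧ ⟦ d ∣? Q ⟧ (χ d)) ⟩
      divisorSum χ m + ∑ Q (λ d → ⟦ p ∣? d ⟧ * (⟦ d ∣? Q ⟧ * χ d))
        ≡⟨ cong (λ z → divisorSum χ m + z) (trans (cong (λ n → ∑ n (λ d → ⟦ p ∣? d ⟧ * (⟦ d ∣? Q ⟧ * χ d))) Q≡) (∑-multiples p q (λ d → ⟦ d ∣? Q ⟧ * χ d))) ⟩
      divisorSum χ m + ∑ q (λ e → ⟦ e ℕ.* p ∣? Q ⟧ * χ (e ℕ.* p))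
        ≡⟨ cong (λ z → divisorSum χ m + z) (∑-cong q λ e _ → trans (cong₂ _*_
             (⟦⟧-cong (e ℕ.* p ∣? Q) (e ∣? q) (λ d → ℕ.*-cancelʳ-∣ p (subst (e ℕ.* p ℕ.∣_) Q≡ d)) (λ d → subst (e ℕ.* p ℕ.∣_) (sym Q≡) (ℕ.*-monoˡ-∣ p d)))
             (χ-* e p)) (lem ⟦ e ∣? q ⟧ (χ e) (χ p))) ⟩
      divisorSum χ m + ∑ q (λ e → χ p * (⟦ e ∣? q ⟧ * χ e))
        ≡⟨ cong (λ z → divisorSum χ m + z) (∑-*ˡ q (χ p) _) ⟩
      divisorSum χ m + χ p * divisorSum χ q ∎
      where
      open ≡-Reasoning
      instance _ = prime⇒nonZero pp
      q = p ℕ.^ k ℕ.* m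
      Q = p ℕ.^ suc k ℕ.* m
      Q≡ : Q ≡ q ℕ.* p
      Q≡ = trans (ℕ.*-assoc p (p ℕ.^ k) m) (ℕ.*-comm p q)
      lem : ∀ i e p → i * (e * p) ≡ p * (i * e)
      lem = solve-∀
      m≤Q : m ℕ.≤ Q
      m≤Q = ℕ.m≤n*m m (p ℕ.^ suc k) {{ℕ.m^n≢0 p (suc k)}}
      splitting : ∀ d → ⟦ d ∣? Q ⟧ ≡ ⟦ d ∣? m ⟧ + ⟦ p ∣? d ⟧ * ⟦ d ∣? Q ⟧
      splitting d with p ∣? d
      ... | yes p∣d = sym (trans (cong₂ _+_ (⟦⟧-no (d ∣? m) (p∤m ∘ ℕ.∣-trans p∣d)) (*-identityˡ _)) (+-identityˡ _))
      ... | no p∤d = trans (⟦⟧-cong (d ∣? Q) (d ∣? m) (coprime-divisor {d} {p ℕ.^ suc k} (coprime-sym (coprime-^ {p} {d} (suc k) (prime∤⇒coprime pp p∤d)))) (ℕ.∣n⇒∣m*n (p ℕ.^ suc k)))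
            (sym (trans (cong (λ z → ⟦ d ∣? m ⟧ + z) (*-zeroˡ ⟦ d ∣? Q ⟧)) (+-identityʳ _)))

    divisorSum-prime-power : ∀ {p} → Prime p → ∀ k m → ¬ p ℕ.∣ m → 1 ℕ.≤ m →
      divisorSum χ (p ℕ.^ k ℕ.* m) ≡ divisorSum χ m * geometric (χ p) k
    divisorSum-prime-power {p} pp zero m p∤m 1≤m = trans (cong (divisorSum χ) (ℕ.+-identityʳ m)) (sym (*-identityʳ (divisorSum χ m)))
    divisorSum-prime-power {p} pp (suc k) m p∤m 1≤m = trans (divisorSum-step pp k m p∤m 1≤m)
      (trans (cong (λ z → divisorSum χ m + χ p * z) (divisorSum-prime-power pp k m p∤m 1≤m)) (lem (divisorSum χ m) (χ p) (geometric (χ p) k)))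
      where
      lem : ∀ r x g → r + x * (r * g) ≡ r * (1ℤ + x * g)
      lem = solve-∀

  -- Squares modulo q, read off the divisor sum

  ≈0-product : ∀ {a p q} .{{_ : NonZero q}} → Coprime p q → a ≈ 0ℤ [mod + p ] → a ≈ 0ℤ [mod + q ] → a ≈ 0ℤ [mod + (p ℕ.* q) ]
  ≈0-product {a} {p} {q} c (k by refl) d = t by trans (cong (λ z → 0ℤ + z * + p) e) (trans (lem t (+ p) (+ q)) (cong (λ z → 0ℤ + t * z) (sym (pos-* p q))))
    where
    lem₀ : ∀ k p → p * k ≡ 0ℤ + k * p
    lem₀ = solve-∀
    K : k ≈ 0ℤ [mod + q ]
    K = unit⇒cancel k (coprime⇒unit c) (≈-trans (≈-reflexive (lem₀ k (+ p))) d)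
    t = _≈_[mod_].quotient K
    e : k ≡ 0ℤ + t * + q
    e = _≈_[mod_].equality K
    lem : ∀ t p q → 0ℤ + (0ℤ + t * q) * p ≡ 0ℤ + t * (p * q)
    lem = solve-∀

  chinese-square : ∀ {p q c} .{{_ : NonZero q}} → Coprime p q → ∀ y x →
    y * y ≈ c [mod + p ] → x * x ≈ c [mod + q ] → ∃[ z ] z * z ≈ c [mod + (p ℕ.* q) ]
  chinese-square {p} {q} {c} cop y x hy hx = z , -≈0⇒≈ (≈0-product cop
      (≈⇒-≈0 (≈-trans (*-≈ zp zp) hy)) (≈⇒-≈0 (≈-trans (*-≈ zq zq) hx)))
    where
    u = coprime⇒unit cop
    w = + Unit.inverse u
    -- pw is 0 modulo p and 1 modulo q.
    z = y + + p * w * (x - y)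
    zp : z ≈ y [mod + p ]
    zp = w * (x - y) by lem y (+ p) w x
      where
      lem : ∀ y p w x → y + p * w * (x - y) ≡ y + w * (x - y) * p
      lem = solve-∀
    zq : z ≈ x [mod + q ]
    zq = ≈-trans (+-≈ (≈-refl {y}) (*-≈ʳ (x - y) (Unit.isInverse u))) (≈-reflexive (lem y x))
      where
      lem : ∀ y x → y + 1ℤ * (x - y) ≡ x
      lem = solve-∀

  ≉0-* : ∀ {a b} → a ≢ 0ℤ → b ≢ 0ℤ → a * b ≢ 0ℤ
  ≉0-* {a} a≢0 b≢0 e with i*j≡0⇒i≡0∨j≡0 a e
  ... | inj₁ p = a≢0 p
  ... | inj₂ p = b≢0 p

  par-even : ∀ k → par k ≡ 1ℤ → ∃[ j ] k ≡ j ℕ.+ j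
  par-even zero _ = 0 , refl
  par-even (suc zero) ()
  par-even (suc (suc k)) e with par-even k (trans (sym (lem (par k))) e)
    where
    lem : ∀ x → -1ℤ * (-1ℤ * x) ≡ x
    lem = solve-∀
  ... | j , refl = suc j , cong suc (sym (ℕ.+-suc j j))

  par-odd : ∀ k → par k ≡ -1ℤ → ∃[ j ] k ≡ suc (j ℕ.+ j)
  par-odd zero ()
  par-odd (suc k) e with par-even k (trans (sym (lem (par k))) (cong (-1ℤ *_) e))
    where
    lem : ∀ x → -1ℤ * (-1ℤ * x) ≡ x
    lem = solve-∀
  ... | j , refl = j , refl

  ^-square : ∀ p j → p ℕ.^ (j ℕ.+ j) ≡ p ℕ.^ j ℕ.* p ℕ.^ j
  ^-square p j = ℕ.^-distribˡ-+-* p j j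

  module _ (g : ℕ) where

    private
      n = 2 ℕ.* odd g
      M = modulus g
      r = divisorSum (χ g)

    χ≡1⇒square : ∀ {p} → Prime p → Coprime p M → χ g p ≡ 1ℤ → ∃[ x ] x * x ≈ - + n [mod + p ]
    χ≡1⇒square {p} pp c e = go (p ℕ./ 2) (coprime⇒odd g c) pp c e
      where
      go : ∀ {p} h → p ≡ odd h → Prime p → Coprime p M → χ g p ≡ 1ℤ → ∃[ x ] x * x ≈ - + n [mod + p ]
      go h refl pp c e = χ-odd≡1⇒square g {h} pp c e

    square⇒χ≡1 : ∀ {p} → Prime p → Coprime p M → ∀ x → x * x ≈ - + n [mod + p ] → χ g p ≡ 1ℤ
    square⇒χ≡1 {p} pp c x e = go (p ℕ./ 2) (coprime⇒odd g c) pp c e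
      where
      go : ∀ {p} h → p ≡ odd h → Prime p → Coprime p M → x * x ≈ - + n [mod + p ] → χ g p ≡ 1ℤ
      go h refl pp c e = square⇒χ-odd≡1 g {h} pp c x e

    SquareModulo : ℕ → Set
    SquareModulo q = ∃[ q₁ ] ∃[ s ] ∃[ x ] (q ≡ q₁ ℕ.* (s ℕ.* s) × x * x ≈ - + n [mod + q₁ ])

    EvenAtInert : ℕ → Set
    EvenAtInert q = ∀ {p} → Prime p → χ g p ≡ -1ℤ → ∀ k m → q ≡ p ℕ.^ k ℕ.* m → ¬ p ℕ.∣ m → par k ≡ 1ℤ

    private
      -- At p^k the divisor sum gains the factor k + 1 if χ(p) = 1, and 1 or 0 for even or odd k if
      -- χ(p) = -1. All three claims are read off from these factors.
      Q : ℕ → Set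
      Q q = Coprime q M → 0ℤ ≤ r q × (r q ≢ 0ℤ → SquareModulo q) × (EvenAtInert q → r q ≢ 0ℤ)

      Q-1 : Q 1
      Q-1 c = subst (0ℤ ≤_) (sym r1) (+≤+ z≤n)
            , (λ _ → 1 , 1 , 0ℤ , refl , (+ n by lem (+ n)))
            , (λ _ e → contradiction (trans (sym r1) e) λ ())
        where
        r1 : r 1 ≡ 1ℤ
        r1 = trans (+-identityʳ _) (trans (*-identityˡ (χ g 1)) (χ-one g))
        lem : ∀ n → 0ℤ * 0ℤ ≡ - n + n * 1ℤ
        lem = solve-∀

      Q-step : ∀ p k m → Prime p → ¬ p ℕ.∣ m → 1 ℕ.≤ m → Q m → Q (p ℕ.^ suc k ℕ.* m)
      Q-step p k m pp p∤m 1≤m Qm c with Qm (coprime-∣ (ℕ.n∣m*n (p ℕ.^ suc k)) ℕ.∣-refl c)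
      ... | r≥0 , rep , even = nonneg , rep′ , even′
        where
        cp : Coprime p M
        cp = coprime-∣ (ℕ.∣m⇒∣m*n m (ℕ.m∣m*n (p ℕ.^ k))) ℕ.∣-refl c
        q≡ : r (p ℕ.^ suc k ℕ.* m) ≡ r m * geometric (χ g p) (suc k)
        q≡ = divisorSum-prime-power (χ g) (χ-* g) pp (suc k) m p∤m 1≤m
        nonneg : 0ℤ ≤ r (p ℕ.^ suc k ℕ.* m)
        nonneg = subst (0ℤ ≤_) (sym q≡) (0≤-* r≥0 (geometric-≥0 (suc k) (χ-sign g cp)))
        rep′ : r (p ℕ.^ suc k ℕ.* m) ≢ 0ℤ → SquareModulo (p ℕ.^ suc k ℕ.* m)
        rep′ r≢0 with rep (λ e → r≢0 (trans q≡ (trans (cong (_* geometric (χ g p) (suc k)) e) (*-zeroˡ (geometric (χ g p) (suc k))))))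
        -- An even power of p goes into s. Of an odd power, one factor p joins q₁ by the Chinese
        -- remainder theorem; this needs χ(p) = 1, and χ(p) = -1 would make the geometric factor
        -- vanish.
        ... | q₁ , s , x , refl , sq with par-sign (suc k)
        ... | inj₁ e with j , k≡ ← par-even (suc k) e = q₁ , p ℕ.^ j ℕ.* s , x
              , trans (cong (λ i → p ℕ.^ i ℕ.* (q₁ ℕ.* (s ℕ.* s))) k≡) (trans (cong (ℕ._* (q₁ ℕ.* (s ℕ.* s))) (^-square p j)) (lem (p ℕ.^ j) q₁ s)) , sq
          where
          lem : ∀ P q s → P ℕ.* P ℕ.* (q ℕ.* (s ℕ.* s)) ≡ q ℕ.* (P ℕ.* s ℕ.* (P ℕ.* s))
          lem = ℕS.solve-∀
        ... | inj₂ e with j , k≡ ← par-odd (suc k) e = p ℕ.* q₁ , p ℕ.^ j ℕ.* s , proj₁ crt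
              , trans (cong (λ i → p ℕ.^ i ℕ.* (q₁ ℕ.* (s ℕ.* s))) k≡) (trans (cong (λ z → p ℕ.* z ℕ.* (q₁ ℕ.* (s ℕ.* s))) (^-square p j)) (lem p (p ℕ.^ j) q₁ s)) , proj₂ crt
          where
          lem : ∀ p P q s → p ℕ.* (P ℕ.* P) ℕ.* (q ℕ.* (s ℕ.* s)) ≡ p ℕ.* q ℕ.* (P ℕ.* s ℕ.* (P ℕ.* s))
          lem = ℕS.solve-∀
          χp≡1 : χ g p ≡ 1ℤ
          χp≡1 with χ-sign g cp
          ... | inj₁ e₁ = e₁
          ... | inj₂ e₁ = contradiction (trans q≡ (trans (cong (r m *_) (trans (cong (λ z → geometric z (suc k)) e₁) (geometric-minus-1-odd (suc k) e))) (*-zeroʳ (r m)))) r≢0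
          root = χ≡1⇒square pp cp χp≡1
          cop : Coprime p q₁
          cop = prime∤⇒coprime pp λ d → p∤m (ℕ.∣m⇒∣m*n (s ℕ.* s) d)
          q₁≢0 : NonZero q₁
          q₁≢0 = ℕ.≢-nonZero λ { refl → contradiction 1≤m λ () }
          crt : ∃[ z ] z * z ≈ - + n [mod + (p ℕ.* q₁) ]
          crt = chinese-square {{q₁≢0}} cop (proj₁ root) x (proj₂ root) sq
        even′ : EvenAtInert (p ℕ.^ suc k ℕ.* m) → r (p ℕ.^ suc k ℕ.* m) ≢ 0ℤ
        even′ E e = ≉0-* (even E-m) geometric≢0 (trans (sym q≡) e)
          where
          E-m : EvenAtInert m
          E-m {p′} pp′ χ≡ j m′ m≡ p′∤m′ with p′ ℕ.≟ p
          E-m {p′} pp′ χ≡ zero m′ m≡ p′∤m′ | yes refl = refl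
          E-m {p′} pp′ χ≡ (suc j) m′ m≡ p′∤m′ | yes refl = contradiction (subst (p ℕ.∣_) (sym m≡) (ℕ.∣m⇒∣m*n m′ (ℕ.m∣m*n (p ℕ.^ j)))) p∤m
          ... | no p′≢p = E pp′ χ≡ j (p ℕ.^ suc k ℕ.* m′) (trans (cong (p ℕ.^ suc k ℕ.*_) m≡) (lem (p ℕ.^ suc k) (p′ ℕ.^ j) m′)) p′∤
            where
            lem : ∀ P P′ m → P ℕ.* (P′ ℕ.* m) ≡ P′ ℕ.* (P ℕ.* m)
            lem = ℕS.solve-∀
            p′∤ : ¬ p′ ℕ.∣ p ℕ.^ suc k ℕ.* m′
            p′∤ d = p′∤m′ (coprime-divisor {p′} {p ℕ.^ suc k} (coprime-sym (coprime-^ (suc k) (prime∤⇒coprime pp λ d′ → p′≢p (prime-unique d′)))) d)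
              where
              prime-unique : p ℕ.∣ p′ → p′ ≡ p
              prime-unique d′ with prime⇒irreducible pp′ d′
              ... | inj₁ refl = contradiction pp ¬prime[1]
              ... | inj₂ e = sym e
          geometric≢0 : geometric (χ g p) (suc k) ≢ 0ℤ
          geometric≢0 e₀ with χ-sign g cp
          ... | inj₁ e₁ = contradiction (trans (sym (geometric-1 (suc k))) (trans (cong (λ z → geometric z (suc k)) (sym e₁)) e₀)) λ ()
          ... | inj₂ e₁ = contradiction (trans (sym (geometric-minus-1-even (suc k) (E pp e₁ (suc k) m refl p∤m))) (trans (cong (λ z → geometric z (suc k)) (sym e₁)) e₀)) λ ()

      Q-all : ∀ q → 1 ℕ.≤ q → Q q
      Q-all = prime-power-induction Q Q-1 Q-step

    divisorSum-≥0 : ∀ {q} → 1 ℕ.≤ q → Coprime q M → 0ℤ ≤ r q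
    divisorSum-≥0 {q} 1≤q c = proj₁ (Q-all q 1≤q c)

    divisorSum≢0⇒squareModulo : ∀ {q} → 1 ℕ.≤ q → Coprime q M → r q ≢ 0ℤ → SquareModulo q
    divisorSum≢0⇒squareModulo {q} 1≤q c = proj₁ (proj₂ (Q-all q 1≤q c))

    private
      -- If p did not divide y, then x/y would be a square root of -n modulo p, against χ(p) = -1.
      inert-∣ : ∀ {p} → Prime p → Coprime p M → χ g p ≡ -1ℤ → ∀ x y → p ℕ.∣ x ℕ.* x ℕ.+ n ℕ.* (y ℕ.* y) → p ℕ.∣ x × p ℕ.∣ y
      inert-∣ {p} pp c χ≡ x y d = p∣x , p∣y
        where
        instance _ = prime⇒nonZero pp
        d≈ : + x * + x + + n * (+ y * + y) ≈ 0ℤ [mod + p ]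
        d≈ = ≈-trans (≈-reflexive (sym (trans (pos-+ (x ℕ.* x) _) (cong₂ _+_ (pos-* x x) (trans (pos-* n _) (cong (+ n *_) (pos-* y y))))))) (∣⇒≈0 d)
        p∣y : p ℕ.∣ y
        p∣y with p ℕ.∣? y
        ... | yes p∣y = p∣y
        ... | no p∤y = contradiction (trans (sym χ≡) (square⇒χ≡1 pp c (+ x * w) root)) λ ()
          where
          u = coprime⇒unit {y} {p} (coprime-sym (prime∤⇒coprime pp p∤y))
          w = + Unit.inverse u
          lem : ∀ x y w n → (x * w) * (x * w) ≡ (x * x + n * (y * y)) * (w * w) - n * ((y * w) * (y * w))
          lem = solve-∀
          lem′ : ∀ w n → 0ℤ * (w * w) + - (n * (1ℤ * 1ℤ)) ≡ - n
          lem′ = solve-∀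
          neg-mul : ∀ n y → - (n * (y * y)) ≡ - n * (y * y)
          neg-mul = solve-∀
          root : (+ x * w) * (+ x * w) ≈ - + n [mod + p ]
          root = ≈-trans (≈-reflexive (lem (+ x) (+ y) w (+ n)))
            (≈-trans (+-≈ (*-≈ʳ (w * w) d≈) (≈-trans (≈-reflexive (neg-mul (+ n) (+ y * w))) (≈-trans (*-≈ˡ (- + n) (*-≈ (Unit.isInverse u) (Unit.isInverse u))) (≈-reflexive (sym (neg-mul (+ n) 1ℤ))))))
              (≈-reflexive (lem′ w (+ n))))
        p∣x : p ℕ.∣ x
        p∣x with euclidsLemma x x pp (ℕ.∣m+n∣m⇒∣n (subst (p ℕ.∣_) (ℕ.+-comm (x ℕ.* x) _) d) (ℕ.∣n⇒∣m*n n (ℕ.∣m⇒∣m*n y p∣y)))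
        ... | inj₁ d = d
        ... | inj₂ d = d

      -- As long as p divides x² + ny², both x and y can be divided by p, which lowers the exponent
      -- of p by 2.
      descent : ∀ {p} → Prime p → Coprime p M → χ g p ≡ -1ℤ → ∀ k m x y →
        x ℕ.* x ℕ.+ n ℕ.* (y ℕ.* y) ≡ p ℕ.^ k ℕ.* m → ¬ p ℕ.∣ m → par k ≡ 1ℤ
      descent pp c χ≡ zero m x y e p∤m = refl
      descent {p} pp c χ≡ (suc k) m x y e p∤m with inert-∣ pp c χ≡ x y (subst (p ℕ.∣_) (sym e) (ℕ.∣m⇒∣m*n m (ℕ.m∣m*n (p ℕ.^ k))))
      ... | ℕ.divides x′ refl , ℕ.divides y′ refl = go k (ℕ.*-cancelˡ-≡ _ _ p {{prime⇒nonZero pp}} (trans (lem n p x′ y′) (trans e (ℕ.*-assoc p (p ℕ.^ k) m))))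
        where
        lem : ∀ n p x y → p ℕ.* (p ℕ.* (x ℕ.* x ℕ.+ n ℕ.* (y ℕ.* y))) ≡ x ℕ.* p ℕ.* (x ℕ.* p) ℕ.+ n ℕ.* (y ℕ.* p ℕ.* (y ℕ.* p))
        lem = ℕS.solve-∀
        go : ∀ k → p ℕ.* (x′ ℕ.* x′ ℕ.+ n ℕ.* (y′ ℕ.* y′)) ≡ p ℕ.^ k ℕ.* m → par (suc k) ≡ 1ℤ
        go zero e′ = contradiction (subst (p ℕ.∣_) (trans e′ (ℕ.+-identityʳ m)) (ℕ.m∣m*n _)) p∤m
        go (suc k) e′ = trans (neg-neg (par k)) (descent pp c χ≡ k m x′ y′ (ℕ.*-cancelˡ-≡ _ _ p {{prime⇒nonZero pp}} (trans e′ (ℕ.*-assoc p (p ℕ.^ k) m))) p∤m)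
          where
          neg-neg : ∀ x → -1ℤ * (-1ℤ * x) ≡ x
          neg-neg = solve-∀

    divisorSum-norm≥1 : ∀ x y → (q : ℕ) → q ≡ x ℕ.* x ℕ.+ n ℕ.* (y ℕ.* y) → 1 ℕ.≤ q → Coprime q M → 1ℤ ≤ r q
    divisorSum-norm≥1 x y q q≡ 1≤q c = i<j⇒suc[i]≤j (≤∧≢⇒< (divisorSum-≥0 1≤q c)
      (λ e → proj₂ (proj₂ (Q-all q 1≤q c)) even (sym e)))
      where
      even : EvenAtInert q
      even {p} pp χ≡ zero m e p∤m = refl
      even {p} pp χ≡ (suc k) m e p∤m = descent pp (coprime-∣ (subst (p ℕ.∣_) (sym e) (ℕ.∣m⇒∣m*n m (ℕ.m∣m*n (p ℕ.^ k)))) ℕ.∣-refl c) χ≡ (suc k) m x y (trans (sym q≡) e) p∤m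

  -- Equidistribution of divisor sums in residue classes

  ∑≢0⇒∃ : ∀ n f → ∑ n f ≢ 0ℤ → ∃[ i ] (InRange n i × f i ≢ 0ℤ)
  ∑≢0⇒∃ zero f h = contradiction refl h
  ∑≢0⇒∃ (suc n) f h with f 1 ≟ 0ℤ
  ... | no f1≢0 = 1 , 1-inRange , f1≢0
  ... | yes f1≡0 with ∑≢0⇒∃ n (f ∘ suc) (λ e → h (cong₂ _+_ f1≡0 e))
  ... | i , r , fi≢0 = suc i , (suc-inRange r) , fi≢0

  down-closed : ∀ {P : ℕ → Set} (P? : Decidable P) → (∀ {i j} → i ℕ.≤ j → P j → P i) →
    ∀ K → ∃[ L ] (L ℕ.≤ K × (∀ i → InRange K i → ⟦ P? i ⟧ ≡ ⟦ i ≤? L ⟧))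
  down-closed P? down zero = 0 , z≤n , λ i r → contradiction (ℕ.≤-trans (proj₁ r) (proj₂ r)) λ ()
  down-closed P? down (suc K) with P? (suc K)
  ... | yes p = suc K , ℕ.≤-refl , λ i r → trans (⟦⟧-yes (P? i) (down (proj₂ r) p)) (sym (⟦⟧-yes (i ≤? suc K) (proj₂ r)))
  ... | no ¬p with down-closed P? down K
  ... | L , L≤K , h = L , ℕ.m≤n⇒m≤1+n L≤K , go
    where
    go : ∀ i → InRange (suc K) i → ⟦ P? i ⟧ ≡ ⟦ i ≤? L ⟧
    go i (1≤i , i≤) with ℕ.m≤n⇒m<n∨m≡n i≤
    ... | inj₁ i< = h i (1≤i , ℕ.≤-pred i<)
    ... | inj₂ refl = trans (⟦⟧-no (P? (suc K)) ¬p) (sym (⟦⟧-no (suc K ≤? L) (ℕ.<⇒≱ (s≤s L≤K))))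

  -- The full blocks contribute exactly ⌊L/M⌋. The rest is part of one more block, whose remaining
  -- terms are nonnegative, so it lies between 0 and 1.
  ∑-window : ∀ M .{{_ : NonZero M}} (φ : ℕ → ℤ) → (∀ i → 0ℤ ≤ φ i) → (∀ v → ∑ M (φ ∘ (v ℕ.+_)) ≡ 1ℤ) →
    ∀ L → + (L ℕ./ M) ≤ ∑ L φ × ∑ L φ ≤ + (L ℕ./ M) + 1ℤ
  ∑-window M φ φ≥0 window L = subst (λ z → + q ≤ z × z ≤ + q + 1ℤ) (sym eq)
      ( subst (_≤ + q + rest) (+-identityʳ (+ q)) (+-monoʳ-≤ (+ q) (∑-≥0 s {φ ∘ (q ℕ.* M ℕ.+_)} λ i _ → φ≥0 (q ℕ.* M ℕ.+ i)))
      , +-monoʳ-≤ (+ q) rest≤1)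
    where
    q = L ℕ./ M
    s = L ℕ.% M
    rest = ∑ s (φ ∘ (q ℕ.* M ℕ.+_))
    blocks : ∀ q → ∑ (q ℕ.* M) φ ≡ + q
    blocks zero = refl
    blocks (suc q) = trans (cong (λ n → ∑ n φ) (ℕ.+-comm M (q ℕ.* M))) (trans (∑-split (q ℕ.* M) M φ)
      (trans (cong₂ _+_ (blocks q) (window (q ℕ.* M))) (trans (sym (pos-+ q 1)) (cong +_ (ℕ.+-comm q 1)))))
    eq : ∑ L φ ≡ + q + rest
    eq = trans (cong (λ n → ∑ n φ) (trans (ℕ.m≡m%n+[m/n]*n L M) (ℕ.+-comm s (q ℕ.* M))))
      (trans (∑-split (q ℕ.* M) s φ) (cong (_+ rest) (blocks q)))
    rest≤1 : rest ≤ 1ℤ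
    rest≤1 with k , e ← ℕ.m≤n⇒∃[o]m+o≡n (ℕ.<⇒≤ (ℕ.m%n<n L M)) = begin
      rest ≡⟨ +-identityʳ rest ⟨
      rest + 0ℤ ≤⟨ +-monoʳ-≤ rest (∑-≥0 k {λ i → φ (q ℕ.* M ℕ.+ (s ℕ.+ i))} λ i _ → φ≥0 _) ⟩
      rest + ∑ k (λ i → φ (q ℕ.* M ℕ.+ (s ℕ.+ i))) ≡⟨ ∑-split s k _ ⟨
      ∑ (s ℕ.+ k) (φ ∘ (q ℕ.* M ℕ.+_)) ≡⟨ cong (λ n → ∑ n (φ ∘ (q ℕ.* M ℕ.+_))) e ⟩
      ∑ M (φ ∘ (q ℕ.* M ℕ.+_)) ≡⟨ window (q ℕ.* M) ⟩
      1ℤ ∎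
      where open ≤-Reasoning

  -- The points h 1 < ... < h Y contribute at least 1 each, and the gaps between them at least 0.
  ∑-increasing : ∀ (H : ℕ → ℤ) → (∀ i → 0ℤ ≤ H i) → (h : ℕ → ℕ) → (∀ j → h j ℕ.< h (suc j)) →
    ∀ Y → (∀ j → 1ℤ ≤ H (h (suc j))) → + Y ≤ ∑ (h Y) H
  ∑-increasing H H≥0 h h< zero h1 = ∑-≥0 (h 0) {H} λ i _ → H≥0 i
  ∑-increasing H H≥0 h h< (suc Y) h1 with k , e ← ℕ.m≤n⇒∃[o]m+o≡n (h< Y) = begin
      + suc Y ≡⟨ trans (cong +_ (ℕ.+-comm 1 Y)) (pos-+ Y 1) ⟩
      + Y + 1ℤ ≤⟨ +-mono-≤ (∑-increasing H H≥0 h h< Y h1) (h1 Y) ⟩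
      ∑ (h Y) H + H (h (suc Y)) ≡⟨ cong (λ z → ∑ (h Y) H + z) (trans (cong H (trans (sym e) (sym (ℕ.+-suc (h Y) k)))) (sym (+-identityˡ _))) ⟩
      ∑ (h Y) H + (0ℤ + H (h Y ℕ.+ suc k)) ≤⟨ +-monoʳ-≤ (∑ (h Y) H) (+-monoˡ-≤ (H (h Y ℕ.+ suc k)) (∑-≥0 k {H ∘ (h Y ℕ.+_)} λ i _ → H≥0 _)) ⟩
      ∑ (h Y) H + (∑ k (H ∘ (h Y ℕ.+_)) + H (h Y ℕ.+ suc k)) ≡⟨ cong (λ z → ∑ (h Y) H + z) (∑-last k (H ∘ (h Y ℕ.+_))) ⟨
      ∑ (h Y) H + ∑ (suc k) (H ∘ (h Y ℕ.+_)) ≡⟨ ∑-split (h Y) (suc k) H ⟨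
      ∑ (h Y ℕ.+ suc k) H ≡⟨ cong (λ n → ∑ n H) (trans (ℕ.+-suc (h Y) k) e) ⟩
      ∑ (h (suc Y)) H ∎
    where open ≤-Reasoning

  module ResidueClass (M : ℕ) .{{_ : NonZero M}} where

    ⟪_≡_⟫ : ℕ → ℕ → ℤ
    ⟪ x ≡ a ⟫ = ⟦ x ℕ.% M ℕ.≟ a ℕ.% M ⟧

    class-window : ∀ {f} → Coprime f M → ∀ a v → ∑ M (λ i → ⟪ f ℕ.* (v ℕ.+ i) ≡ a ⟫) ≡ 1ℤ
    class-window {f} c a v = trans
      (∑-single M k (s≤s z≤n , n%ℕd<d z M) (λ i → ⟪ f ℕ.* (v ℕ.+ i) ≡ a ⟫)
        (λ i r i≢k → ⟦⟧-no _ λ e → i≢k (unique i r e)))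
      (⟦⟧-yes _ hit)
      where
      open ≈-Reasoning (+ M)
      u = coprime⇒unit c
      w = + Unit.inverse u
      z = w * + a - + v - 1ℤ
      -- The solution modulo M is wa - v. Windows run over 1, ..., M, so it is lowered by 1 before
      -- the remainder is taken and raised again afterwards.
      k = suc (z %ℕ M)
      k≈ : + k ≈ z + 1ℤ [mod + M ]
      k≈ = ≈-trans (≈-reflexive (trans (cong +_ (ℕ.+-comm 1 (z %ℕ M))) (pos-+ (z %ℕ M) 1)))
        (+-≈ (≈-sym (%ℕ-≈ z M)) ≈-refl)
      expand : ∀ i → + (f ℕ.* (v ℕ.+ i)) ≡ + f * (+ v + + i)
      expand i = trans (pos-* f (v ℕ.+ i)) (cong (+ f *_) (pos-+ v i))
      hit≈ : + (f ℕ.* (v ℕ.+ k)) ≈ + a [mod + M ]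
      hit≈ = begin
        + (f ℕ.* (v ℕ.+ k)) ≡⟨ expand k ⟩
        + f * (+ v + + k) ≈⟨ *-≈ˡ (+ f) (+-≈ (≈-refl {+ v}) k≈) ⟩
        + f * (+ v + (w * + a - + v - 1ℤ + 1ℤ)) ≡⟨ lem (+ f) (+ v) w (+ a) ⟩
        (+ f * w) * + a ≈⟨ *-≈ʳ (+ a) (Unit.isInverse u) ⟩
        1ℤ * + a ≡⟨ *-identityˡ (+ a) ⟩
        + a ∎
        where
        lem : ∀ f v w a → f * (v + (w * a - v - 1ℤ + 1ℤ)) ≡ (f * w) * a
        lem = solve-∀
      hit : (f ℕ.* (v ℕ.+ k)) ℕ.% M ≡ a ℕ.% M
      hit = ≈⇒%≡ (f ℕ.* (v ℕ.+ k)) a hit≈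
      unique : ∀ i → InRange M i → (f ℕ.* (v ℕ.+ i)) ℕ.% M ≡ a ℕ.% M → i ≡ k
      unique (suc i) r e = cong suc (small-≈ (proj₂ r) (n%ℕd<d z M) (-≈0⇒≈ (unit⇒cancel _ u (begin
        + f * (+ i - + k′) ≡⟨ lem (+ f) (+ v) (+ i) (+ k′) ⟩
        + f * (+ v + (1ℤ + + i)) - + f * (+ v + (1ℤ + + k′)) ≡⟨ cong₂ _-_ (expand (suc i)) (expand k) ⟨
        + (f ℕ.* (v ℕ.+ suc i)) - + (f ℕ.* (v ℕ.+ k)) ≈⟨ ≈⇒-≈0 same ⟩
        0ℤ ∎))))
        where
        k′ = z %ℕ M
        lem : ∀ f v i k → f * (i - k) ≡ f * (v + (1ℤ + i)) - f * (v + (1ℤ + k))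
        lem = solve-∀
        same : + (f ℕ.* (v ℕ.+ suc i)) ≈ + (f ℕ.* (v ℕ.+ k)) [mod + M ]
        same = ≈-trans (%-≈ _ M) (≈-trans (≈-reflexive (cong +_ (trans e (sym hit)))) (≈-sym (%-≈ _ M)))

    -- What matters is that λ₀ is chosen before a. The condition f(u + i) ≤ X cuts off an initial
    -- range that does not depend on the class, and among M consecutive i exactly one hits the class
    -- of a.
    class-count : ∀ {f} → Coprime f M → ∀ X u K → ∃[ λ₀ ] (∀ a →
      (let N = ∑ K (λ i → ⟦ f ℕ.* (u ℕ.+ i) ≤? X ⟧ * ⟪ f ℕ.* (u ℕ.+ i) ≡ a ⟫)) → + λ₀ ≤ N × N ≤ + λ₀ + 1ℤ)
    class-count {f} c X u K with down-closed (λ i → f ℕ.* (u ℕ.+ i) ≤? X) (λ {i} {j} i≤j → ℕ.≤-trans (ℕ.*-monoʳ-≤ f (ℕ.+-monoʳ-≤ u i≤j))) K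
    ... | L , L≤K , h = L ℕ./ M , λ a → subst (λ z → + (L ℕ./ M) ≤ z × z ≤ + (L ℕ./ M) + 1ℤ)
        (sym (trans (∑-cong K λ i r → cong (_* ⟪ f ℕ.* (u ℕ.+ i) ≡ a ⟫) (h i r)) (∑-truncate _ L≤K)))
        (∑-window M (λ i → ⟪ f ℕ.* (u ℕ.+ i) ≡ a ⟫) (λ i → ⟦⟧≥0 _)
          (λ v → trans (∑-cong M λ i _ → cong (λ z → ⟪ f ℕ.* z ≡ a ⟫) (sym (ℕ.+-assoc u v i))) (class-window c a (u ℕ.+ v))) L)

  module _ (g : ℕ) where

    private
      M = modulus g
      instance
        M≢0 : NonZero M
        M≢0 = modulus≢0 g
      χ′ = χ g
      r = divisorSum χ′

    open ResidueClass M

    classSum : ℕ → ℕ → ℤ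
    classSum a X = ∑ X (λ q → ⟪ q ≡ a ⟫ * r q)

    private
      W : ℕ → ℕ → ℕ → ℕ → ℤ
      W X a d e = ⟦ d ℕ.* e ≤? X ⟧ * ⟪ d ℕ.* e ≡ a ⟫

      W-sym : ∀ X a d e → W X a d e ≡ W X a e d
      W-sym X a d e = cong (λ z → ⟦ z ≤? X ⟧ * ⟪ z ≡ a ⟫) (ℕ.*-comm d e)

      classSum-pairs : ∀ a X → classSum a X ≡ ∑ X (λ d → χ′ d * ∑ X (W X a d))
      classSum-pairs a X = begin
        ∑ X (λ q → ⟪ q ≡ a ⟫ * r q)
          ≡⟨ ∑-cong X (λ q r → cong (⟪ q ≡ a ⟫ *_) (sym (divisorSum-extend χ′ (proj₁ r) (proj₂ r)))) ⟩
        ∑ X (λ q → ⟪ q ≡ a ⟫ * ∑ X (λ d → ⟦ d ∣? q ⟧ * χ′ d))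
          ≡⟨ ∑-cong X (λ q _ → trans (sym (∑-*ˡ X ⟪ q ≡ a ⟫ _)) (∑-cong X λ d _ → lem ⟪ q ≡ a ⟫ ⟦ d ∣? q ⟧ (χ′ d))) ⟩
        ∑ X (λ q → ∑ X (λ d → χ′ d * (⟦ d ∣? q ⟧ * ⟪ q ≡ a ⟫)))
          ≡⟨ ∑-comm X X _ ⟩
        ∑ X (λ d → ∑ X (λ q → χ′ d * (⟦ d ∣? q ⟧ * ⟪ q ≡ a ⟫)))
          ≡⟨ ∑-cong X (λ d r → trans (∑-*ˡ X (χ′ d) _) (cong (χ′ d *_) (inner d r))) ⟩
        ∑ X (λ d → χ′ d * ∑ X (W X a d)) ∎
        where
        open ≡-Reasoning
        lem : ∀ i j x → i * (j * x) ≡ x * (j * i)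
        lem = solve-∀
        inner : ∀ d → InRange X d → ∑ X (λ q → ⟦ d ∣? q ⟧ * ⟪ q ≡ a ⟫) ≡ ∑ X (W X a d)
        inner d@(suc _) r = trans (∑-multiples-≤ d X (λ q → ⟪ q ≡ a ⟫))
          (trans (sym (∑-truncate (λ e → ⟪ e ℕ.* d ≡ a ⟫) (ℕ.m/n≤m X d)))
            (∑-cong X λ e _ → cong₂ _*_
              (⟦⟧-cong (e ≤? X ℕ./ d) (d ℕ.* e ≤? X)
                (λ le → ℕ.≤-trans (ℕ.≤-reflexive (ℕ.*-comm d e)) (ℕ.≤-trans (ℕ.*-monoˡ-≤ d le) (ℕ.m/n*n≤m X d)))
                (λ le → ℕ.≤-trans (ℕ.≤-reflexive (sym (ℕ.m*n/n≡m e d))) (ℕ./-monoˡ-≤ d (ℕ.≤-trans (ℕ.≤-reflexive (ℕ.*-comm e d)) le))))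
              (cong (λ z → ⟪ z ≡ a ⟫) (ℕ.*-comm e d))))

    module _ (T : ℕ) where

      private
        X = T ℕ.* T
        T≤X : T ℕ.≤ X
        T≤X = n≤n*n T
          where
          n≤n*n : ∀ n → n ℕ.≤ n ℕ.* n
          n≤n*n zero = z≤n
          n≤n*n (suc n) = ℕ.m≤m*n (suc n) (suc n)
        K = X ℕ.∸ T
        T+K≡X : T ℕ.+ K ≡ X
        T+K≡X = ℕ.m+[n∸m]≡n T≤X

        row : ℕ → ℕ → ℕ → ℕ → ℤ
        row a u K f = ∑ K (λ i → W X a f (u ℕ.+ i))

        part : ℕ → ℕ → ℕ → ℤ
        part a u K = ∑ T (λ f → χ′ f * row a u K f)

        -- Dirichlet's hyperbola method; in the second half d e ≡ a forces χ d = χ e.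
        hyperbola : ∀ a → Coprime a M → χ′ a ≡ 1ℤ → classSum a X ≡ part a 0 X + part a T K
        hyperbola a cop χa≡1 = begin
          classSum a X
            ≡⟨ classSum-pairs a X ⟩
          ∑ X (λ d → χ′ d * ∑ X (W X a d))
            ≡⟨ cong (λ n → ∑ n (λ d → χ′ d * ∑ X (W X a d))) (sym T+K≡X) ⟩
          ∑ (T ℕ.+ K) (λ d → χ′ d * ∑ X (W X a d))
            ≡⟨ ∑-split T K _ ⟩
          part a 0 X + ∑ K (λ i → χ′ (T ℕ.+ i) * ∑ X (W X a (T ℕ.+ i)))
            ≡⟨ cong (λ z → part a 0 X + z) second ⟩
          part a 0 X + part a T K ∎
          where
          open ≡-Reasoning
          swap-χ : ∀ d e → χ′ d * W X a d e ≡ χ′ e * W X a e d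
          swap-χ d e = go ((d ℕ.* e) ℕ.% M ℕ.≟ a ℕ.% M)
            where
            vanish : ∀ d e → ¬ ((d ℕ.* e) ℕ.% M ≡ a ℕ.% M) → χ′ d * W X a d e ≡ 0ℤ
            vanish d e ¬p = trans (cong (χ′ d *_) (trans (cong (⟦ d ℕ.* e ≤? X ⟧ *_) (⟦⟧-no _ ¬p)) (*-zeroʳ ⟦ d ℕ.* e ≤? X ⟧))) (*-zeroʳ (χ′ d))
            go : Dec ((d ℕ.* e) ℕ.% M ≡ a ℕ.% M) → χ′ d * W X a d e ≡ χ′ e * W X a e d
            go (no ¬p) = trans (vanish d e ¬p) (sym (vanish e d (¬p ∘ trans (cong (ℕ._% M) (ℕ.*-comm d e)))))
            go (yes p) = cong₂ _*_ χd≡χe (W-sym X a d e)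
              where
              χde : χ′ d * χ′ e ≡ 1ℤ
              χde = trans (sym (χ-* g d e)) (trans (χ-cong g {d ℕ.* e} {a} p) χa≡1)
              cop-de : Coprime (d ℕ.* e) M
              cop-de = coprime-%⁻¹ {d ℕ.* e} (subst (λ z → Coprime z M) (sym p) (coprime-% {a} cop))
              χe² : χ′ e * χ′ e ≡ 1ℤ
              χe² = sign² (χ-sign g {e} (coprime-∣ (ℕ.n∣m*n d) ℕ.∣-refl cop-de))
              χd≡χe : χ′ d ≡ χ′ e
              χd≡χe = trans (sym (*-identityʳ (χ′ d))) (trans (cong (χ′ d *_) (sym χe²)) (trans (sym (*-assoc (χ′ d) (χ′ e) (χ′ e))) (trans (cong (_* χ′ e) χde) (*-identityˡ (χ′ e)))))
          second : ∑ K (λ i → χ′ (T ℕ.+ i) * ∑ X (W X a (T ℕ.+ i))) ≡ part a T K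
          second = begin
            ∑ K (λ i → χ′ (T ℕ.+ i) * ∑ X (W X a (T ℕ.+ i)))
              ≡⟨ ∑-cong K (λ i _ → trans (sym (∑-*ˡ X (χ′ (T ℕ.+ i)) _)) (∑-cong X λ e _ → swap-χ (T ℕ.+ i) e)) ⟩
            ∑ K (λ i → ∑ X (λ e → χ′ e * W X a e (T ℕ.+ i)))
              ≡⟨ ∑-comm K X _ ⟩
            ∑ X (λ e → ∑ K (λ i → χ′ e * W X a e (T ℕ.+ i)))
              -- For e > T the product e(T + i) exceeds T² = X, so only e ≤ T is left.
              ≡⟨ ∑-extend _ T≤X (λ e T<e _ → ∑-0 K λ i r → trans (cong (χ′ e *_) (trans (cong (_* ⟪ e ℕ.* (T ℕ.+ i) ≡ a ⟫) (⟦⟧-no (e ℕ.* (T ℕ.+ i) ≤? X) (ℕ.<⇒≱ (ℕ.*-mono-< T<e (ℕ.m<m+n T (proj₁ r)))))) (*-zeroˡ ⟪ e ℕ.* (T ℕ.+ i) ≡ a ⟫))) (*-zeroʳ (χ′ e))) ⟩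
            ∑ T (λ e → ∑ K (λ i → χ′ e * W X a e (T ℕ.+ i)))
              ≡⟨ ∑-cong T (λ e _ → ∑-*ˡ K (χ′ e) _) ⟩
            part a T K ∎

        -- By `class-count` both rows lie between the same λ₀ and λ₀ + 1, which bounds their
        -- difference by 1 for either sign of χ(f). If f is not prime to M, then χ(f) = 0.
        compare : ∀ a b u K f → χ′ f * row a u K f ≤ χ′ f * row b u K f + 1ℤ
        compare a b u K f = go (coprime? f M)
          where
          A = row a u K f
          B = row b u K f
          signed : ∀ {s x y l} → IsSign s → (l ≤ x × x ≤ l + 1ℤ) → (l ≤ y × y ≤ l + 1ℤ) → s * x ≤ s * y + 1ℤ
          signed {s} {x} {y} {l} (inj₁ refl) (_ , hx) (hy , _) = 0≤⇒≤ (0≤-by (lem x y l) (0≤-+ (≤⇒0≤ hx) (≤⇒0≤ hy)))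
            where
            lem : ∀ x y l → 1ℤ * y + 1ℤ - 1ℤ * x ≡ l + 1ℤ - x + (y - l)
            lem = solve-∀
          signed {s} {x} {y} {l} (inj₂ refl) (hx , _) (_ , hy) = 0≤⇒≤ (0≤-by (lem x y l) (0≤-+ (≤⇒0≤ hx) (≤⇒0≤ hy)))
            where
            lem : ∀ x y l → -1ℤ * y + 1ℤ - -1ℤ * x ≡ x - l + (l + 1ℤ - y)
            lem = solve-∀
          go : Dec (Coprime f M) → χ′ f * A ≤ χ′ f * B + 1ℤ
          go (no ¬c) = subst (λ z → z * A ≤ z * B + 1ℤ) (sym (χ-¬coprime g ¬c)) (subst₂ (λ x y → x ≤ y + 1ℤ) (sym (*-zeroˡ A)) (sym (*-zeroˡ B)) (+≤+ z≤n))
          go (yes c) = signed {l = + proj₁ cc} (χ-sign g {f} c) (proj₂ cc a) (proj₂ cc b)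
            where cc = class-count {f} c X u K

      classSum-compare : ∀ a b → Coprime a M → Coprime b M → χ′ a ≡ 1ℤ → χ′ b ≡ 1ℤ →
        classSum a X ≤ classSum b X + + (T ℕ.+ T)
      classSum-compare a b ca cb ea eb = subst₂ (λ x y → x ≤ y + + (T ℕ.+ T)) (sym (hyperbola a ca ea)) (sym (hyperbola b cb eb)) (begin
        part a 0 X + part a T K ≤⟨ +-mono-≤ (half 0 X) (half T K) ⟩
        (part b 0 X + + T) + (part b T K + + T) ≡⟨ lem (part b 0 X) (part b T K) (+ T) ⟩
        part b 0 X + part b T K + (+ T + + T) ≡⟨ cong (λ z → part b 0 X + part b T K + z) (pos-+ T T) ⟨
        part b 0 X + part b T K + + (T ℕ.+ T) ∎)
        where
        open ≤-Reasoning
        lem : ∀ x y t → (x + t) + (y + t) ≡ x + y + (t + t)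
        lem = solve-∀
        half : ∀ u K → part a u K ≤ part b u K + + T
        half u K = ≤-trans (∑-mono T (λ f _ → compare a b u K f)) (≤-reflexive (trans (∑-+ T _ (λ _ → 1ℤ))
          (cong (λ z → part b u K + z) (trans (∑-const T 1ℤ) (*-identityʳ (+ T))))))

  -- Existence of q ≡ 2l - 1 with -2l a square modulo its square-free part

  norm : ℕ → ℕ → ℕ → ℕ → ℕ
  norm M n k j = (M ℕ.* k ℕ.+ 1) ℕ.* (M ℕ.* k ℕ.+ 1) ℕ.+ n ℕ.* ((M ℕ.* j) ℕ.* (M ℕ.* j))

  norm-≥1 : ∀ M n k j → 1 ℕ.≤ norm M n k j
  norm-≥1 M n k j = ℕ.≤-trans (ℕ.*-mono-≤ (ℕ.m≤n+m 1 (M ℕ.* k)) (ℕ.m≤n+m 1 (M ℕ.* k))) (ℕ.m≤m+n _ _)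

  norm-% : ∀ M n k j .{{_ : NonZero M}} → norm M n k j ℕ.% M ≡ 1 ℕ.% M
  norm-% M n k j = trans (cong (ℕ._% M) (lem M n k j)) (ℕ.[m+kn]%n≡m%n 1 (M ℕ.* (k ℕ.* k) ℕ.+ 2 ℕ.* k ℕ.+ n ℕ.* (M ℕ.* (j ℕ.* j))) M)
    where
    lem : ∀ M n k j → (M ℕ.* k ℕ.+ 1) ℕ.* (M ℕ.* k ℕ.+ 1) ℕ.+ n ℕ.* ((M ℕ.* j) ℕ.* (M ℕ.* j)) ≡ 1 ℕ.+ (M ℕ.* (k ℕ.* k) ℕ.+ 2 ℕ.* k ℕ.+ n ℕ.* (M ℕ.* (j ℕ.* j))) ℕ.* M
    lem = ℕS.solve-∀

  -- For k ≥ n Y² the values x² + n y² with x = M k + 1 and M ∣ y ≤ M Y lie below the next square (M (k + 1) + 1)²; hence they are distinct.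
  module Norms (M n Y : ℕ) .{{_ : NonZero M}} .{{_ : NonZero n}} (G : ℕ → ℤ)
    (G≥0 : ∀ q → 1 ℕ.≤ q → 0ℤ ≤ G q) (G-norm≥1 : ∀ k j → 1ℤ ≤ G (norm M n k j)) where

    B : ℕ → ℕ
    B k = (M ℕ.* k ℕ.+ 1) ℕ.* (M ℕ.* k ℕ.+ 1)

    k₀ : ℕ
    k₀ = n ℕ.* (Y ℕ.* Y)

    private
      h : ℕ → ℕ
      h j = n ℕ.* ((M ℕ.* j) ℕ.* (M ℕ.* j))

      h< : ∀ j → h j ℕ.< h (suc j)
      h< j = ℕ.*-monoʳ-< n (ℕ.*-mono-< Mj< Mj<)
        where
        Mj< : M ℕ.* j ℕ.< M ℕ.* suc j
        Mj< = ℕ.*-monoʳ-< M (ℕ.n<1+n j)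

    block : ∀ i → ∑ (B (k₀ ℕ.+ i)) G + + Y ≤ ∑ (B (k₀ ℕ.+ suc i)) G
    block i = begin
      ∑ (B k) G + + Y ≤⟨ +-monoʳ-≤ (∑ (B k) G) (∑-increasing (λ j → G (B k ℕ.+ j)) (λ j → G≥0 (B k ℕ.+ j) (B+≥1 j)) h h< Y (λ j → G-norm≥1 k (suc j))) ⟩
      ∑ (B k) G + S ≡⟨ +-identityʳ _ ⟨
      ∑ (B k) G + S + 0ℤ ≤⟨ +-monoʳ-≤ (∑ (B k) G + S) (∑-≥0 D {λ j → G (B k ℕ.+ h Y ℕ.+ j)} λ j r → G≥0 _ (ℕ.≤-trans (proj₁ r) (ℕ.m≤n+m j (B k ℕ.+ h Y)))) ⟩
      ∑ (B k) G + S + R ≡⟨ cong (_+ R) (∑-split (B k) (h Y) G) ⟨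
      ∑ (B k ℕ.+ h Y) G + R ≡⟨ ∑-split (B k ℕ.+ h Y) D G ⟨
      ∑ (B k ℕ.+ h Y ℕ.+ D) G ≡⟨ cong (λ z → ∑ z G) (lem M n Y i) ⟩
      ∑ (B (k₀ ℕ.+ suc i)) G ∎
      where
      open ≤-Reasoning
      k = k₀ ℕ.+ i
      S = ∑ (h Y) (G ∘ (B k ℕ.+_))
      -- The distance from (Mk + 1)² + n(MY)² to (M(k + 1) + 1)². It is 2M²k + 2M + M² - M²k₀, and k
      -- ≥ k₀ keeps it nonnegative.
      D = M ℕ.* M ℕ.* (k₀ ℕ.+ 2 ℕ.* i) ℕ.+ 2 ℕ.* M ℕ.+ M ℕ.* M
      R = ∑ D (G ∘ ((B k ℕ.+ h Y) ℕ.+_))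
      B+≥1 : ∀ j → 1 ℕ.≤ B k ℕ.+ j
      B+≥1 j = ℕ.≤-trans (ℕ.*-mono-≤ (ℕ.m≤n+m 1 (M ℕ.* k)) (ℕ.m≤n+m 1 (M ℕ.* k))) (ℕ.m≤m+n (B k) j)
      lem : ∀ M n Y i → let k₀ = n ℕ.* (Y ℕ.* Y); x = M ℕ.* (k₀ ℕ.+ i) ℕ.+ 1; x′ = M ℕ.* (k₀ ℕ.+ suc i) ℕ.+ 1 in
        x ℕ.* x ℕ.+ n ℕ.* ((M ℕ.* Y) ℕ.* (M ℕ.* Y)) ℕ.+ (M ℕ.* M ℕ.* (k₀ ℕ.+ 2 ℕ.* i) ℕ.+ 2 ℕ.* M ℕ.+ M ℕ.* M) ≡ x′ ℕ.* x′
      lem = ℕS.solve-∀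

    blocks : ∀ i → + (i ℕ.* Y) ≤ ∑ (B (k₀ ℕ.+ i)) G
    blocks zero = ∑-≥0 (B (k₀ ℕ.+ 0)) {G} λ j r → G≥0 j (proj₁ r)
    blocks (suc i) = begin
      + (Y ℕ.+ i ℕ.* Y) ≡⟨ trans (cong +_ (ℕ.+-comm Y (i ℕ.* Y))) (pos-+ (i ℕ.* Y) Y) ⟩
      + (i ℕ.* Y) + + Y ≤⟨ +-monoˡ-≤ (+ Y) (blocks i) ⟩
      ∑ (B (k₀ ℕ.+ i)) G + + Y ≤⟨ block i ⟩
      ∑ (B (k₀ ℕ.+ suc i)) G ∎
      where open ≤-Reasoning

  many-norms : ∀ M k → 8 ℕ.≤ M → let T = M ℕ.* (k ℕ.+ suc k) ℕ.+ 1 in T ℕ.+ T ℕ.< suc k ℕ.* (4 ℕ.* M)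
  many-norms M k M≥8 = begin-strict
      M ℕ.* (k ℕ.+ suc k) ℕ.+ 1 ℕ.+ (M ℕ.* (k ℕ.+ suc k) ℕ.+ 1) ≡⟨ lem₁ M k ⟩
      (4 ℕ.* (M ℕ.* k) ℕ.+ 2 ℕ.* M) ℕ.+ 2 <⟨ ℕ.+-monoʳ-< (4 ℕ.* (M ℕ.* k) ℕ.+ 2 ℕ.* M) (ℕ.<-≤-trans (ℕ.≤-trans (s≤s (s≤s (s≤s z≤n))) M≥8) (ℕ.m≤n*m M 2)) ⟩
      (4 ℕ.* (M ℕ.* k) ℕ.+ 2 ℕ.* M) ℕ.+ 2 ℕ.* M ≡⟨ lem₂ M k ⟩
      suc k ℕ.* (4 ℕ.* M) ∎
    where
    open ℕ.≤-Reasoning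
    lem₁ : ∀ M k → M ℕ.* (k ℕ.+ suc k) ℕ.+ 1 ℕ.+ (M ℕ.* (k ℕ.+ suc k) ℕ.+ 1) ≡ (4 ℕ.* (M ℕ.* k) ℕ.+ 2 ℕ.* M) ℕ.+ 2
    lem₁ = ℕS.solve-∀
    lem₂ : ∀ M k → (4 ℕ.* (M ℕ.* k) ℕ.+ 2 ℕ.* M) ℕ.+ 2 ℕ.* M ≡ suc k ℕ.* (4 ℕ.* M)
    lem₂ = ℕS.solve-∀

  module _ (g : ℕ) where

    private
      n = 2 ℕ.* odd g
      M = modulus g
      instance
        M≢0 : NonZero M
        M≢0 = modulus≢0 g
      r = divisorSum (χ g)
      c = odd (g ℕ.+ g)

    open ResidueClass M

    private
      G : ℕ → ℤ
      G q = ⟪ q ≡ 1 ⟫ * r q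

      class⇒coprime : ∀ {q a} → Coprime a M → q ℕ.% M ≡ a ℕ.% M → Coprime q M
      class⇒coprime {q} {a} cop e = coprime-%⁻¹ {q} (subst (λ z → Coprime z M) (sym e) (coprime-% {a} cop))

      G≥0 : ∀ q → 1 ℕ.≤ q → 0ℤ ≤ G q
      G≥0 q 1≤q with q ℕ.% M ℕ.≟ 1 ℕ.% M
      ... | no _ = subst (0ℤ ≤_) (sym (*-zeroˡ (r q))) ≤-refl
      ... | yes e = subst (0ℤ ≤_) (sym (*-identityˡ (r q))) (divisorSum-≥0 g 1≤q (class⇒coprime {q} {1} (1-coprimeTo M) e))

      G-norm≥1 : ∀ k j → 1ℤ ≤ G (norm M n k j)
      G-norm≥1 k j = go (norm M n k j) refl
        where
        go : ∀ q → q ≡ norm M n k j → 1ℤ ≤ G q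
        go q e = subst (1ℤ ≤_) (sym (trans (cong (_* r q) (⟦⟧-yes (q ℕ.% M ℕ.≟ 1 ℕ.% M) q%)) (*-identityˡ (r q))))
          (divisorSum-norm≥1 g (M ℕ.* k ℕ.+ 1) (M ℕ.* j) q e (subst (1 ℕ.≤_) (sym e) (norm-≥1 M n k j)) (class⇒coprime {q} {1} (1-coprimeTo M) q%))
          where
          q% : q ℕ.% M ≡ 1 ℕ.% M
          q% = trans (cong (ℕ._% M) e) (norm-% M n k j)

      bound : ∃[ T ] ∃[ Z ] (T ℕ.+ T ℕ.< Z × + Z ≤ classSum g 1 (T ℕ.* T))
      -- T = M(2k₀ + 1) + 1, so T² is the end of the block k = 2k₀. The blocks k₀, ..., 2k₀ hold (k₀
      -- + 1) · 4M norms, more than 2T = 4Mk₀ + 2M + 2; the width Y = 4M is chosen for this.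
      bound = M ℕ.* (k₀ ℕ.+ suc k₀) ℕ.+ 1 , suc k₀ ℕ.* (4 ℕ.* M) , many-norms M k₀ M≥8 , blocks (suc k₀)
        where
        open Norms M n (4 ℕ.* M) G G≥0 G-norm≥1
        M≥8 : 8 ℕ.≤ M
        M≥8 = subst (8 ℕ.≤_) (sym (modulus≡8l g)) (ℕ.m≤m*n 8 (odd g))

      classSum-target≢0 : ∃[ X ] classSum g c X ≢ 0ℤ
      classSum-target≢0 = go bound
        where
        open ≤-Reasoning
        go : ∃[ T ] ∃[ Z ] (T ℕ.+ T ℕ.< Z × + Z ≤ classSum g 1 (T ℕ.* T)) → ∃[ X ] classSum g c X ≢ 0ℤ
        go (T , Z , 2T< , Z≤) = T ℕ.* T , λ e → ℕ.<⇒≱ 2T< (drop‿+≤+ (begin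
          + Z ≤⟨ Z≤ ⟩
          classSum g 1 (T ℕ.* T) ≤⟨ classSum-compare g T 1 c (1-coprimeTo M) (target-coprime g) (χ-one g) (χ-target g) ⟩
          classSum g c (T ℕ.* T) + + (T ℕ.+ T) ≡⟨ cong (_+ + (T ℕ.+ T)) e ⟩
          0ℤ + + (T ℕ.+ T) ≡⟨ +-identityˡ _ ⟩
          + (T ℕ.+ T) ∎))

    ∃-squareModulo : ∃[ q ] (1 ℕ.≤ q × q ℕ.% M ≡ c ℕ.% M × SquareModulo g q)
    ∃-squareModulo = find (∑≢0⇒∃ (proj₁ classSum-target≢0) (λ q → ⟪ q ≡ c ⟫ * r q) (proj₂ classSum-target≢0))
      where
      find : ∃[ q ] (InRange (proj₁ classSum-target≢0) q × ⟪ q ≡ c ⟫ * r q ≢ 0ℤ) → ∃[ q ] (1 ℕ.≤ q × q ℕ.% M ≡ c ℕ.% M × SquareModulo g q)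
      find (q , range , t≢0) = go (q ℕ.% M ℕ.≟ c ℕ.% M)
        where
        go : Dec (q ℕ.% M ≡ c ℕ.% M) → ∃[ q ] (1 ℕ.≤ q × q ℕ.% M ≡ c ℕ.% M × SquareModulo g q)
        go (no ¬e) = ⊥-elim (t≢0 (trans (cong (_* r q) (⟦⟧-no (q ℕ.% M ℕ.≟ c ℕ.% M) ¬e)) (*-zeroˡ (r q))))
        go (yes e) = q , proj₁ range , e , divisorSum≢0⇒squareModulo g (proj₁ range) (class⇒coprime {q} {c} (target-coprime g) e)
          λ r≡0 → t≢0 (trans (cong (⟪ q ≡ c ⟫ *_) r≡0) (*-zeroʳ ⟪ q ≡ c ⟫))

  -- Three squares

  ≥1⇒0≤ : ∀ {n} → 1 ℕ.≤ n → 0ℤ ≤ + n - 1ℤ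
  ≥1⇒0≤ p = ≤⇒0≤ (+≤+ p)

  -- Put nb = 1 + s²q₁, B = xb and A = (B² + b) / q₁, which is integral as B² + b ≡ b(1 - nb) =
  -- -bs²q₁ ≡ 0 modulo q₁. The matrix (n 0 s; 0 q₁ B; s B A) has determinant n(q₁A - B²) - q₁s² = nb
  -- - q₁s² = 1. In a Gram triple for it the first vector has square n.
  three-squares′ : ∀ {n q₁ s} x → 1 ℕ.≤ n → 1 ℕ.≤ q₁ →
    + s * + s * + q₁ ≈ -1ℤ [mod + n ] → x * x ≈ - + n [mod + q₁ ] →
    ∃[ a ] ∃[ b ] ∃[ c ] (a * a + b * b + c * c ≡ + n)
  three-squares′ {n} {q₁} {s} x 1≤n 1≤q₁ (b by eb) root = project (unimodular⁺⇒gram form)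
    where
    project : ∀ {b c r s t} → Gram (+ n) b c r s t → ∃[ a ] ∃[ b ] ∃[ c ] (a * a + b * b + c * c ≡ + n)
    project ((a , b , c) , _ , _ , e , _) = a , b , c , e
    B = x * b
    nb≡ : 1ℤ + + s * + s * + q₁ ≡ + n * b
    nb≡ = trans (cong (λ z → 1ℤ + z) eb) (lem b (+ n))
      where
      lem : ∀ b n → 1ℤ + (-1ℤ + b * n) ≡ n * b
      lem = solve-∀
    divisible : B * B + b ≈ 0ℤ [mod + q₁ ]
    divisible = begin
      x * b * (x * b) + b ≡⟨ lem₁ x b ⟩
      b * b * (x * x) + b ≈⟨ +-≈ (*-≈ˡ (b * b) root) (≈-refl {b}) ⟩
      b * b * (- + n) + b ≡⟨ lem₂ b (+ n) ⟩
      b * (1ℤ - + n * b) ≡⟨ cong (λ z → b * (1ℤ - z)) nb≡ ⟨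
      b * (1ℤ - (1ℤ + + s * + s * + q₁)) ≈⟨ - (b * + s * + s) by lem₃ b (+ s) (+ q₁) ⟩
      0ℤ ∎
      where
      open ≈-Reasoning (+ q₁)
      lem₁ : ∀ x b → x * b * (x * b) + b ≡ b * b * (x * x) + b
      lem₁ = solve-∀
      lem₂ : ∀ b n → b * b * (- n) + b ≡ b * (1ℤ - n * b)
      lem₂ = solve-∀
      lem₃ : ∀ b s q → b * (1ℤ - (1ℤ + s * s * q)) ≡ 0ℤ + - (b * s * s) * q
      lem₃ = solve-∀
    A = _≈_[mod_].quotient divisible
    A≡ : B * B + b ≡ 0ℤ + A * + q₁
    A≡ = _≈_[mod_].equality divisible
    form : Unimodular⁺ (+ n) (+ q₁) A 0ℤ (+ s) B
    form = unimodular⁺ (≥1⇒0≤ 1≤n) (0≤-by (trans (lem (+ n * + q₁)) (cong (_- 1ℤ) (sym (pos-* n q₁)))) (≥1⇒0≤ (ℕ.*-mono-≤ 1≤n 1≤q₁)))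
      (trans (lem₁ (+ n) (+ q₁) A (+ s) B) (trans (cong (λ z → + n * (z - B * B) - + q₁ * (+ s * + s)) (sym A≡))
        (trans (lem₂ (+ n) B b (+ q₁) (+ s)) (trans (cong (λ z → z - + q₁ * (+ s * + s)) (sym nb≡)) (lem₃ (+ s) (+ q₁))))))
      where
      lem : ∀ x → x - 0ℤ * 0ℤ - 1ℤ ≡ x - 1ℤ
      lem = solve-∀
      lem₁ : ∀ n q A s B → n * q * A + + 2 * 0ℤ * s * B - n * (B * B) - q * (s * s) - A * (0ℤ * 0ℤ) ≡ n * (0ℤ + A * q - B * B) - q * (s * s)
      lem₁ = solve-∀
      lem₂ : ∀ n B b q s → n * (B * B + b - B * B) - q * (s * s) ≡ n * b - q * (s * s)
      lem₂ = solve-∀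
      lem₃ : ∀ s q → 1ℤ + s * s * q - q * (s * s) ≡ 1ℤ
      lem₃ = solve-∀

  target-≈ : ∀ {M n c q} .{{_ : NonZero M}} → M ≡ 4 ℕ.* n → 1 ℕ.+ c ≡ n → q ℕ.% M ≡ c ℕ.% M → + q ≈ -1ℤ [mod + n ]
  target-≈ {M} {n} {c} {q} M≡ c≡ q% = ≈-trans (≈-divisor n 4 (subst (λ m → + q ≈ + c [mod + m ]) M≡ q≈c)) c≈
    where
    q≈c : + q ≈ + c [mod + M ]
    q≈c = ≈-trans (%-≈ q M) (≈-trans (≈-reflexive (cong +_ q%)) (≈-sym (%-≈ c M)))
    c≈ : + c ≈ -1ℤ [mod + n ]
    c≈ = 1ℤ by trans (lem (+ c)) (cong (λ z → -1ℤ + 1ℤ * z) (trans (sym (pos-+ 1 c)) (cong +_ c≡)))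
      where
      lem : ∀ c → c ≡ -1ℤ + 1ℤ * (1ℤ + c)
      lem = solve-∀

  opaque
    three-squares : ∀ g → ∃[ a ] ∃[ b ] ∃[ c ] (a * a + b * b + c * c ≡ + (2 ℕ.* odd g))
    three-squares g = go (∃-squareModulo g)
      where
      instance
        M≢0 : NonZero (modulus g)
        M≢0 = modulus≢0 g
      target+1 : ∀ g → 1 ℕ.+ suc (g ℕ.+ g ℕ.+ (g ℕ.+ g)) ≡ 2 ℕ.* suc (g ℕ.+ g)
      target+1 = ℕS.solve-∀
      go : ∃[ q ] (1 ℕ.≤ q × q ℕ.% modulus g ≡ odd (g ℕ.+ g) ℕ.% modulus g × SquareModulo g q) →
        ∃[ a ] ∃[ b ] ∃[ c ] (a * a + b * b + c * c ≡ + (2 ℕ.* odd g))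
      go (q , 1≤q , q% , q₁ , s , x , q≡ , root) = three-squares′ {2 ℕ.* odd g} {q₁} {s} x (s≤s z≤n)
        (ℕ.n≢0⇒n>0 λ q₁≡0 → contradiction (trans q≡ (cong (ℕ._* (s ℕ.* s)) q₁≡0)) (ℕ.m<n⇒n≢0 1≤q)) minus-one root
        where
        minus-one : + s * + s * + q₁ ≈ -1ℤ [mod + (2 ℕ.* odd g) ]
        minus-one = ≈-trans (≈-reflexive (trans (*-comm (+ s * + s) (+ q₁)) (trans (cong (+ q₁ *_) (sym (pos-* s s))) (trans (sym (pos-* q₁ (s ℕ.* s))) (cong +_ (sym q≡))))))
          (target-≈ (trans (modulus≡8l g) (ℕ.*-assoc 4 2 (odd g))) (target+1 g) q%)

  -- The form x₁² + x₂² + 2x₃² + 4x₄² with prescribed linear part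

  Even Odd : ℤ → Set
  Even x = ∃[ k ] x ≡ + 2 * k
  Odd x = ∃[ k ] x ≡ + 2 * k + 1ℤ

  parity : ∀ x → Even x ⊎ Odd x
  parity x with x %ℕ 2 | n%ℕd<d x 2 | a≡a%ℕn+[a/ℕn]*n x 2
  ... | 0 | _ | e = inj₁ (x /ℕ 2 , trans e (trans (+-identityˡ _) (*-comm (x /ℕ 2) (+ 2))))
  ... | 1 | _ | e = inj₂ (x /ℕ 2 , trans e (trans (+-comm 1ℤ (x /ℕ 2 * + 2)) (cong (λ z → z + 1ℤ) (*-comm (x /ℕ 2) (+ 2)))))
  ... | suc (suc _) | s≤s (s≤s ()) | _

  Even² : ∀ {x} → Even x → x * x ≈ 0ℤ [mod + 4 ]
  Even² (k , refl) = k * k by lem k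
    where
    lem : ∀ k → + 2 * k * (+ 2 * k) ≡ 0ℤ + k * k * + 4
    lem = solve-∀

  Odd² : ∀ {x} → Odd x → x * x ≈ 1ℤ [mod + 8 ]
  Odd² (k , refl) with parity k
  ... | inj₁ (j , refl) = j * (+ 2 * j + 1ℤ) by lem j
    where
    lem : ∀ j → (+ 2 * (+ 2 * j) + 1ℤ) * (+ 2 * (+ 2 * j) + 1ℤ) ≡ 1ℤ + j * (+ 2 * j + 1ℤ) * + 8
    lem = solve-∀
  ... | inj₂ (j , refl) = (j + 1ℤ) * (+ 2 * j + 1ℤ) by lem j
    where
    lem : ∀ j → (+ 2 * (+ 2 * j + 1ℤ) + 1ℤ) * (+ 2 * (+ 2 * j + 1ℤ) + 1ℤ) ≡ 1ℤ + (j + 1ℤ) * (+ 2 * j + 1ℤ) * + 8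
    lem = solve-∀

  Odd²₄ : ∀ {x} → Odd x → x * x ≈ 1ℤ [mod + 4 ]
  Odd²₄ o = ≈-divisor₈₄ (Odd² o)
    where
    ≈-divisor₈₄ : ∀ {a b} → a ≈ b [mod + 8 ] → a ≈ b [mod + 4 ]
    ≈-divisor₈₄ {b = b} (q by e) = + 2 * q by trans e (lem b q)
      where
      lem : ∀ b q → b + q * + 8 ≡ b + + 2 * q * + 4
      lem = solve-∀

  distinct : ∀ {m} x y {_ : True (x ℕ.<? m)} {_ : True (y ℕ.<? m)} {_ : False (x ℕ.≟ y)} {z} →
    z ≈ + x [mod + m ] → z ≈ + y [mod + m ] → ⊥
  distinct x y {x<m} {y<m} {x≢y} p q =
    toWitnessFalse x≢y (small-≈ (toWitness x<m) (toWitness y<m) (≈-trans (≈-sym p) q))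

  x≡y-[y-x] : ∀ x y → x ≡ y - (y - x)
  x≡y-[y-x] = solve-∀

  Odd∧Odd⇒Even : ∀ {x y} → Odd x → Odd y → Even (x - y)
  Odd∧Odd⇒Even (k , refl) (j , refl) = k - j , lem k j
    where
    lem : ∀ k j → + 2 * k + 1ℤ - (+ 2 * j + 1ℤ) ≡ + 2 * (k - j)
    lem = solve-∀

  -- Odd numbers are ±1 modulo 4. Only w² enters the forms, so the sign of w can be chosen to make b
  -- - w divisible by 4.
  Odd-or-negated : ∀ {b w} → Odd b → Odd w → ∃[ x ] (w ≡ b - + 4 * x ⊎ w ≡ - (b - + 4 * x))
  Odd-or-negated (β , refl) (ω , refl) with parity (β - ω)
  ... | inj₁ (τ , e) = τ , inj₁ (trans (lem β ω) (trans (cong (λ z → + 2 * β + 1ℤ - + 2 * z) e) (lem′ β τ)))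
    where
    lem : ∀ β ω → + 2 * ω + 1ℤ ≡ + 2 * β + 1ℤ - + 2 * (β - ω)
    lem = solve-∀
    lem′ : ∀ β τ → + 2 * β + 1ℤ - + 2 * (+ 2 * τ) ≡ + 2 * β + 1ℤ - + 4 * τ
    lem′ = solve-∀
  ... | inj₂ (τ , e) = τ + ω + 1ℤ , inj₂ (trans (lem β ω) (trans (cong (λ z → - (+ 2 * β + 1ℤ - + 2 * (z + + 2 * ω + 1ℤ))) e) (lem′ β τ ω)))
    where
    lem : ∀ β ω → + 2 * ω + 1ℤ ≡ - (+ 2 * β + 1ℤ - + 2 * (β - ω + + 2 * ω + 1ℤ))
    lem = solve-∀
    lem′ : ∀ β τ ω → - (+ 2 * β + 1ℤ - + 2 * (+ 2 * τ + 1ℤ + + 2 * ω + 1ℤ)) ≡ - (+ 2 * β + 1ℤ - + 4 * (τ + ω + 1ℤ))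
    lem′ = solve-∀

  square-± : ∀ {w x} → w ≡ x ⊎ w ≡ - x → w * w ≡ x * x
  square-± (inj₁ refl) = refl
  square-± {x = x} (inj₂ refl) = lem x
    where
    lem : ∀ x → - x * - x ≡ x * x
    lem = solve-∀

  -- The sum is 2 modulo 4 and each square is 0 or 1 modulo 4, so exactly two are odd.
  two-odd-squares : ∀ g → ∃[ A ] ∃[ B ] ∃[ C ] (A * A + B * B + C * C ≡ + (2 ℕ.* odd g) × Odd A × Odd B × Even C)
  two-odd-squares g with three-squares g
  ... | A , B , C , e = go (parity A) (parity B) (parity C)
    where
    total : A * A + B * B + C * C ≈ + 2 [mod + 4 ]
    total = + g by trans e (trans (cong +_ (ℕ.*-distribˡ-+ 2 1 (g ℕ.+ g))) (trans (pos-+ 2 (2 ℕ.* (g ℕ.+ g))) (cong (λ z → + 2 + z) (trans (pos-* 2 (g ℕ.+ g)) (trans (cong (+ 2 *_) (pos-+ g g)) (lem (+ g)))))))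
      where
      lem : ∀ g → + 2 * (g + g) ≡ g * + 4
      lem = solve-∀
    sum : ∀ {x y z} → A * A ≈ x [mod + 4 ] → B * B ≈ y [mod + 4 ] → C * C ≈ z [mod + 4 ] → A * A + B * B + C * C ≈ x + y + z [mod + 4 ]
    sum p q r = +-≈ (+-≈ p q) r
    swap : ∀ a b c → a + b + c ≡ a + c + b
    swap = solve-∀
    rotate : ∀ a b c → a + b + c ≡ b + c + a
    rotate = solve-∀
    not0 : A * A + B * B + C * C ≈ 0ℤ [mod + 4 ] → ⊥
    not0 p = distinct 0 2 p total
    not1 : A * A + B * B + C * C ≈ 1ℤ [mod + 4 ] → ⊥
    not1 p = distinct 1 2 p total
    not3 : A * A + B * B + C * C ≈ + 3 [mod + 4 ] → ⊥
    not3 p = distinct 3 2 p total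
    go : Even A ⊎ Odd A → Even B ⊎ Odd B → Even C ⊎ Odd C →
      ∃[ A ] ∃[ B ] ∃[ C ] (A * A + B * B + C * C ≡ + (2 ℕ.* odd g) × Odd A × Odd B × Even C)
    go (inj₂ a) (inj₂ b) (inj₁ c) = A , B , C , e , a , b , c
    go (inj₂ a) (inj₁ b) (inj₂ c) = A , C , B , trans (swap (A * A) (C * C) (B * B)) e , a , c , b
    go (inj₁ a) (inj₂ b) (inj₂ c) = B , C , A , trans (sym (rotate (A * A) (B * B) (C * C))) e , b , c , a
    go (inj₁ a) (inj₁ b) (inj₁ c) = ⊥-elim (not0 (sum (Even² a) (Even² b) (Even² c)))
    go (inj₁ a) (inj₁ b) (inj₂ c) = ⊥-elim (not1 (sum (Even² a) (Even² b) (Odd²₄ c)))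
    go (inj₁ a) (inj₂ b) (inj₁ c) = ⊥-elim (not1 (sum (Even² a) (Odd²₄ b) (Even² c)))
    go (inj₂ a) (inj₁ b) (inj₁ c) = ⊥-elim (not1 (sum (Odd²₄ a) (Even² b) (Even² c)))
    go (inj₂ a) (inj₂ b) (inj₂ c) = ⊥-elim (not3 (sum (Odd²₄ a) (Odd²₄ b) (Odd²₄ c)))

  positive-odd : ∀ {x} → 0ℤ ≤ x - 1ℤ → Odd x → ∃[ g ] x ≡ + odd g
  positive-odd p (+ k , refl) = k , trans (+-comm (+ 2 * + k) 1ℤ) (cong (λ z → 1ℤ + z) (lem (+ k)))
    where
    lem : ∀ k → + 2 * k ≡ k + k
    lem = solve-∀
  positive-odd () (-[1+ zero ] , refl)
  positive-odd () (-[1+ suc k ] , refl)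

  -- Halve 2n = A² + B² + (2y)² with A, B odd: n = ((A + B)/2)² + ((A - B)/2)² + 2y². The first two
  -- roots have the odd sum A, so exactly one of them is odd.
  odd-form : ∀ {n} → 0ℤ ≤ n - 1ℤ → Odd n →
    ∃[ w ] ∃[ u ] ∃[ y ] (w * w + u * u + + 2 * (y * y) ≡ n × Odd w × Even u)
  odd-form pos o with positive-odd pos o
  ... | g , refl with two-odd-squares g
  ... | A , B , C , e , (α , refl) , (β , refl) , (y , refl) = go (parity (α - β))
    where
    eq : (α + β + 1ℤ) * (α + β + 1ℤ) + (α - β) * (α - β) + + 2 * (y * y) ≡ + odd g
    eq = *-cancelˡ-≡ (+ 2) _ _ (trans (lem α β y) (trans e (pos-* 2 (odd g))))
      where
      lem : ∀ α β y → + 2 * ((α + β + 1ℤ) * (α + β + 1ℤ) + (α - β) * (α - β) + + 2 * (y * y))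
        ≡ (+ 2 * α + 1ℤ) * (+ 2 * α + 1ℤ) + (+ 2 * β + 1ℤ) * (+ 2 * β + 1ℤ) + + 2 * y * (+ 2 * y)
      lem = solve-∀
    split : ∀ α β → α + β + 1ℤ ≡ α - β + + 2 * β + 1ℤ
    split = solve-∀
    go : Even (α - β) ⊎ Odd (α - β) → ∃[ w ] ∃[ u ] ∃[ y ] (w * w + u * u + + 2 * (y * y) ≡ + odd g × Odd w × Even u)
    go (inj₁ (k , p)) = α + β + 1ℤ , α - β , y , eq , (k + β , trans (split α β) (trans (cong (λ z → z + + 2 * β + 1ℤ) p) (lem k β))) , (k , p)
      where
      lem : ∀ k β → + 2 * k + + 2 * β + 1ℤ ≡ + 2 * (k + β) + 1ℤ
      lem = solve-∀
    go (inj₂ (k , p)) = α - β , α + β + 1ℤ , y , trans (cong (_+ + 2 * (y * y)) (+-comm ((α - β) * (α - β)) ((α + β + 1ℤ) * (α + β + 1ℤ)))) eq , (k , p)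
      , (k + β + 1ℤ , trans (split α β) (trans (cong (λ z → z + + 2 * β + 1ℤ) p) (lem k β)))
      where
      lem : ∀ k β → + 2 * k + 1ℤ + + 2 * β + 1ℤ ≡ + 2 * (k + β + 1ℤ)
      lem = solve-∀

  linear quadratic : (x₁ x₂ x₃ x₄ : ℤ) → ℤ
  linear x₁ x₂ x₃ x₄ = x₁ + x₂ + + 2 * x₃ + + 4 * x₄
  quadratic x₁ x₂ x₃ x₄ = x₁ * x₁ + x₂ * x₂ + + 2 * (x₃ * x₃) + + 4 * (x₄ * x₄)

  Representable : ℤ → ℤ → Set
  Representable a b = ∃[ x₁ ] ∃[ x₂ ] ∃[ x₃ ] ∃[ x₄ ] (linear x₁ x₂ x₃ x₄ ≡ b × quadratic x₁ x₂ x₃ x₄ ≡ a)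

  -- 8a - b² = w² + 2v² + 4u² for w = x₁ + x₂ + 2x₃ - 4x₄, v = x₁ + x₂ - 2x₃, u = x₁ - x₂.
  representable-odd : ∀ {a b} → Odd a → Odd b → 0ℤ ≤ + 8 * a - b * b - 1ℤ → Representable a b
  representable-odd {a} {b} oa@(α , refl) ob@(β , refl) pos with odd-form pos (odd-n α β)
    where
    odd-n : ∀ α β → Odd (+ 8 * (+ 2 * α + 1ℤ) - (+ 2 * β + 1ℤ) * (+ 2 * β + 1ℤ))
    odd-n α β = + 4 * (+ 2 * α + 1ℤ) - + 2 * (β * β) - + 2 * β - 1ℤ , lem α β
      where
      lem : ∀ α β → + 8 * (+ 2 * α + 1ℤ) - (+ 2 * β + 1ℤ) * (+ 2 * β + 1ℤ) ≡ + 2 * (+ 4 * (+ 2 * α + 1ℤ) - + 2 * (β * β) - + 2 * β - 1ℤ) + 1ℤ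
      lem = solve-∀
  ... | w , _ , y , e , ow , (z , refl) with Odd-or-negated ob ow
  ... | τ , w± = go-y (parity y)
    where
    -- Half of the identity with w = b - 4τ. Modulo 4 it forces y and z to be odd. Modulo 8 it then
    -- forces τ to be even, because a and b are odd; hence w = b - 8x₄ up to sign, and y, z serve as
    -- v, u.
    eq : b * b + y * y + + 2 * (z * z) ≡ + 4 * a + + 4 * (b * τ) - + 8 * (τ * τ)
    eq = *-cancelˡ-≡ (+ 2) _ _ (trans (l₁ b τ y z) (trans (cong (λ x → x - (b * b - + 8 * (b * τ) + + 16 * (τ * τ)) + + 2 * (b * b)) (trans (cong (λ x → x + + 2 * z * (+ 2 * z) + + 2 * (y * y)) (sym (square-± w±))) e)) (l₂ a b τ)))
      where
      l₁ : ∀ b τ y z → let w = b - + 4 * τ in + 2 * (b * b + y * y + + 2 * (z * z)) ≡ w * w + + 2 * z * (+ 2 * z) + + 2 * (y * y) - (b * b - + 8 * (b * τ) + + 16 * (τ * τ)) + + 2 * (b * b)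
      l₁ = solve-∀
      l₂ : ∀ a b τ → + 8 * a - b * b - (b * b - + 8 * (b * τ) + + 16 * (τ * τ)) + + 2 * (b * b) ≡ + 2 * (+ 4 * a + + 4 * (b * τ) - + 8 * (τ * τ))
      l₂ = solve-∀
    eq₄ : b * b + y * y + + 2 * (z * z) ≈ 0ℤ [mod + 4 ]
    eq₄ = (a + b * τ - + 2 * (τ * τ)) by trans eq (lem a b τ)
      where
      lem : ∀ a b τ → + 4 * a + + 4 * (b * τ) - + 8 * (τ * τ) ≡ 0ℤ + (a + b * τ - + 2 * (τ * τ)) * + 4
      lem = solve-∀
    finish : ∀ {x₄} → τ ≡ + 2 * x₄ → Odd y → Odd z → Representable a b
    finish {x₄} refl oy oz with Odd-or-negated {b - + 4 * x₄} (β - + 2 * x₄ , lem β x₄) oy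
      where
      lem : ∀ β x → + 2 * β + 1ℤ - + 4 * x ≡ + 2 * (β - + 2 * x) + 1ℤ
      lem = solve-∀
    ... | x₃ , y± with Odd∧Odd⇒Even {b - + 4 * x₄ - + 2 * x₃} (β - + 2 * x₄ - x₃ , lem β x₄ x₃) oz
      where
      lem : ∀ β x y → + 2 * β + 1ℤ - + 4 * x - + 2 * y ≡ + 2 * (β - + 2 * x - y) + 1ℤ
      lem = solve-∀
    ... | x₂ , z≡ = b - + 4 * x₄ - + 2 * x₃ - x₂ , x₂ , x₃ , x₄ , l₁ b x₄ x₃ x₂ ,
        *-cancelˡ-≡ (+ 4) _ _ (trans (l₂ b x₄ x₃ x₂) (trans (cong₂ (λ Y Z → b * b + Y + + 2 * (Z * Z) - + 4 * (b * (+ 2 * x₄)) + + 8 * (+ 2 * x₄ * (+ 2 * x₄))) (sym (square-± y±)) (sym z≡′))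
          (trans (cong (λ s → s - + 4 * (b * (+ 2 * x₄)) + + 8 * (+ 2 * x₄ * (+ 2 * x₄))) eq) (l₃ a (b * (+ 2 * x₄)) (+ 2 * x₄ * (+ 2 * x₄))))))
      where
      z≡′ : z ≡ b - + 4 * x₄ - + 2 * x₃ - + 2 * x₂
      z≡′ = trans (x≡y-[y-x] z (b - + 4 * x₄ - + 2 * x₃)) (cong (λ t → b - + 4 * x₄ - + 2 * x₃ - t) z≡)
      l₁ : ∀ b x₄ x₃ x₂ → b - + 4 * x₄ - + 2 * x₃ - x₂ + x₂ + + 2 * x₃ + + 4 * x₄ ≡ b
      l₁ = solve-∀
      l₂ : ∀ b x₄ x₃ x₂ → let s = b - + 4 * x₄ - + 2 * x₃; y = b - + 4 * x₄ - + 4 * x₃; z = s - + 2 * x₂; τ = + 2 * x₄ in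
        + 4 * ((s - x₂) * (s - x₂) + x₂ * x₂ + + 2 * (x₃ * x₃) + + 4 * (x₄ * x₄)) ≡ b * b + y * y + + 2 * (z * z) - + 4 * (b * τ) + + 8 * (τ * τ)
      l₂ = solve-∀
      l₃ : ∀ a p q → + 4 * a + + 4 * p - + 8 * q - + 4 * p + + 8 * q ≡ + 4 * a
      l₃ = solve-∀
    go-τ : Odd y → Odd z → Even τ ⊎ Odd τ → Representable a b
    go-τ oy oz (inj₁ (x₄ , τ≡)) = finish τ≡ oy oz
    go-τ oy oz (inj₂ (k , τ≡)) = ⊥-elim (distinct 4 0 (+-≈ (+-≈ (Odd² ob) (Odd² oy)) (*-≈ˡ (+ 2) (Odd² oz)))
        ((α + 1ℤ + (+ 2 * (β * k) + β + k) - τ * τ) by trans eq (trans (cong (λ t → + 4 * a + + 4 * (b * t) - + 8 * (τ * τ)) τ≡) (lem α β k (τ * τ)))))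
      where
      lem : ∀ α β k t → + 4 * (+ 2 * α + 1ℤ) + + 4 * ((+ 2 * β + 1ℤ) * (+ 2 * k + 1ℤ)) - + 8 * t ≡ 0ℤ + (α + 1ℤ + (+ 2 * (β * k) + β + k) - t) * + 8
      lem = solve-∀
    go-z : Odd y → Even z ⊎ Odd z → Representable a b
    go-z oy (inj₂ oz) = go-τ oy oz (parity τ)
    go-z oy (inj₁ ez) = ⊥-elim (distinct 2 0 (+-≈ (+-≈ (Odd²₄ ob) (Odd²₄ oy)) (*-≈ˡ (+ 2) (Even² ez))) eq₄)
    go-y : Even y ⊎ Odd y → Representable a b
    go-y (inj₂ oy) = go-z oy (parity z)
    go-y (inj₁ ey) with parity z
    ... | inj₁ ez = ⊥-elim (distinct 1 0 (+-≈ (+-≈ (Odd²₄ ob) (Even² ey)) (*-≈ˡ (+ 2) (Even² ez))) eq₄)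
    ... | inj₂ oz = ⊥-elim (distinct 3 0 (+-≈ (+-≈ (Odd²₄ ob) (Even² ey)) (*-≈ˡ (+ 2) (Odd²₄ oz))) eq₄)

  -- The halved form of the previous identity: 4a - b² = w² + 2v² + u² represents (2a, 2b).
  representable-double : ∀ a b x₄ k j →
    (b - + 4 * x₄) * (b - + 4 * x₄) + + 2 * j * (+ 2 * j) + + 2 * ((b - + 2 * k) * (b - + 2 * k)) ≡ + 4 * a - b * b →
    Representable (+ 2 * a) (+ 2 * b)
  representable-double a b x₄ k j e = b - x₄ - k + j , b - x₄ - k - j , k - x₄ , x₄ , l₁ b x₄ k j ,
    *-cancelˡ-≡ (+ 2) _ _ (trans (l₂ b x₄ k j) (trans (cong (_+ b * b) e) (l₃ a b)))
    where
    l₁ : ∀ b x₄ k j → b - x₄ - k + j + (b - x₄ - k - j) + + 2 * (k - x₄) + + 4 * x₄ ≡ + 2 * b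
    l₁ = solve-∀
    l₂ : ∀ b x₄ k j → let x₁ = b - x₄ - k + j; x₂ = b - x₄ - k - j; w = b - + 4 * x₄; v = b - + 2 * k in
      + 2 * (x₁ * x₁ + x₂ * x₂ + + 2 * ((k - x₄) * (k - x₄)) + + 4 * (x₄ * x₄)) ≡ w * w + + 2 * j * (+ 2 * j) + + 2 * (v * v) + b * b
    l₂ = solve-∀
    l₃ : ∀ a b → + 4 * a - b * b + b * b ≡ + 2 * (+ 2 * a)
    l₃ = solve-∀

  -- In 4a - b² = w² + u² + 2y² with b, w odd and u even, an even y would give b² + w² ≡ 0 modulo 4.
  -- So y is odd, and y = b - 2k as `representable-double` demands.
  representable-2odd : ∀ a {b} → Odd b → 0ℤ ≤ + 4 * a - b * b - 1ℤ → Representable (+ 2 * a) (+ 2 * b)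
  representable-2odd a {b} ob@(β , refl) pos with odd-form pos (odd-n a β)
    where
    odd-n : ∀ a β → Odd (+ 4 * a - (+ 2 * β + 1ℤ) * (+ 2 * β + 1ℤ))
    odd-n a β = + 2 * a - + 2 * (β * β) - + 2 * β - 1ℤ , lem a β
      where
      lem : ∀ a β → + 4 * a - (+ 2 * β + 1ℤ) * (+ 2 * β + 1ℤ) ≡ + 2 * (+ 2 * a - + 2 * (β * β) - + 2 * β - 1ℤ) + 1ℤ
      lem = solve-∀
  ... | w , _ , y , e , ow , (j , refl) with Odd-or-negated ob ow
  ... | x₄ , w± = go (parity y)
    where
    go : Even y ⊎ Odd y → Representable (+ 2 * a) (+ 2 * b)
    go (inj₁ (η , refl)) = ⊥-elim (distinct 2 0 (+-≈ (Odd²₄ ob) (Odd²₄ ow))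
      ((a - j * j - + 2 * (η * η)) by trans (l₁ (b * b) (w * w) j η) (trans (cong (λ s → b * b + s - + 2 * j * (+ 2 * j) - + 2 * (+ 2 * η * (+ 2 * η))) e) (l₂ a (b * b) j η))))
      where
      l₁ : ∀ b w j η → b + w ≡ b + (w + + 2 * j * (+ 2 * j) + + 2 * (+ 2 * η * (+ 2 * η))) - + 2 * j * (+ 2 * j) - + 2 * (+ 2 * η * (+ 2 * η))
      l₁ = solve-∀
      l₂ : ∀ a b j η → b + (+ 4 * a - b) - + 2 * j * (+ 2 * j) - + 2 * (+ 2 * η * (+ 2 * η)) ≡ 0ℤ + (a - j * j - + 2 * (η * η)) * + 4
      l₂ = solve-∀
    go (inj₂ oy) with Odd∧Odd⇒Even ob oy
    ... | k , k≡ = representable-double a b x₄ k j (trans (cong₂ (λ W V → W + + 2 * j * (+ 2 * j) + + 2 * (V * V)) (sym (square-± w±)) (sym y≡)) e)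
      where
      y≡ : y ≡ b - + 2 * k
      y≡ = trans (x≡y-[y-x] y b) (cong (λ t → b - t) k≡)

  -- 4a - (2b)² = 4(a - b²), so `representable-double` applies to the doubled roots 2w, 2u, 2v. The
  -- parity condition makes 2w ≡ 2b modulo 4.
  representable-4 : ∀ {a b w u v} → Even (b - w) → w * w + u * u + + 2 * (v * v) ≡ a - b * b → Representable (+ 2 * a) (+ 2 * (+ 2 * b))
  representable-4 {a} {b} {w} {u} {v} (κ , κ≡) e = representable-double a (+ 2 * b) κ (b - v) u
    (trans (l₁ b κ v u) (trans (cong (λ W → + 4 * (W * W + u * u + + 2 * (v * v))) (sym w≡)) (trans (cong (+ 4 *_) e) (l₂ a b))))
    where
    w≡ : w ≡ b - + 2 * κ
    w≡ = trans (x≡y-[y-x] w b) (cong (λ t → b - t) κ≡)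
    l₁ : ∀ b κ v u → let w = b - + 2 * κ; w′ = + 2 * b - + 4 * κ; v′ = + 2 * b - + 2 * (b - v) in
      w′ * w′ + + 2 * u * (+ 2 * u) + + 2 * (v′ * v′) ≡ + 4 * (w * w + u * u + + 2 * (v * v))
    l₁ = solve-∀
    l₂ : ∀ a b → + 4 * (a - b * b) ≡ + 4 * a - + 2 * b * (+ 2 * b)
    l₂ = solve-∀

  -- Of the two single squares in `odd-form` one root is odd and one is even; the one with the
  -- parity of b is taken for w.
  representable-4-odd : ∀ {a b} → Odd (a - b * b) → 0ℤ ≤ a - b * b - 1ℤ → Representable (+ 2 * a) (+ 2 * (+ 2 * b))
  representable-4-odd {a} {b} o pos with odd-form pos o
  ... | w , u , y , e , ow , (j , refl) = go (parity b)
    where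
    go : Even b ⊎ Odd b → Representable (+ 2 * a) (+ 2 * (+ 2 * b))
    go (inj₂ ob) = representable-4 {a} {b} {w} {+ 2 * j} {y} (Odd∧Odd⇒Even ob ow) e
    go (inj₁ (k , b≡)) = representable-4 {a} {b} {+ 2 * j} {w} {y} (k - j , trans (cong (_- + 2 * j) b≡) (lem k j))
      (trans (cong (_+ + 2 * (y * y)) (+-comm (+ 2 * j * (+ 2 * j)) (w * w))) e)
      where
      lem : ∀ k j → + 2 * k - + 2 * j ≡ + 2 * (k - j)
      lem = solve-∀

  -- Write a - b² = 4(2q + 1) and 2(2q + 1) = A² + B² + (2c)² with A, B odd. Then a - b² = (A + 2c)²
  -- + (A - 2c)² + 2B², and A + 2c is odd like b.
  representable-4-even : ∀ {a b} → Odd b → a - b * b ≈ + 4 [mod + 8 ] → 0ℤ ≤ a - b * b - 1ℤ → Representable (+ 2 * a) (+ 2 * (+ 2 * b))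
  representable-4-even {a} {b} ob (q by e) pos = go (positive-odd {+ 2 * q + 1ℤ} pos′ (q , refl))
    where
    l : ∀ q → + 4 + q * + 8 - 1ℤ ≡ + 4 * (+ 2 * q + 1ℤ) - 1ℤ
    l = solve-∀
    pos′ : 0ℤ ≤ + 2 * q + 1ℤ - 1ℤ
    pos′ = pos-cancel (+ 4) (+ 2 * q + 1ℤ) (+≤+ z≤n) (0≤-by (sym (trans (cong (_- 1ℤ) e) (l q))) pos)
    go : ∃[ g ] + 2 * q + 1ℤ ≡ + odd g → Representable (+ 2 * a) (+ 2 * (+ 2 * b))
    go (g , q≡) with two-odd-squares g
    ... | A , B , C , s , oA , oB , (c , refl) = representable-4 {a} {b} {A + + 2 * c} {A - + 2 * c} {B} even
      (trans (l₁ A B c) (trans (cong (+ 2 *_) (trans s (pos-* 2 (odd g)))) (trans (cong (λ t → + 2 * (+ 2 * t)) (sym q≡)) (trans (l₂ q) (sym e)))))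
      where
      l₁ : ∀ A B c → (A + + 2 * c) * (A + + 2 * c) + (A - + 2 * c) * (A - + 2 * c) + + 2 * (B * B) ≡ + 2 * (A * A + B * B + + 2 * c * (+ 2 * c))
      l₁ = solve-∀
      l₂ : ∀ q → + 2 * (+ 2 * (+ 2 * q + 1ℤ)) ≡ + 4 + q * + 8
      l₂ = solve-∀
      even : Even (b - (A + + 2 * c))
      even with Odd∧Odd⇒Even ob oA
      ... | k , k≡ = k - c , trans (lem b A c) (trans (cong (_- + 2 * c) k≡) (lem′ k c))
        where
        lem : ∀ b A c → b - (A + + 2 * c) ≡ b - A - + 2 * c
        lem = solve-∀
        lem′ : ∀ k c → + 2 * k - + 2 * c ≡ + 2 * (k - c)
        lem′ = solve-∀

  -- Eight admissible values of b

  first-change : ∀ {P : ℕ → Set} → Decidable P → ∀ n → ¬ P 0 → P n → ∃[ j ] (¬ P j × P (suc j))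
  first-change P? zero ¬P0 Pn = contradiction Pn ¬P0
  first-change P? (suc n) ¬P0 Pn with P? n
  ... | yes p = first-change P? n ¬P0 p
  ... | no ¬p = n , ¬p , Pn

  nat≥0 : ∀ n → 0ℤ ≤ + n
  nat≥0 n = +≤+ z≤n

  0≤-scale : ∀ n x → 0ℤ ≤ x → 0ℤ ≤ + n * x
  0≤-scale n x p = 0≤-* {+ n} {x} (nat≥0 n) p

  ≥3⇒≥1 : ∀ m → 0ℤ ≤ m - + 3 → 0ℤ ≤ m - 1ℤ
  ≥3⇒≥1 m h = 0≤-by (lem m) (0≤-+ h (nat≥0 2))
    where
    lem : ∀ m → m - 1ℤ ≡ m - + 3 + + 2
    lem = solve-∀

  ≥3⇒≥0 : ∀ m → 0ℤ ≤ m - + 3 → 0ℤ ≤ m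
  ≥3⇒≥0 m h = 1≤⇒0≤ m (≥3⇒≥1 m h)

  -- Multiplied by m, the conditions 7(a - 1) < (b + 1)² and b² < 8a at a = 2(N - b)/m + b read 0 ≤ lower and 0 ≤ upper.
  lower upper : ℤ → ℤ → ℤ → ℤ
  lower m N b = m * (b * b - + 5 * b + + 8) + + 14 * b - + 14 * N - 1ℤ
  upper m N b = + 16 * N - 1ℤ - (m * (b * b) - + 8 * (m * b) + + 16 * b)

  module _ (m N : ℤ) (m≥3 : 0ℤ ≤ m - + 3) (large : 0ℤ ≤ N - + 1056 * (m * m * m)) where

    private
      m≥1 = ≥3⇒≥1 m m≥3
      m≥0 = ≥3⇒≥0 m m≥3

    ¬lower-initial : ∀ r → 0ℤ ≤ r → 0ℤ ≤ m - r → ¬ 0ℤ ≤ lower m N r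
    ¬lower-initial r r≥0 r≤m p = ¬0≤-[1+ 0 ] (0≤-by (lem m N r)
      (0≤-+ p (0≤-+ (0≤-scale 14 (N - + 2 * (m * m * m)) large′) (0≤-+ (0≤-* m≥0 (0≤-* r≤m (0≤-+ m≥0 r≥0)))
        (0≤-+ (0≤-scale 5 (m * r) (0≤-* m≥0 r≥0)) (0≤-+ (0≤-scale 14 (m - r) r≤m)
        (0≤-+ (0≤-scale 27 (m * ((m - 1ℤ) * (m + 1ℤ))) (0≤-* m≥0 (0≤-* m≥1 (0≤-+ m≥0 (nat≥0 1))))) (0≤-scale 5 m m≥0))))))))
      where
      large′ : 0ℤ ≤ N - + 2 * (m * m * m)
      large′ = 0≤-by (l N (m * m * m)) (0≤-+ large (0≤-scale 1054 (m * m * m) (0≤-* (0≤-* m≥0 m≥0) m≥0)))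
        where
        l : ∀ N c → N - + 2 * c ≡ N - + 1056 * c + + 1054 * c
        l = solve-∀
      lem : ∀ m N r → -1ℤ ≡ m * (r * r - + 5 * r + + 8) + + 14 * r - + 14 * N - 1ℤ
        + (+ 14 * (N - + 2 * (m * m * m)) + (m * ((m - r) * (m + r)) + (+ 5 * (m * r) + (+ 14 * (m - r)
        + (+ 27 * (m * ((m - 1ℤ) * (m + 1ℤ))) + + 5 * m)))))
      lem = solve-∀

    lower-final : ∀ b → 0ℤ ≤ b - + 3 → 0ℤ ≤ b - N → 0ℤ ≤ lower m N b
    lower-final b b≥3 b≥N = 0≤-by (lem m N b) (0≤-+ (0≤-* (nat≥0 14) b≥N)
      (0≤-+ (0≤-* m≥0 (0≤-sq (b - + 3))) (0≤-+ (0≤-* m≥0 b≥3) (0≤-+ m≥0 m≥1))))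
      where
      lem : ∀ m N b → m * (b * b - + 5 * b + + 8) + + 14 * b - + 14 * N - 1ℤ
        ≡ + 14 * (b - N) + (m * ((b - + 3) * (b - + 3)) + (m * (b - + 3) + (m + (m - 1ℤ))))
      lem = solve-∀

    lower-mono : ∀ b δ → 0ℤ ≤ b - + 3 → 0ℤ ≤ δ → 0ℤ ≤ lower m N b → 0ℤ ≤ lower m N (b + δ)
    lower-mono b δ b≥3 δ≥0 p = 0≤-by (lem m N b δ) (0≤-+ p (0≤-+ (0≤-* m≥0 (0≤-* δ≥0 (0≤-+ (0≤-* (nat≥0 2) b≥3) (0≤-+ (nat≥0 1) δ≥0)))) (0≤-* (nat≥0 14) δ≥0)))
      where
      lem : ∀ m N b δ → let b′ = b + δ in m * (b′ * b′ - + 5 * b′ + + 8) + + 14 * b′ - + 14 * N - 1ℤ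
        ≡ m * (b * b - + 5 * b + + 8) + + 14 * b - + 14 * N - 1ℤ + (m * (δ * (+ 2 * (b - + 3) + (1ℤ + δ))) + + 14 * δ)
      lem = solve-∀

    -- Here b = y + 8m; this is where the constant 1056 is used.
    upper-last : ∀ y → 0ℤ ≤ y → ¬ 0ℤ ≤ lower m N y → 0ℤ ≤ upper m N (y + + 8 * m)
    upper-last y y≥0 ¬p = 0≤-by (l₁ (upper m N (y + + 8 * m))) (pos-cancel (+ 14) (upper m N (y + + 8 * m) + 1ℤ) (nat≥0 13) (0≤-by (l₂ m N y (+ 1056))
      (0≤-+ (0≤-scale 15 (+ 14 * N - (m * (y * y - + 5 * y + + 8) + + 14 * y)) G) (0≤-+ (0≤-scale 14 (N - + 1056 * (m * m * m)) large) remainder≥0))))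
      where
      G : 0ℤ ≤ + 14 * N - (m * (y * y - + 5 * y + + 8) + + 14 * y)
      G with compare-0≤ 0ℤ (lower m N y)
      ... | inj₁ q = ⊥-elim (¬p (0≤-by (sym (+-identityʳ (lower m N y))) q))
      ... | inj₂ q = 0≤-by (lem (m * (y * y - + 5 * y + + 8) + + 14 * y) N) q
        where
        lem : ∀ l N → + 14 * N - l ≡ 0ℤ - (l - + 14 * N - 1ℤ) - 1ℤ
        lem = solve-∀
      l₁ : ∀ u → u ≡ u + 1ℤ - 1ℤ
      l₁ = solve-∀
      -- 14 · 16N is split as 15 · 14N + 14N. The failure of `lower` at y bounds the first part,
      -- `large` the second; my² is left with coefficient 15 - 14 = 1 and dominates the cross term
      -- of the shift by 8m.
      l₂ : ∀ m N y k → let b = y + + 8 * m in + 14 * (+ 16 * N - 1ℤ - (m * (b * b) - + 8 * (m * b) + + 16 * b) + 1ℤ) - 1ℤ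
        ≡ + 15 * (+ 14 * N - (m * (y * y - + 5 * y + + 8) + + 14 * y)) + (+ 14 * (N - k * (m * m * m))
          + (m * (y * (y - + 224 * m)) + (+ 14 * k - + 896) * (m * m * m) + + 37 * (m * y) - + 14 * y + + 896 * (m * m) - + 1672 * m - 1ℤ))
      l₂ = solve-∀
      -- y² - 224my + 13888m² = (y - 112m)² + 1344m²; the large coefficients stay symbolic for the solver.
      square : ∀ m y h c → m * (y * (y - + 2 * (h * m))) + c * (m * m * m) ≡ m * ((y - h * m) * (y - h * m)) + (c - h * h) * (m * m * m)
      square = solve-∀
      224m : ∀ m → + 224 * m ≡ + 2 * (+ 112 * m)
      224m = solve-∀
      rest : ∀ m y q → q + + 1344 * (m * m * m) + + 37 * (m * y) - + 14 * y + + 896 * (m * m) - + 1672 * m - 1ℤ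
        ≡ q + (+ 37 * ((m - + 3) * y) + (+ 97 * y + (+ 1344 * (m * ((m - 1ℤ) * (m + 1ℤ))) + (+ 896 * (m * (m - 1ℤ)) + (+ 567 * m + (m - 1ℤ))))))
      rest = solve-∀
      remainder≥0 : 0ℤ ≤ m * (y * (y - + 224 * m)) + (+ 14 * + 1056 - + 896) * (m * m * m) + + 37 * (m * y) - + 14 * y + + 896 * (m * m) - + 1672 * m - 1ℤ
      remainder≥0 = 0≤-by
        (trans (cong (λ z → z + + 37 * (m * y) - + 14 * y + + 896 * (m * m) - + 1672 * m - 1ℤ)
          (trans (cong (λ z → m * (y * (y - z)) + + 13888 * (m * m * m)) (224m m)) (square m y (+ 112) (+ 13888))))
          (rest m y (m * ((y - + 112 * m) * (y - + 112 * m)))))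
        (0≤-+ (0≤-* m≥0 (0≤-sq (y - + 112 * m))) (0≤-+ (0≤-scale 37 ((m - + 3) * y) (0≤-* m≥3 y≥0)) (0≤-+ (0≤-scale 97 y y≥0)
        (0≤-+ (0≤-scale 1344 (m * ((m - 1ℤ) * (m + 1ℤ))) (0≤-* m≥0 (0≤-* m≥1 (0≤-+ m≥0 (nat≥0 1)))))
        (0≤-+ (0≤-scale 896 (m * (m - 1ℤ)) (0≤-* m≥0 m≥1)) (0≤-+ (0≤-scale 567 m m≥0) m≥1))))))

    -- `upper` decreases along the progression while `lower` increases. Of the eight values, only
    -- the first has to be tested for `lower` and only the last for `upper`.
    upper-mono : ∀ b i → 0ℤ ≤ b - + 3 → 0ℤ ≤ upper m N (b + m * + i) → 0ℤ ≤ upper m N b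
    upper-mono b zero b≥3 p = subst (λ z → 0ℤ ≤ upper m N z) (lem b m) p
      where
      lem : ∀ b m → b + m * 0ℤ ≡ b
      lem = solve-∀
    upper-mono b (suc i) b≥3 p = 0≤-by (lem m N b (m * + suc i)) (0≤-+ p (0≤-* (0≤-* m≥0 (nat≥0 (suc i)))
      (0≤-+ (0≤-* m≥0 (0≤-+ (0≤-* (nat≥0 2) b≥3) (0≤-by lem′ (0≤-+ m≥3 (0≤-+ (0≤-* m≥0 (nat≥0 i)) (nat≥0 1)))))) (nat≥0 16))))
      where
      lem : ∀ m N b δ → let b′ = b + δ in + 16 * N - 1ℤ - (m * (b * b) - + 8 * (m * b) + + 16 * b)
        ≡ + 16 * N - 1ℤ - (m * (b′ * b′) - + 8 * (m * b′) + + 16 * b′) + δ * (m * (+ 2 * (b - + 3) + (δ - + 2)) + + 16)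
      lem = solve-∀
      lem′ : m * + suc i - + 2 ≡ m - + 3 + (m * + i + 1ℤ)
      lem′ = trans (cong (λ z → m * z - + 2) (pos-+ 1 i)) (lem″ m (+ i))
        where
        lem″ : ∀ m i → m * (1ℤ + i) - + 2 ≡ m - + 3 + (m * i + 1ℤ)
        lem″ = solve-∀

  sumAt : ℤ → ℤ → ℕ → ℤ
  sumAt m b i = b + m * + i

  -- With N = b₀ + me, the equation N = m(a - b)/2 + b at b = b₀ + mi says a - b = 2(e - i).
  squaresAt : ℤ → ℤ → ℤ → ℕ → ℤ
  squaresAt m b e i = + 2 * (e - + i) + sumAt m b i

  record Window (m N : ℤ) : Set where
    field
      b₀ e₀ : ℤ
      N≡ : N ≡ b₀ + m * e₀
      b₀≥0 : 0ℤ ≤ b₀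
      b²<8a : ∀ i → i ℕ.≤ 7 → 0ℤ ≤ + 8 * squaresAt m b₀ e₀ i - sumAt m b₀ i * sumAt m b₀ i - 1ℤ
      7a<b² : ∀ i → i ℕ.≤ 7 → 0ℤ ≤ (sumAt m b₀ i + 1ℤ) * (sumAt m b₀ i + 1ℤ) - + 7 * (squaresAt m b₀ e₀ i - 1ℤ) - 1ℤ

  window-at : ∀ m N (m≥3 : 0ℤ ≤ m - + 3) (large : 0ℤ ≤ N - + 1056 * (m * m * m)) y e → 0ℤ ≤ y →
    N ≡ y + m + m * e → ¬ 0ℤ ≤ lower m N y → 0ℤ ≤ lower m N (y + m) → Window m N
  window-at m N m≥3 large y e y≥0 N≡ ¬l l = record
    { b₀ = b₀ ; e₀ = e ; N≡ = N≡ ; b₀≥0 = ≥3⇒≥0 b₀ b₀≥3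
    ; b²<8a = λ i i≤7 → pos-cancel m (+ 8 * squaresAt m b₀ e i - sumAt m b₀ i * sumAt m b₀ i) m≥1
        (0≤-by (trans (e₁ m b₀ e (+ i)) (cong (λ n → upper m n (b₀ + m * + i)) (sym N≡))) (upper-i i i≤7))
    ; 7a<b² = λ i i≤7 → pos-cancel m ((sumAt m b₀ i + 1ℤ) * (sumAt m b₀ i + 1ℤ) - + 7 * (squaresAt m b₀ e i - 1ℤ)) m≥1
        (0≤-by (trans (e₂ m b₀ e (+ i)) (cong (λ n → lower m n (b₀ + m * + i)) (sym N≡)))
          (lower-mono m N m≥3 large b₀ (m * + i) b₀≥3 (0≤-* m≥0 (nat≥0 i)) l))
    }
    where
    b₀ = y + m
    m≥1 = ≥3⇒≥1 m m≥3
    m≥0 = ≥3⇒≥0 m m≥3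
    b₀≥3 : 0ℤ ≤ b₀ - + 3
    b₀≥3 = 0≤-by (lem y m) (0≤-+ y≥0 m≥3)
      where
      lem : ∀ y m → y + m - + 3 ≡ y + (m - + 3)
      lem = solve-∀
    upper-i : ∀ i → i ℕ.≤ 7 → 0ℤ ≤ upper m N (b₀ + m * + i)
    upper-i i i≤7 = go (ℕ.m≤n⇒∃[o]m+o≡n i≤7)
      where
      lem : ∀ b m i → b + m * i - + 3 ≡ b - + 3 + m * i
      lem = solve-∀
      lem′ : ∀ y m i i′ → y + (1ℤ + (i + i′)) * m ≡ y + m + m * i + m * i′
      lem′ = solve-∀
      go : ∃[ i′ ] i ℕ.+ i′ ≡ 7 → 0ℤ ≤ upper m N (b₀ + m * + i)
      go (i′ , i+i′≡7) = upper-mono m N m≥3 large (b₀ + m * + i) i′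
        (0≤-by (lem b₀ m (+ i)) (0≤-+ b₀≥3 (0≤-* m≥0 (nat≥0 i))))
        (subst (λ z → 0ℤ ≤ upper m N z) eq (upper-last m N m≥3 large y y≥0 ¬l))
        where
        eq : y + + 8 * m ≡ b₀ + m * + i + m * + i′
        eq = trans (cong (λ z → y + (1ℤ + z) * m) (trans (cong +_ (sym i+i′≡7)) (pos-+ i i′))) (lem′ y m (+ i) (+ i′))
    e₁ : ∀ m b₀ e i → let b = b₀ + m * i; N = b₀ + m * e in
      m * (+ 8 * (+ 2 * (e - i) + b) - b * b) - 1ℤ ≡ + 16 * N - 1ℤ - (m * (b * b) - + 8 * (m * b) + + 16 * b)
    e₁ = solve-∀
    e₂ : ∀ m b₀ e i → let b = b₀ + m * i; N = b₀ + m * e in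
      m * ((b + 1ℤ) * (b + 1ℤ) - + 7 * (+ 2 * (e - i) + b - 1ℤ)) - 1ℤ ≡ m * (b * b - + 5 * b + + 8) + + 14 * b - + 14 * N - 1ℤ
    e₂ = solve-∀

  -- Along the residue class of N modulo m, the condition `lower` fails at the remainder and holds
  -- far out. The window starts just after a failure y; that failure bounds y from above, as
  -- `upper-last` requires.
  window : ∀ m N → 3 ℕ.≤ m → 0ℤ ≤ + N - + 1056 * (+ m * + m * + m) → Window (+ m) (+ N)
  window m N 3≤m large = go (first-change L? (3 ℕ.+ N) at-0 at-final)
    where
    instance
      m≢0 : NonZero m
      m≢0 = ℕ.>-nonZero (ℕ.≤-trans (s≤s z≤n) 3≤m)
    r = N ℕ.% m
    m≥3 : 0ℤ ≤ + m - + 3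
    m≥3 = ≤⇒0≤ (+≤+ 3≤m)
    m≥1 : 0ℤ ≤ + m - 1ℤ
    m≥1 = ≤⇒0≤ (+≤+ (ℕ.≤-trans (s≤s z≤n) 3≤m))
    at : ℕ → ℤ
    at j = + r + + m * + j
    L : ℕ → Set
    L j = 0ℤ ≤ lower (+ m) (+ N) (at j)
    L? : Decidable L
    L? j = 0ℤ ℤ.≤? lower (+ m) (+ N) (at j)
    at-0 : ¬ L 0
    at-0 p = ¬lower-initial (+ m) (+ N) m≥3 large (+ r) (nat≥0 r) (≤⇒0≤ (+≤+ (ℕ.<⇒≤ (ℕ.m%n<n N m)))) (subst (λ z → 0ℤ ≤ lower (+ m) (+ N) z) (lem (+ r) (+ m)) p)
      where
      lem : ∀ r m → r + m * 0ℤ ≡ r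
      lem = solve-∀
    at-final : L (3 ℕ.+ N)
    at-final = lower-final (+ m) (+ N) m≥3 large (at (3 ℕ.+ N))
      (0≤-by (trans (cong (λ z → + r + + m * z - + 3) (pos-+ 3 N)) (l₁ (+ r) (+ m) (+ N))) (0≤-+ (nat≥0 r) (0≤-+ (0≤-* (nat≥0 m) (nat≥0 N)) (0≤-scale 3 (+ m - 1ℤ) m≥1))))
      (0≤-by (trans (cong (λ z → + r + + m * z - + N) (pos-+ 3 N)) (l₂ (+ r) (+ m) (+ N))) (0≤-+ (nat≥0 r) (0≤-+ (0≤-* m≥1 (nat≥0 N)) (0≤-scale 3 (+ m) (nat≥0 m)))))
      where
      l₁ : ∀ r m N → r + m * (+ 3 + N) - + 3 ≡ r + (m * N + + 3 * (m - 1ℤ))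
      l₁ = solve-∀
      l₂ : ∀ r m N → r + m * (+ 3 + N) - N ≡ r + ((m - 1ℤ) * N + + 3 * m)
      l₂ = solve-∀
    go : ∃[ j ] (¬ L j × L (suc j)) → Window (+ m) (+ N)
    go (j , ¬l , l) = window-at (+ m) (+ N) m≥3 large (at j) (+ (N ℕ./ m) - + j - 1ℤ) (0≤-+ (nat≥0 r) (0≤-* (nat≥0 m) (nat≥0 j)))
      N≡ ¬l (subst (λ z → 0ℤ ≤ lower (+ m) (+ N) z) (trans (cong (λ z → + r + + m * z) (pos-+ 1 j)) (lem (+ r) (+ m) (+ j))) l)
      where
      lem : ∀ r m j → r + m * (1ℤ + j) ≡ r + m * j + m
      lem = solve-∀
      N≡ : + N ≡ at j + + m + + m * (+ (N ℕ./ m) - + j - 1ℤ)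
      N≡ = trans (cong +_ (ℕ.m≡m%n+[m/n]*n N m)) (trans (pos-+ r _) (trans (cong (λ z → + r + z) (pos-* (N ℕ./ m) m)) (lem′ (+ r) (+ m) (+ (N ℕ./ m)) (+ j))))
        where
        lem′ : ∀ r m q j → r + q * m ≡ r + m * j + m + m * (q - j - 1ℤ)
        lem′ = solve-∀

  -- For b₀ = 4γ and m = 4ν the i-th pair is (2a, 4x) with x = γ + νi and a = e - i + 2x. This is a
  -- - x², the number that `representable-4` has to write as w² + u² + 2v².
  κ : ℤ → ℤ → ℤ → ℤ → ℤ
  κ e γ ν i = e - i + + 2 * (γ + ν * i) - (γ + ν * i) * (γ + ν * i)

  opaque
    -- The factor 7 stands for -1. If ν is even, x keeps its parity and k changes parity with i. If
    -- ν is odd, k has constant parity; when it is even, k ≡ e + 2γ - 1 + (2ν - 1)i for the four i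
    -- with x odd, and these k run through all even residues modulo 8. Hence the need for eight
    -- values of i.
    residue-choice : ∀ {e} → e ℕ.< 8 → ∀ {γ} → γ ℕ.< 8 → ∀ {ν} → ν ℕ.< 8 → ∃[ i ] (i ℕ.< 8 ×
      (let x = γ ℕ.+ ν ℕ.* i; k = e ℕ.+ 2 ℕ.* x ℕ.+ 7 ℕ.* (i ℕ.+ x ℕ.* x) in
       k ℕ.% 2 ≡ 1 ⊎ (x ℕ.% 2 ≡ 1 × k ℕ.% 8 ≡ 4)))
    residue-choice = from-yes (ℕ.allUpTo? (λ e → ℕ.allUpTo? (λ γ → ℕ.allUpTo? (λ ν → ℕ.anyUpTo? (λ i →
      let x = γ ℕ.+ ν ℕ.* i; k = e ℕ.+ 2 ℕ.* x ℕ.+ 7 ℕ.* (i ℕ.+ x ℕ.* x) in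
      (k ℕ.% 2 ℕ.≟ 1) ⊎-dec ((x ℕ.% 2 ℕ.≟ 1) ×-dec (k ℕ.% 8 ℕ.≟ 4))) 8) 8) 8) 8)

  ≈-Odd : ∀ {x} k → x ≈ + k [mod + 8 ] → k ℕ.% 2 ≡ 1 → Odd x
  ≈-Odd k (q by e) k%2 = + (k ℕ./ 2) + + 4 * q , trans e (trans (cong (λ z → z + q * + 8) k≡) (lem (+ (k ℕ./ 2)) q))
    where
    k≡ : + k ≡ 1ℤ + + (k ℕ./ 2) * + 2
    k≡ = trans (cong +_ (trans (ℕ.m≡m%n+[m/n]*n k 2) (cong (ℕ._+ k ℕ./ 2 ℕ.* 2) k%2))) (trans (pos-+ 1 (k ℕ./ 2 ℕ.* 2)) (cong (λ z → 1ℤ + z) (pos-* (k ℕ./ 2) 2)))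
    lem : ∀ h q → 1ℤ + h * + 2 + q * + 8 ≡ + 2 * (h + + 4 * q) + 1ℤ
    lem = solve-∀

  κ-choice : ∀ e γ ν → ∃[ i ] (i ℕ.≤ 7 × (Odd (κ e γ ν (+ i)) ⊎ (Odd (γ + ν * + i) × κ e γ ν (+ i) ≈ + 4 [mod + 8 ])))
  κ-choice e γ ν with residue-choice (n%ℕd<d e 8) (n%ℕd<d γ 8) (n%ℕd<d ν 8)
  ... | i , i<8 , h = i , ℕ.≤-pred i<8 , go h
    where
    e′ = e %ℕ 8
    γ′ = γ %ℕ 8
    ν′ = ν %ℕ 8
    x′ = γ′ ℕ.+ ν′ ℕ.* i
    k′ = e′ ℕ.+ 2 ℕ.* x′ ℕ.+ 7 ℕ.* (i ℕ.+ x′ ℕ.* x′)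
    x≈ : γ + ν * + i ≈ + x′ [mod + 8 ]
    x≈ = ≈-trans (+-≈ (%ℕ-≈ γ 8) (*-≈ʳ (+ i) (%ℕ-≈ ν 8))) (≈-reflexive (trans (cong (λ z → + γ′ + z) (sym (pos-* ν′ i))) (sym (pos-+ γ′ (ν′ ℕ.* i)))))
    κ≈ : κ e γ ν (+ i) ≈ + k′ [mod + 8 ]
    κ≈ = begin
      κ e γ ν (+ i) ≈⟨ - (+ i + x * x) by lem e (+ i) x ⟩
      e + + 2 * x + + 7 * (+ i + x * x) ≈⟨ +-≈ (+-≈ (%ℕ-≈ e 8) (*-≈ˡ (+ 2) x≈)) (*-≈ˡ (+ 7) (+-≈ (≈-refl {+ i}) (*-≈ x≈ x≈))) ⟩
      + e′ + + 2 * + x′ + + 7 * (+ i + + x′ * + x′) ≡⟨ cong₂ (λ y z → + e′ + y + z) (pos-* 2 x′) (trans (pos-* 7 (i ℕ.+ x′ ℕ.* x′)) (cong (+ 7 *_) (trans (pos-+ i (x′ ℕ.* x′)) (cong (λ z → + i + z) (pos-* x′ x′))))) ⟨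
      + e′ + + (2 ℕ.* x′) + + (7 ℕ.* (i ℕ.+ x′ ℕ.* x′)) ≡⟨ trans (pos-+ (e′ ℕ.+ 2 ℕ.* x′) _) (cong (_+ + (7 ℕ.* (i ℕ.+ x′ ℕ.* x′))) (pos-+ e′ (2 ℕ.* x′))) ⟨
      + k′ ∎
      where
      open ≈-Reasoning (+ 8)
      x = γ + ν * + i
      lem : ∀ e i x → e - i + + 2 * x - x * x ≡ e + + 2 * x + + 7 * (i + x * x) + - (i + x * x) * + 8
      lem = solve-∀
    go : k′ ℕ.% 2 ≡ 1 ⊎ (x′ ℕ.% 2 ≡ 1 × k′ ℕ.% 8 ≡ 4) → Odd (κ e γ ν (+ i)) ⊎ (Odd (γ + ν * + i) × κ e γ ν (+ i) ≈ + 4 [mod + 8 ])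
    go (inj₁ o) = inj₁ (≈-Odd k′ κ≈ o)
    go (inj₂ (o , f)) = inj₂ (≈-Odd x′ x≈ o , ≈-trans κ≈ (≈-trans (%-≈ k′ 8) (≈-reflexive (cong +_ f))))

  -- Sums of polygonal numbers

  open import Data.Nat.Combinatorics using (_C_; nCk+nC[k+1]≡[n+1]C[k+1]; nC1≡n)

  Admissible : ℤ → ℤ → Set
  Admissible a b = 0ℤ ≤ (b + 1ℤ) * (b + 1ℤ) - + 7 * (a - 1ℤ) - 1ℤ

  -- If x₁ ≤ -1, then b + 1 ≤ b - x₁, and Cauchy–Schwarz for the weights 1, 2, 4 gives (b - x₁)² ≤ 7(a - x₁²).
  x₁≥0 : ∀ x₁ x₂ x₃ x₄ → (let b = linear x₁ x₂ x₃ x₄; a = quadratic x₁ x₂ x₃ x₄) →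
    0ℤ ≤ b → Admissible a b → 0ℤ ≤ x₁
  x₁≥0 x₁ x₂ x₃ x₄ b≥0 h with compare-0≤ 0ℤ x₁
  ... | inj₁ q = 0≤-by (sym (+-identityʳ x₁)) q
  ... | inj₂ p = ⊥-elim (¬0≤-[1+ 0 ] (0≤-by (lem x₁ x₂ x₃ x₄) (0≤-+ h
      (0≤-+ (0≤-+ (0≤-+ (0≤-scale 2 _ (0≤-sq (x₂ - x₃))) (0≤-scale 4 _ (0≤-sq (x₂ - x₄)))) (0≤-scale 8 _ (0≤-sq (x₃ - x₄))))
        (0≤-+ (0≤-* p (0≤-+ (0≤-+ (0≤-scale 2 b b≥0) p) (nat≥0 2))) (0≤-scale 7 _ (0≤-* p (0≤-+ p (nat≥0 2)))))))))
    where
    b = linear x₁ x₂ x₃ x₄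
    lem : ∀ x₁ x₂ x₃ x₄ → let b = x₁ + x₂ + + 2 * x₃ + + 4 * x₄; a = x₁ * x₁ + x₂ * x₂ + + 2 * (x₃ * x₃) + + 4 * (x₄ * x₄); p = 0ℤ - x₁ - 1ℤ in
      -1ℤ ≡ (b + 1ℤ) * (b + 1ℤ) - + 7 * (a - 1ℤ) - 1ℤ
      + (+ 2 * ((x₂ - x₃) * (x₂ - x₃)) + + 4 * ((x₂ - x₄) * (x₂ - x₄)) + + 8 * ((x₃ - x₄) * (x₃ - x₄))
      + (p * (+ 2 * b + p + + 2) + + 7 * (p * (p + + 2))))
    lem = solve-∀

  -- If x₃ ≤ -1, then b + 1 < b - 2x₃, and Cauchy-Schwarz for the weights 1, 1, 4 gives (b - 2x₃)² ≤
  -- 6(a - 2x₃²). The remaining a of 7a is nonnegative.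
  x₃≥0 : ∀ x₁ x₂ x₃ x₄ → (let b = linear x₁ x₂ x₃ x₄; a = quadratic x₁ x₂ x₃ x₄) →
    0ℤ ≤ b → Admissible a b → 0ℤ ≤ x₃
  x₃≥0 x₁ x₂ x₃ x₄ b≥0 h with compare-0≤ 0ℤ x₃
  ... | inj₁ q = 0≤-by (sym (+-identityʳ x₃)) q
  ... | inj₂ p = ⊥-elim (¬0≤-[1+ 0 ] (0≤-by (lem x₁ x₂ x₃ x₄) (0≤-+ h
      (0≤-+ (0≤-+ (0≤-+ (0≤-sq (x₁ - x₂)) (0≤-scale 4 _ (0≤-sq (x₁ - x₄)))) (0≤-scale 4 _ (0≤-sq (x₂ - x₄))))
        (0≤-+ (0≤-+ (0≤-+ (0≤-+ (0≤-sq x₁) (0≤-sq x₂)) (0≤-scale 2 _ (0≤-sq x₃))) (0≤-scale 4 _ (0≤-sq x₄)))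
          (0≤-+ (0≤-* (0≤-+ (0≤-scale 2 _ p) (nat≥0 1)) (0≤-+ (0≤-+ (0≤-scale 2 b b≥0) (0≤-scale 2 _ p)) (nat≥0 3)))
            (0≤-+ (0≤-+ (0≤-scale 12 _ (0≤-sq (0ℤ - x₃ - 1ℤ))) (0≤-scale 24 _ p)) (nat≥0 5))))))))
    where
    b = linear x₁ x₂ x₃ x₄
    lem : ∀ x₁ x₂ x₃ x₄ → let b = x₁ + x₂ + + 2 * x₃ + + 4 * x₄; a = x₁ * x₁ + x₂ * x₂ + + 2 * (x₃ * x₃) + + 4 * (x₄ * x₄); p = 0ℤ - x₃ - 1ℤ in
      -1ℤ ≡ (b + 1ℤ) * (b + 1ℤ) - + 7 * (a - 1ℤ) - 1ℤ
      + ((x₁ - x₂) * (x₁ - x₂) + + 4 * ((x₁ - x₄) * (x₁ - x₄)) + + 4 * ((x₂ - x₄) * (x₂ - x₄))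
      + (a
      + ((+ 2 * p + 1ℤ) * (+ 2 * b + + 2 * p + + 3)
      + (+ 12 * (p * p) + + 24 * p + + 5))))
    lem = solve-∀

  -- If x₄ ≤ -1, then b + 1 < b - 4x₄, and the weights 1, 1, 2 give (b - 4x₄)² ≤ 4(a - 4x₄²). The
  -- remaining 3a of 7a is nonnegative.
  x₄≥0 : ∀ x₁ x₂ x₃ x₄ → (let b = linear x₁ x₂ x₃ x₄; a = quadratic x₁ x₂ x₃ x₄) →
    0ℤ ≤ b → Admissible a b → 0ℤ ≤ x₄
  x₄≥0 x₁ x₂ x₃ x₄ b≥0 h with compare-0≤ 0ℤ x₄
  ... | inj₁ q = 0≤-by (sym (+-identityʳ x₄)) q
  ... | inj₂ p = ⊥-elim (¬0≤-[1+ 0 ] (0≤-by (lem x₁ x₂ x₃ x₄) (0≤-+ h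
      (0≤-+ (0≤-+ (0≤-+ (0≤-sq (x₁ - x₂)) (0≤-scale 2 _ (0≤-sq (x₁ - x₃)))) (0≤-scale 2 _ (0≤-sq (x₂ - x₃))))
        (0≤-+ (0≤-scale 3 _ (0≤-+ (0≤-+ (0≤-+ (0≤-sq x₁) (0≤-sq x₂)) (0≤-scale 2 _ (0≤-sq x₃))) (0≤-scale 4 _ (0≤-sq x₄))))
          (0≤-+ (0≤-* (0≤-+ (0≤-scale 4 _ p) (nat≥0 3)) (0≤-+ (0≤-+ (0≤-scale 2 b b≥0) (0≤-scale 4 _ p)) (nat≥0 5)))
            (0≤-+ (0≤-+ (0≤-scale 16 _ (0≤-sq (0ℤ - x₄ - 1ℤ))) (0≤-scale 32 _ p)) (nat≥0 9))))))))
    where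
    b = linear x₁ x₂ x₃ x₄
    lem : ∀ x₁ x₂ x₃ x₄ → let b = x₁ + x₂ + + 2 * x₃ + + 4 * x₄; a = x₁ * x₁ + x₂ * x₂ + + 2 * (x₃ * x₃) + + 4 * (x₄ * x₄); p = 0ℤ - x₄ - 1ℤ in
      -1ℤ ≡ (b + 1ℤ) * (b + 1ℤ) - + 7 * (a - 1ℤ) - 1ℤ
      + ((x₁ - x₂) * (x₁ - x₂) + + 2 * ((x₁ - x₃) * (x₁ - x₃)) + + 2 * ((x₂ - x₃) * (x₂ - x₃))
      + (+ 3 * a
      + ((+ 4 * p + + 3) * (+ 2 * b + + 4 * p + + 5)
      + (+ 16 * (p * p) + + 32 * p + + 9))))
    lem = solve-∀

  representable-ℕ : ∀ {a b} → 0ℤ ≤ b → Admissible a b → Representable a b →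
    ∃[ x₁ ] ∃[ x₂ ] ∃[ x₃ ] ∃[ x₄ ]
      (linear (+ x₁) (+ x₂) (+ x₃) (+ x₄) ≡ b × quadratic (+ x₁) (+ x₂) (+ x₃) (+ x₄) ≡ a)
  representable-ℕ b≥0 h (x₁ , x₂ , x₃ , x₄ , refl , refl) = go x₁ x₂ x₃ x₄
      (x₁≥0 x₁ x₂ x₃ x₄ b≥0 h)
      (x₁≥0 x₂ x₁ x₃ x₄ (subst (0ℤ ≤_) b-swap b≥0) (subst₂ Admissible a-swap b-swap h))
      (x₃≥0 x₁ x₂ x₃ x₄ b≥0 h) (x₄≥0 x₁ x₂ x₃ x₄ b≥0 h)
    where
    swap : ∀ x y c d → x + y + c + d ≡ y + x + c + d
    swap = solve-∀
    b-swap = swap x₁ x₂ (+ 2 * x₃) (+ 4 * x₄)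
    a-swap = swap (x₁ * x₁) (x₂ * x₂) (+ 2 * (x₃ * x₃)) (+ 4 * (x₄ * x₄))
    go : ∀ x₁ x₂ x₃ x₄ → 0ℤ ≤ x₁ → 0ℤ ≤ x₂ → 0ℤ ≤ x₃ → 0ℤ ≤ x₄ →
      ∃[ y₁ ] ∃[ y₂ ] ∃[ y₃ ] ∃[ y₄ ]
      (linear (+ y₁) (+ y₂) (+ y₃) (+ y₄) ≡ linear x₁ x₂ x₃ x₄ × quadratic (+ y₁) (+ y₂) (+ y₃) (+ y₄) ≡ quadratic x₁ x₂ x₃ x₄)
    go (+ y₁) (+ y₂) (+ y₃) (+ y₄) _ _ _ _ = y₁ , y₂ , y₃ , y₄ , refl , refl

  2*nC2 : ∀ n → + 2 * + (n C 2) ≡ + n * + n - + n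
  2*nC2 zero = refl
  2*nC2 (suc n) = trans (cong (λ z → + 2 * + z) (trans (sym (nCk+nC[k+1]≡[n+1]C[k+1] n 1)) (cong (ℕ._+ n C 2) (nC1≡n n))))
    (trans (cong (+ 2 *_) (pos-+ n (n C 2))) (trans (*-distribˡ-+ (+ 2) (+ n) (+ (n C 2))) (trans (cong (λ z → + 2 * + n + z) (2*nC2 n))
      (trans (lem (+ n)) (cong (λ z → z * z - z) (sym (pos-+ 1 n)))))))
    where
    lem : ∀ n → + 2 * n + (n * n - n) ≡ (1ℤ + n) * (1ℤ + n) - (1ℤ + n)
    lem = solve-∀

  2*polygonal : ∀ m x → + 2 * + polygonal m x ≡ + m * (+ x * + x - + x) + + 2 * + x
  2*polygonal m x = trans (cong (+ 2 *_) (trans (pos-+ (m ℕ.* (x C 2)) x) (cong (_+ + x) (pos-* m (x C 2)))))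
    (trans (lem (+ m) (+ (x C 2)) (+ x)) (cong (λ z → + m * z + + 2 * + x) (2*nC2 x)))
    where
    lem : ∀ m c x → + 2 * (m * c + x) ≡ m * (+ 2 * c) + + 2 * x
    lem = solve-∀

  polygonal-sum : ∀ m N e x₁ x₂ x₃ x₄ → (let b = linear (+ x₁) (+ x₂) (+ x₃) (+ x₄)) →
    quadratic (+ x₁) (+ x₂) (+ x₃) (+ x₄) ≡ + 2 * e + b → + N ≡ b + + m * e →
    polygonal m x₁ ℕ.+ polygonal m x₂ ℕ.+ 2 ℕ.* polygonal m x₃ ℕ.+ 4 ℕ.* polygonal m x₄ ≡ N
  polygonal-sum m N e x₁ x₂ x₃ x₄ a≡ N≡ = +-injective (*-cancelˡ-≡ (+ 2) _ _ (begin
      + 2 * + (p₁ ℕ.+ p₂ ℕ.+ 2 ℕ.* p₃ ℕ.+ 4 ℕ.* p₄) ≡⟨ cong (+ 2 *_) (trans (pos-+ (p₁ ℕ.+ p₂ ℕ.+ 2 ℕ.* p₃) (4 ℕ.* p₄)) (cong₂ _+_ (trans (pos-+ (p₁ ℕ.+ p₂) (2 ℕ.* p₃)) (cong₂ _+_ (pos-+ p₁ p₂) (pos-* 2 p₃))) (pos-* 4 p₄))) ⟩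
      + 2 * (+ p₁ + + p₂ + + 2 * + p₃ + + 4 * + p₄) ≡⟨ l₁ (+ p₁) (+ p₂) (+ p₃) (+ p₄) ⟩
      + 2 * + p₁ + + 2 * + p₂ + + 2 * (+ 2 * + p₃) + + 4 * (+ 2 * + p₄) ≡⟨ cong₂ _+_ (cong₂ _+_ (cong₂ _+_ (2*polygonal m x₁) (2*polygonal m x₂)) (cong (+ 2 *_) (2*polygonal m x₃))) (cong (+ 4 *_) (2*polygonal m x₄)) ⟩
      P x₁ + P x₂ + + 2 * P x₃ + + 4 * P x₄ ≡⟨ l₂ (+ m) (+ x₁) (+ x₂) (+ x₃) (+ x₄) ⟩
      + m * (a - b) + + 2 * b ≡⟨ cong (λ z → + m * (z - b) + + 2 * b) a≡ ⟩
      + m * (+ 2 * e + b - b) + + 2 * b ≡⟨ l₃ (+ m) e b ⟩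
      + 2 * (b + + m * e) ≡⟨ cong (+ 2 *_) N≡ ⟨
      + 2 * + N ∎))
    where
    open ≡-Reasoning
    p₁ = polygonal m x₁
    p₂ = polygonal m x₂
    p₃ = polygonal m x₃
    p₄ = polygonal m x₄
    P : ℕ → ℤ
    P x = + m * (+ x * + x - + x) + + 2 * + x
    b = linear (+ x₁) (+ x₂) (+ x₃) (+ x₄)
    a = quadratic (+ x₁) (+ x₂) (+ x₃) (+ x₄)
    l₁ : ∀ p q r s → + 2 * (p + q + + 2 * r + + 4 * s) ≡ + 2 * p + + 2 * q + + 2 * (+ 2 * r) + + 4 * (+ 2 * s)
    l₁ = solve-∀
    l₂ : ∀ m x₁ x₂ x₃ x₄ → m * (x₁ * x₁ - x₁) + + 2 * x₁ + (m * (x₂ * x₂ - x₂) + + 2 * x₂) + + 2 * (m * (x₃ * x₃ - x₃) + + 2 * x₃) + + 4 * (m * (x₄ * x₄ - x₄) + + 2 * x₄)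
      ≡ m * (x₁ * x₁ + x₂ * x₂ + + 2 * (x₃ * x₃) + + 4 * (x₄ * x₄) - (x₁ + x₂ + + 2 * x₃ + + 4 * x₄)) + + 2 * (x₁ + x₂ + + 2 * x₃ + + 4 * x₄)
    l₂ = solve-∀
    l₃ : ∀ m e b → m * (+ 2 * e + b - b) + + 2 * b ≡ + 2 * (b + m * e)
    l₃ = solve-∀

  module _ (m b e : ℤ) where

    private
      S = sumAt m b
      Q = squaresAt m b e

      Choice : Set
      Choice = ∃[ i ] (i ℕ.≤ 7 × Representable (Q i) (S i))

      0≤7 : 0 ℕ.≤ 7
      0≤7 = z≤n
      1≤7 : 1 ℕ.≤ 7
      1≤7 = s≤s z≤n

    module _ (pos : ∀ i → i ℕ.≤ 7 → 0ℤ ≤ + 8 * Q i - S i * S i - 1ℤ) where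

      private
        odd-choice : ∀ i → i ℕ.≤ 7 → Odd (S i) → Choice
        odd-choice i i≤7 (k , S≡) = i , i≤7 , representable-odd (e - + i + k , trans (cong (λ z → + 2 * (e - + i) + z) S≡) (lem (e - + i) k)) (k , S≡) (pos i i≤7)
          where
          lem : ∀ x k → + 2 * x + (+ 2 * k + 1ℤ) ≡ + 2 * (x + k) + 1ℤ
          lem = solve-∀

        2odd-choice : ∀ i → i ℕ.≤ 7 → ∀ b′ → S i ≡ + 2 * b′ → Odd b′ → Choice
        2odd-choice i i≤7 b′ S≡ o = i , i≤7 , subst₂ Representable (sym Q≡) (sym S≡) (representable-2odd (e - + i + b′) o
            (pos-cancel (+ 4) (+ 4 * (e - + i + b′) - b′ * b′) (nat≥0 3) (0≤-by (sym (trans (cong₂ (λ q s → + 8 * q - s * s - 1ℤ) Q≡ S≡) (lem′ (e - + i + b′) b′))) (pos i i≤7))))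
          where
          lem : ∀ x b → + 2 * x + + 2 * b ≡ + 2 * (x + b)
          lem = solve-∀
          Q≡ : Q i ≡ + 2 * (e - + i + b′)
          Q≡ = trans (cong (λ z → + 2 * (e - + i) + z) S≡) (lem (e - + i) b′)
          lem′ : ∀ a b → + 8 * (+ 2 * a) - + 2 * b * (+ 2 * b) - 1ℤ ≡ + 4 * (+ 4 * a - b * b) - 1ℤ
          lem′ = solve-∀

        4-choice : ∀ γ ν → b ≡ + 2 * (+ 2 * γ) → m ≡ + 2 * (+ 2 * ν) → Choice
        4-choice γ ν b≡ m≡ with κ-choice e γ ν
        ... | i , i≤7 , h = i , i≤7 , subst₂ Representable (sym Q≡) (sym S≡) (go h)
          where
          x = γ + ν * + i
          a = e - + i + + 2 * x
          S≡ : S i ≡ + 2 * (+ 2 * x)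
          S≡ = trans (cong₂ (λ b m → b + m * + i) b≡ m≡) (lem γ ν (+ i))
            where
            lem : ∀ γ ν i → + 2 * (+ 2 * γ) + + 2 * (+ 2 * ν) * i ≡ + 2 * (+ 2 * (γ + ν * i))
            lem = solve-∀
          Q≡ : Q i ≡ + 2 * a
          Q≡ = trans (cong (λ z → + 2 * (e - + i) + z) S≡) (lem (e - + i) x)
            where
            lem : ∀ y x → + 2 * y + + 2 * (+ 2 * x) ≡ + 2 * (y + + 2 * x)
            lem = solve-∀
          k≥1 : 0ℤ ≤ a - x * x - 1ℤ
          k≥1 = pos-cancel (+ 16) (a - x * x) (nat≥0 15) (0≤-by (sym (trans (cong₂ (λ q s → + 8 * q - s * s - 1ℤ) Q≡ S≡) (lem a x))) (pos i i≤7))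
            where
            lem : ∀ a x → + 8 * (+ 2 * a) - + 2 * (+ 2 * x) * (+ 2 * (+ 2 * x)) - 1ℤ ≡ + 16 * (a - x * x) - 1ℤ
            lem = solve-∀
          go : Odd (κ e γ ν (+ i)) ⊎ (Odd x × κ e γ ν (+ i) ≈ + 4 [mod + 8 ]) → Representable (+ 2 * a) (+ 2 * (+ 2 * x))
          go (inj₁ o) = representable-4-odd {a} {x} o k≥1
          go (inj₂ (o , f)) = representable-4-even {a} {x} o f k≥1

        at-0 : ∀ c b → b ≡ b + c * 0ℤ
        at-0 = solve-∀

        at-1 : ∀ k j → + 2 * k + (+ 2 * j + 1ℤ) * 1ℤ ≡ + 2 * (k + j) + 1ℤ
        at-1 = solve-∀

        m-even : ∀ μ β → m ≡ + 2 * μ → b ≡ + 2 * β → Choice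
        m-even μ β m≡ b≡ with parity β | parity μ
        ... | inj₂ o | _ = 2odd-choice 0 0≤7 β (trans (sym (at-0 m b)) b≡) o
        ... | inj₁ (γ , refl) | inj₁ (ν , refl) = 4-choice γ ν b≡ m≡
        ... | inj₁ (γ , refl) | inj₂ (ν , refl) = 2odd-choice 1 1≤7 (+ 2 * γ + (+ 2 * ν + 1ℤ) * 1ℤ)
              (trans (cong₂ (λ b m → b + m * 1ℤ) b≡ m≡) (lem (+ 2 * γ) (+ 2 * ν + 1ℤ))) (γ + ν , at-1 γ ν)
          where
          lem : ∀ x y → + 2 * x + + 2 * y * 1ℤ ≡ + 2 * (x + y * 1ℤ)
          lem = solve-∀

      -- If b or m is odd, i = 0 or i = 1 makes the sum odd. If both are even but not both divisible
      -- by 4, i = 0 or i = 1 makes it twice an odd number. Only when 4 divides both can larger i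
      -- occur.
      representable-choice : Choice
      representable-choice with parity b | parity m
      ... | inj₂ (k , b≡) | _ = odd-choice 0 0≤7 (k , trans (sym (at-0 m b)) b≡)
      ... | inj₁ (β , b≡) | inj₁ (μ , m≡) = m-even μ β m≡ b≡
      ... | inj₁ (β , b≡) | inj₂ (μ , m≡) = odd-choice 1 1≤7 (β + μ , trans (cong₂ (λ b m → b + m * 1ℤ) b≡ m≡) (at-1 β μ))

  polygonal-representation : ∀ m N → 3 ℕ.≤ m → 1056 ℕ.* m ℕ.^ 3 ℕ.≤ N →
    ∃[ x₁ ] ∃[ x₂ ] ∃[ x₃ ] ∃[ x₄ ]
      (polygonal m x₁ ℕ.+ polygonal m x₂ ℕ.+ 2 ℕ.* polygonal m x₃ ℕ.+ 4 ℕ.* polygonal m x₄ ≡ N)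
  polygonal-representation m N 3≤m large = go (window m N 3≤m large′)
    where
    m³ : + (m ℕ.^ 3) ≡ + m * + m * + m
    m³ = trans (cong (λ z → + (m ℕ.* (m ℕ.* z))) (ℕ.*-identityʳ m)) (trans (pos-* m (m ℕ.* m)) (trans (cong (+ m *_) (pos-* m m)) (sym (*-assoc (+ m) (+ m) (+ m)))))
    large′ : 0ℤ ≤ + N - + 1056 * (+ m * + m * + m)
    large′ = ≤⇒0≤ (subst (_≤ + N) (trans (pos-* 1056 (m ℕ.^ 3)) (cong (+ 1056 *_) m³)) (+≤+ large))
    go : Window (+ m) (+ N) → _
    go W = pick (representable-choice (+ m) b₀ e₀ b²<8a)
      where
      open Window W
      pick : ∃[ i ] (i ℕ.≤ 7 × Representable (squaresAt (+ m) b₀ e₀ i) (sumAt (+ m) b₀ i)) → _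
      pick (i , i≤7 , R) = assemble (representable-ℕ (0≤-+ b₀≥0 (0≤-* (nat≥0 m) (nat≥0 i))) (7a<b² i i≤7) R)
        where
        assemble : _ → _
        assemble (x₁ , x₂ , x₃ , x₄ , b≡ , a≡) = x₁ , x₂ , x₃ , x₄ , polygonal-sum m N (e₀ - + i) x₁ x₂ x₃ x₄
          (trans a≡ (cong (λ z → + 2 * (e₀ - + i) + z) (sym b≡)))
          (trans N≡ (trans (lem b₀ (+ m) e₀ (+ i)) (cong (_+ + m * (e₀ - + i)) (sym b≡))))
          where
          lem : ∀ b m e i → b + m * e ≡ b + m * i + m * (e - i)
          lem = solve-∀

open Proof using (polygonal-representation)

open import Defs
open import Data.Nat using (ℕ; _+_; _*_; _^_; _≤_)
open import Data.Product using (∃-syntax; Σ-syntax)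
open import Relation.Binary.PropositionalEquality using (_≡_)

theorem1p4 : (m : ℕ) → 3 ≤ m → (N : ℕ) → 1056 * m ^ 3 ≤ N →
    ∃[ x₁ ] ∃[ x₂ ] ∃[ x₃ ] ∃[ x₄ ]
    (polygonal m x₁ + polygonal m x₂ + 2 * polygonal m x₃ + 4 * polygonal m x₄ ≡ N)
theorem1p4 m 3≤m N large = polygonal-representation m N 3≤m large
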